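{- Let $G$ be an exceptional strongly regular graph with parameters $(v,k,\lambda,\mu)$. Then $k/\Lambda(G) > v^{1/10}/2$.
   Context: A graph is strongly regular with parameters $(v,k,\lambda,\mu)$ if it is a $k$-regular graph on $v$ vertices such that each edge lies in exactly $\lambda$ triangles and any two non-adjacent vertices have exactly $\mu$ common neighbours; complete and empty graphs are excluded. For a $k$-regular graph $G$ on $v$ vertices with adjacency eigenvalues $k=\lambda_1\ge\lambda_2\ge\dots\ge\lambda_v$, set $\Lambda(G)=\max\{|\lambda_i| : 2\le i\le v\}$. The non-exceptional classes of connected strongly regular graphs are: (i) complete multipartite graphs $K_{m,m,\dots,m}$ ($n$ parts of size $m$); (ii) Latin square graphs: given $m-2$ mutually orthogonal Latin squares of order $n$ (with $m=2$ allowed, i.e. no squares), the vertices are the $n^2$ cells, two cells being adjacent if they lie in the same row or the same column or have the same entry in one of the squares; (iii) Steiner graphs: the vertices are the blocks of a Steiner system $S(2,m,n)$ (a family of $m$-subsets of an $n$-set such that any two elements of the $n$-set lie in exactly one block; $m=2$ allowed), two blocks being adjacent iff they intersect. A connected strongly regular graph is called exceptional if it is not a complete multipartite graph, not a Steiner graph and not a Latin square graph. -}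

module Defs where

open import Level using (0ℓ)
open import Data.Nat as ℕ using (ℕ; zero; suc)
open import Data.Bool using (Bool; true; false; _∧_; if_then_else_)
open import Data.Fin using (Fin; zero; suc)
open import Data.Fin.Subset using (Subset; _∈_; ∣_∣)
open import Data.Product using (Σ; ∃; ∃-syntax; _×_; _,_)
open import Data.Sum using (_⊎_)
open import Relation.Nullary using (¬_)
open import Relation.Binary.PropositionalEquality using (_≡_; _≢_)
open import Algebra.Structures using (IsCommutativeRing)
open import Relation.Binary.Structures using (IsTotalOrder)

record Graph (v : ℕ) : Set where
  field
    adj   : Fin v → Fin v → Bool
    sym   : ∀ i j → adj i j ≡ adj j i
    irrefl : ∀ i → adj i i ≡ false
open Graph public

count : ∀ {n} → (Fin n → Bool) → ℕ
count {zero}  p = zero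
count {suc n} p = (if p zero then 1 else 0) ℕ.+ count (λ i → p (suc i))

degree : ∀ {v} → Graph v → Fin v → ℕ
degree G i = count (adj G i)

commonNeighbours : ∀ {v} → Graph v → Fin v → Fin v → ℕ
commonNeighbours G i j = count (λ w → adj G i w ∧ adj G j w)

record IsSRG {v : ℕ} (G : Graph v) (k l m : ℕ) : Set where
  field
    regular    : ∀ i → degree G i ≡ k
    edgeParam  : ∀ i j → i ≢ j → adj G i j ≡ true → commonNeighbours G i j ≡ l
    nonEdgeParam : ∀ i j → i ≢ j → adj G i j ≡ false → commonNeighbours G i j ≡ m
    notEmpty    : ∃[ i ] ∃[ j ] adj G i j ≡ true
    notComplete : ∃[ i ] ∃[ j ] (i ≢ j × adj G i j ≡ false)

data Reach {v : ℕ} (G : Graph v) : Fin v → Fin v → Set where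
  here : ∀ {i} → Reach G i i
  step : ∀ {i j w} → adj G i j ≡ true → Reach G j w → Reach G i w

Connected : ∀ {v} → Graph v → Set
Connected G = ∀ i j → Reach G i j

record IsoTo {v : ℕ} (G : Graph v) (V : Set) (R : V → V → Set) : Set where
  field
    to      : Fin v → V
    from    : V → Fin v
    from-to : ∀ i → from (to i) ≡ i
    to-from : ∀ x → to (from x) ≡ x
    adj→R   : ∀ i j → adj G i j ≡ true → R (to i) (to j)
    R→adj   : ∀ i j → R (to i) (to j) → adj G i j ≡ true

MultipartiteAdj : (n m : ℕ) → Fin n × Fin m → Fin n × Fin m → Set
MultipartiteAdj n m (a , _) (b , _) = a ≢ b

IsCompleteMultipartite : ∀ {v} → Graph v → Set
IsCompleteMultipartite G =
  ∃[ n ] ∃[ m ] IsoTo G (Fin n × Fin m) (MultipartiteAdj n m)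

-- (ii) Latin square graphs from t = m-2 mutually orthogonal Latin squares of order n

record MOLS (t n : ℕ) : Set where
  field
    sq : Fin t → Fin n → Fin n → Fin n      -- sq a row col = entry
    rowLatin : ∀ a r c c' → sq a r c ≡ sq a r c' → c ≡ c'
    colLatin : ∀ a r r' c → sq a r c ≡ sq a r' c → r ≡ r'
    orthogonal : ∀ a b → a ≢ b → ∀ r c r' c' →
      sq a r c ≡ sq a r' c' → sq b r c ≡ sq b r' c' → (r ≡ r' × c ≡ c')
open MOLS public

LatinAdj : ∀ {t n} → MOLS t n → Fin n × Fin n → Fin n × Fin n → Set
LatinAdj L (r , c) (r' , c') =
  (r , c) ≢ (r' , c') ×
  (r ≡ r' ⊎ c ≡ c' ⊎ ∃[ a ] sq L a r c ≡ sq L a r' c')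

IsLatinSquareGraph : ∀ {v} → Graph v → Set
IsLatinSquareGraph G =
  ∃[ t ] ∃[ n ] Σ (MOLS t n) λ L → IsoTo G (Fin n × Fin n) (LatinAdj L)

record SteinerSystem (m n b : ℕ) : Set where
  field
    two≤m   : 2 ℕ.≤ m
    block   : Fin b → Subset n
    blockSize : ∀ β → ∣ block β ∣ ≡ m
    distinct  : ∀ β γ → block β ≡ block γ → β ≡ γ
    cover     : ∀ x y → x ≢ y → ∃[ β ] (x ∈ block β × y ∈ block β)
    unique    : ∀ x y → x ≢ y → ∀ β γ →
      x ∈ block β → y ∈ block β → x ∈ block γ → y ∈ block γ → β ≡ γ
open SteinerSystem public

SteinerAdj : ∀ {m n b} → SteinerSystem m n b → Fin b → Fin b → Set
SteinerAdj S β γ = β ≢ γ × ∃[ x ] (x ∈ block S β × x ∈ block S γ)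

IsSteinerGraph : ∀ {v} → Graph v → Set
IsSteinerGraph G =
  ∃[ m ] ∃[ n ] ∃[ b ] Σ (SteinerSystem m n b) λ S → IsoTo G (Fin b) (SteinerAdj S)

Exceptional : ∀ {v} → Graph v → Set
Exceptional G =
  Connected G × ¬ IsCompleteMultipartite G × ¬ IsLatinSquareGraph G × ¬ IsSteinerGraph G

record OrderedField : Set₁ where
  infixl 6 _+_
  infixl 7 _*_
  infix 4 _≤_
  field
    Carrier : Set
    _+_ _*_ : Carrier → Carrier → Carrier
    -_      : Carrier → Carrier
    0# 1#   : Carrier
    _≤_     : Carrier → Carrier → Set
    isCommutativeRing : IsCommutativeRing _≡_ _+_ _*_ -_ 0# 1#
    0≢1     : 0# ≢ 1#
    inverse : ∀ x → x ≢ 0# → ∃[ y ] x * y ≡ 1#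
    isTotalOrder : IsTotalOrder _≡_ _≤_
    +-mono  : ∀ x y z → x ≤ y → x + z ≤ y + z
    *-pos   : ∀ x y → 0# ≤ x → 0# ≤ y → 0# ≤ x * y

  _<_ : Carrier → Carrier → Set
  x < y = x ≤ y × x ≢ y

  fromℕ : ℕ → Carrier
  fromℕ zero    = 0#
  fromℕ (suc n) = 1# + fromℕ n

  _^_ : Carrier → ℕ → Carrier
  x ^ zero  = 1#
  x ^ suc n = x * (x ^ n)

  sumFin : ∀ {n} → (Fin n → Carrier) → Carrier
  sumFin {zero}  f = 0#
  sumFin {suc n} f = f zero + sumFin (λ i → f (suc i))

  b2F : Bool → Carrier
  b2F true  = 1#
  b2F false = 0#

module _ (F : OrderedField) where
  open OrderedField F

  adjApply : ∀ {v} → Graph v → (Fin v → Carrier) → Fin v → Carrier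
  adjApply G x i = sumFin (λ j → b2F (adj G i j) * x j)

  IsEigenvalue : ∀ {v} → Graph v → Carrier → Set
  IsEigenvalue {v} G θ = ∃[ x ] ((∃[ i ] x i ≢ 0#) × (∀ i → adjApply G x i ≡ θ * x i))

{-# OPTIONS --safe #-}
-- Suppose v θ¹⁰ ≥ (2k)¹⁰; since the order is total, it suffices to reach a contradiction, so the
-- argument may be classical. The multiplicities f and g of θ and of the other root σ are traces of
-- symmetric idempotents, hence natural numbers, and tr A = 0 makes θ an integer unless f = g. In the
-- latter case G is a conference graph and θ² ≤ 4μ suffices. Bessel's inequality in V ⊗ V yields the
-- absolute bound g ≤ f², so that v ≤ 1 + f + f².
--
-- If θ = -m < 0, then either the complement has degree at least 2k and the Krein condition
-- Σ E_ij³ ≥ 0 gives m³ ≤ 2k², or v ≤ 3k and the absolute bound applies; σ = 0 is the complete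
-- multipartite case.
--
-- If θ = r > 0 and σ = -m, the absolute bound forces r ≥ 17 m² μ. By Bose's claw argument G is then the
-- collinearity graph of a partial linear space with m lines on each point, and A + m I = N Nᵀ makes
-- this space a partial geometry: a point off a line L is collinear with T ≤ m points of L.
-- T = m is the dual of a Steiner system, T = m - 1 a net, and for T ≤ m - 2 the integrality of f
-- gives r + m ≤ m⁴, while v ≤ 2k² forces r > m⁴.
module Submission where

open import Defs renaming (sym to adj-sym)
open import Data.Fin using (Fin; zero; suc) renaming (_≟_ to _≟ᶠ_)
open import Data.Bool using (Bool; true; false; _∧_; _∨_; not)
open import Data.Product using (∃-syntax; _×_; _,_; proj₁; proj₂)
open import Data.Sum using (_⊎_; inj₁; inj₂)
open import Data.Empty using (⊥; ⊥-elim)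
open import Relation.Nullary using (¬_; Dec; yes; no)
open import Relation.Binary.PropositionalEquality

-- The field is an arbitrary ordered one, with neither square roots nor decidable equality, so
-- eigenbases and dimensions are avoided. By Vieta the second root is σ = l - μ - θ; the projections
-- onto the two eigenspaces are explicit combinations of I, A and J; and whatever is needed about
-- multiplicities is a statement about their traces. The absolute bound requires a non-zero Krein
-- parameter, whose sign is settled separately for θ = r and θ = -m. The exponent 10 and the factor
-- 2 are dictated by the case θ = r. There v ≤ 3 f² by the absolute bound, f r² ≤ v k by the trace
-- equation, and r m ≤ k. If v ≤ c m³ k, these combine to v r¹⁰ ≤ 3 c² k⁴ (r m)⁶ ≤ 3 c² k¹⁰, which
-- contradicts v r¹⁰ ≥ 2¹⁰ k¹⁰ as long as 3 c² < 1024; this allows c = 18. Hence v > 18 m³ k, and as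
-- μ k′ = k (r + 1)(m - 1), this makes r at least 17 m² μ. All errors in the claw counts are small
-- multiples of m μ, so they are negligible against l.

-- Counting with Boolean predicates on finite sets.

module FiniteCounting where
  open import Data.Nat
  open import Data.Nat.Properties
  open import Data.Bool.Properties using (∧-distribˡ-∨; ∧-zeroʳ)
  open import Relation.Nullary.Decidable using (does; dec-true; dec-false)

  infix 4 _==_
  _==_ : ∀ {n} → Fin n → Fin n → Bool
  i == j = does (i ≟ᶠ j)

  ==-refl : ∀ {n} (i : Fin n) → (i == i) ≡ true
  ==-refl i = dec-true (i ≟ᶠ i) refl

  ==⇒≡ : ∀ {n} {i j : Fin n} → (i == j) ≡ true → i ≡ j
  ==⇒≡ {i = i} {j} e with i ≟ᶠ j
  ... | yes i≡j = i≡j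

  ≢⇒== : ∀ {n} {i j : Fin n} → i ≢ j → (i == j) ≡ false
  ≢⇒== {i = i} {j} = dec-false (i ≟ᶠ j)

  ∧-intro : ∀ {a b} → a ≡ true → b ≡ true → a ∧ b ≡ true
  ∧-intro refl refl = refl

  ∧-elim : ∀ {a b} → a ∧ b ≡ true → a ≡ true × b ≡ true
  ∧-elim {true} {true} e = refl , refl

  ∨-introˡ : ∀ {a b} → a ≡ true → a ∨ b ≡ true
  ∨-introˡ refl = refl

  ∨-introʳ : ∀ {a b} → b ≡ true → a ∨ b ≡ true
  ∨-introʳ {true}  e = refl
  ∨-introʳ {false} e = e

  ∨-elim : ∀ {a b} → a ∨ b ≡ true → a ≡ true ⊎ b ≡ true
  ∨-elim {true}  e = inj₁ refl
  ∨-elim {false} e = inj₂ e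

  not-intro : ∀ {a} → a ≡ false → not a ≡ true
  not-intro refl = refl

  not-elim : ∀ {a} → not a ≡ true → a ≡ false
  not-elim {false} e = refl

  true≢false : ∀ {a} → a ≡ true → a ≡ false → ⊥
  true≢false refl ()

  bool : ∀ a → a ≡ true ⊎ a ≡ false
  bool true  = inj₁ refl
  bool false = inj₂ refl

  bool-ext : ∀ {a b} → (a ≡ true → b ≡ true) → (b ≡ true → a ≡ true) → a ≡ b
  bool-ext {true}  {true}  f g = refl
  bool-ext {true}  {false} f g = sym (f refl)
  bool-ext {false} {true}  f g = g refl
  bool-ext {false} {false} f g = refl

  count-mono : ∀ {n} (p q : Fin n → Bool) → (∀ i → p i ≡ true → q i ≡ true) → count p ≤ count q
  count-mono {zero}  p q h = z≤n
  count-mono {suc n} p q h with p zero in e₁ | q zero in e₂ | count-mono (λ i → p (suc i)) (λ i → q (suc i)) (λ i → h (suc i))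
  ... | true  | true  | ih = s≤s ih
  ... | true  | false | ih = ⊥-elim (true≢false (h zero e₁) e₂)
  ... | false | true  | ih = m≤n⇒m≤1+n ih
  ... | false | false | ih = ih

  count-cong : ∀ {n} (p q : Fin n → Bool) → (∀ i → p i ≡ q i) → count p ≡ count q
  count-cong p q h = ≤-antisym (count-mono p q λ i e → trans (sym (h i)) e) (count-mono q p λ i e → trans (h i) e)

  count-∨-∧ : ∀ {n} (p q : Fin n → Bool) → count (λ i → p i ∨ q i) + count (λ i → p i ∧ q i) ≡ count p + count q
  count-∨-∧ {zero}  p q = refl
  count-∨-∧ {suc n} p q with p zero | q zero | count-∨-∧ (λ i → p (suc i)) (λ i → q (suc i))
  ... | true  | true  | ih = cong suc (trans (+-suc _ _) (trans (cong suc ih) (sym (+-suc _ _))))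
  ... | true  | false | ih = cong suc ih
  ... | false | true  | ih = trans (cong suc ih) (sym (+-suc _ _))
  ... | false | false | ih = ih

  count-split : ∀ {n} (p q : Fin n → Bool) → count p ≡ count (λ i → p i ∧ q i) + count (λ i → p i ∧ not (q i))
  count-split {zero}  p q = refl
  count-split {suc n} p q with p zero | q zero | count-split (λ i → p (suc i)) (λ i → q (suc i))
  ... | true  | true  | ih = cong suc ih
  ... | true  | false | ih = trans (cong suc ih) (sym (+-suc _ _))
  ... | false | true  | ih = ih
  ... | false | false | ih = ih

  count-cover : ∀ {n} (p q r : Fin n → Bool) → (∀ i → p i ≡ true → q i ≡ true ⊎ r i ≡ true) → count p ≤ count q + count r
  count-cover p q r h = ≤-trans (count-mono p (λ i → q i ∨ r i) λ i e → pick i (h i e))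
      (≤-trans (m≤m+n _ _) (≤-reflexive (count-∨-∧ q r)))
    where
    pick : ∀ i → q i ≡ true ⊎ r i ≡ true → q i ∨ r i ≡ true
    pick i (inj₁ e) = ∨-introˡ e
    pick i (inj₂ e) = ∨-introʳ e

  count-empty : ∀ {n} (p : Fin n → Bool) → (∀ i → p i ≡ false) → count p ≡ 0
  count-empty {zero}  p h = refl
  count-empty {suc n} p h rewrite h zero = count-empty (λ i → p (suc i)) (λ i → h (suc i))

  count-∧-∨ : ∀ {n} (p q r : Fin n → Bool) →
    count (λ i → p i ∧ (q i ∨ r i)) ≤ count (λ i → p i ∧ q i) + count (λ i → p i ∧ r i)
  count-∧-∨ p q r = count-cover _ (λ i → p i ∧ q i) (λ i → p i ∧ r i) λ i e → ∨-elim (trans (sym (∧-distribˡ-∨ (p i) (q i) (r i))) e)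

  count-∧-false : ∀ {n} (p : Fin n → Bool) → count (λ i → p i ∧ false) ≡ 0
  count-∧-false p = count-empty _ λ i → ∧-zeroʳ (p i)

  count-disjoint : ∀ {n} (p q r : Fin n → Bool) → (∀ i → q i ≡ true → p i ≡ true) → (∀ i → r i ≡ true → p i ≡ true) →
    (∀ i → q i ≡ true → r i ≡ true → ⊥) → count q + count r ≤ count p
  count-disjoint p q r f g h = begin
    count q + count r                                     ≡⟨ sym (count-∨-∧ q r) ⟩
    count (λ i → q i ∨ r i) + count (λ i → q i ∧ r i)     ≡⟨ cong (count (λ i → q i ∨ r i) +_) (count-empty _ ∧-empty) ⟩
    count (λ i → q i ∨ r i) + 0                           ≡⟨ +-identityʳ _ ⟩
    count (λ i → q i ∨ r i)                               ≤⟨ count-mono (λ i → q i ∨ r i) p (λ i e → either i (∨-elim e)) ⟩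
    count p                                               ∎
    where
    open ≤-Reasoning
    either : ∀ i → q i ≡ true ⊎ r i ≡ true → p i ≡ true
    either i (inj₁ e) = f i e
    either i (inj₂ e) = g i e
    ∧-empty : ∀ i → q i ∧ r i ≡ false
    ∧-empty i = bool-ext (λ e → ⊥-elim (h i (proj₁ (∧-elim e)) (proj₂ (∧-elim e)))) λ ()

  count-== : ∀ {n} (x : Fin n) → count (x ==_) ≡ 1
  count-== {suc n} zero    = cong suc (count-empty {n} (λ i → zero == suc i) (λ _ → refl))
  count-== {suc n} (suc x) = trans (count-cong (λ i → suc x == suc i) (x ==_) λ i → bool-ext (λ e → same i e)
      (λ e → trans (cong (λ j → suc x == suc j) (sym (==⇒≡ e))) (==-refl (suc x)))) (count-== x)
    where
    same : ∀ i → (suc x == suc i) ≡ true → (x == i) ≡ true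
    same i e with ==⇒≡ {i = suc x} {suc i} e
    ... | refl = ==-refl x

  count-inhabited : ∀ {n} (p : Fin n → Bool) → 1 ≤ count p → ∃[ i ] p i ≡ true
  count-inhabited {suc n} p h with p zero in e
  ... | true  = zero , e
  ... | false = let (i , e′) = count-inhabited (λ i → p (suc i)) h in suc i , e′

  inhabited-count : ∀ {n} (p : Fin n → Bool) i → p i ≡ true → 1 ≤ count p
  inhabited-count p i e = subst (_≤ count p) (count-== i) (count-mono (i ==_) p λ j i≡j → subst (λ z → p z ≡ true) (==⇒≡ i≡j) e)

  count-< : ∀ {n} (p q : Fin n → Bool) → count q < count p → ∃[ i ] (p i ≡ true × q i ≡ false)
  count-< p q h with count-inhabited (λ i → p i ∧ not (q i)) (≮⇒≥ λ none → <⇒≱ h (begin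
      count p                                                       ≡⟨ count-split p q ⟩
      count (λ i → p i ∧ q i) + count (λ i → p i ∧ not (q i))       ≡⟨ cong (count (λ i → p i ∧ q i) +_) (n<1⇒n≡0 none) ⟩
      count (λ i → p i ∧ q i) + 0                                   ≡⟨ +-identityʳ _ ⟩
      count (λ i → p i ∧ q i)                                       ≤⟨ count-mono (λ i → p i ∧ q i) q (λ i e → proj₂ (∧-elim {p i} e)) ⟩
      count q                                                       ∎))
    where open ≤-Reasoning
  ... | i , e = i , proj₁ (∧-elim e) , not-elim (proj₂ (∧-elim {p i} e))

  count-full : ∀ n → count {n} (λ _ → true) ≡ n
  count-full zero    = refl
  count-full (suc n) = cong suc (count-full n)

  count-≤1 : ∀ {n} (p : Fin n → Bool) → (∀ i j → p i ≡ true → p j ≡ true → i ≡ j) → count p ≤ 1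
  count-≤1 p h with 1 ≤? count p
  ... | no  none = ≤-trans (≤-pred (≰⇒> none)) z≤n
  ... | yes some = let (i , pi) = count-inhabited p some in
    subst (count p ≤_) (count-== i) (count-mono p (i ==_) λ j pj → trans (cong (i ==_) (sym (h i j pi pj))) (==-refl i))

  two-members : ∀ {n} (p : Fin n → Bool) {i j} → p i ≡ true → p j ≡ true → i ≢ j → 2 ≤ count p
  two-members p {i} {j} pi pj i≢j = ≤-trans (≤-reflexive (sym (cong₂ _+_ (count-== i) (count-== j))))
    (count-disjoint p (i ==_) (j ==_) (λ w e → subst (λ z → p z ≡ true) (==⇒≡ e) pi) (λ w e → subst (λ z → p z ≡ true) (==⇒≡ e) pj)
      (λ w e e′ → i≢j (trans (==⇒≡ e) (sym (==⇒≡ e′)))))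

-- Ordered fields: the embedded integers, inequalities and finite sums.

module FieldProperties (F : OrderedField) where
  open import Level using (0ℓ)
  open import Algebra.Bundles using (CommutativeRing)
  import Algebra.Solver.Ring
  import Algebra.Properties.Ring
  open import Algebra.Solver.Ring.AlmostCommutativeRing using (fromCommutativeRing; _-Raw-AlmostCommutative⟶_)
  open import Data.Nat as ℕ using (ℕ; zero; suc; z≤n; s≤s)
  import Data.Nat.Properties as ℕ
  open import Data.Integer as ℤ using (ℤ; -[1+_])
  import Data.Integer.Properties as ℤ
  open import Data.Maybe using (Maybe; just; nothing)
  open OrderedField F public hiding (_<_)

  ring : CommutativeRing 0ℓ 0ℓ
  ring = record { isCommutativeRing = isCommutativeRing }

  open CommutativeRing ring public
    using (+-comm; +-assoc; *-comm; *-assoc; +-identityˡ; +-identityʳ; *-identityˡ; *-identityʳ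
          ; zeroˡ; zeroʳ; distribˡ; distribʳ; -‿inverseˡ; -‿inverseʳ; _-_)
  import Algebra.Properties.Semiring.Sum (CommutativeRing.semiring ring) as Sum
  open import Relation.Binary.Structures using (IsTotalOrder)
  open IsTotalOrder isTotalOrder public
    using (total) renaming (refl to ≤-refl; trans to ≤-trans; antisym to ≤-antisym; reflexive to ≤-reflexive)
  open Algebra.Properties.Ring (CommutativeRing.ring ring) using (-0#≈0#; -‿distribˡ-*; -‿distribʳ-*; -‿involutive)

  fromℤ : ℤ → Carrier
  fromℤ (ℤ.+ n)    = fromℕ n
  fromℤ -[1+ n ] = - fromℕ (suc n)

  private
    cancel₁ : ∀ a b → a - b ≡ (1# + a) - (1# + b)
    cancel₁ a b = sym (begin
      (1# + a) + - (1# + b)        ≡⟨ cong ((1# + a) +_) (sym (⁻¹-∙-comm 1# b)) ⟩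
      (1# + a) + (- 1# + - b)      ≡⟨ cong (_+ (- 1# + - b)) (+-comm 1# a) ⟩
      (a + 1#) + (- 1# + - b)      ≡⟨ +-assoc a 1# _ ⟩
      a + (1# + (- 1# + - b))      ≡⟨ cong (a +_) (sym (+-assoc 1# (- 1#) (- b))) ⟩
      a + ((1# + - 1#) + - b)      ≡⟨ cong (λ z → a + (z + - b)) (-‿inverseʳ 1#) ⟩
      a + (0# + - b)               ≡⟨ cong (a +_) (+-identityˡ (- b)) ⟩
      a + - b ∎)
      where
      open ≡-Reasoning
      open import Algebra.Properties.AbelianGroup (CommutativeRing.+-abelianGroup ring) using (⁻¹-∙-comm)

    fromℤ-⊖ : ∀ m n → fromℤ (m ℤ.⊖ n) ≡ fromℕ m - fromℕ n
    fromℤ-⊖ zero    zero    = sym (-‿inverseʳ 0#)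
    fromℤ-⊖ zero    (suc n) = sym (+-identityˡ _)
    fromℤ-⊖ (suc m) zero    = sym (trans (cong (fromℕ (suc m) +_) -0#≈0#) (+-identityʳ _))
    fromℤ-⊖ (suc m) (suc n) =
      trans (cong fromℤ (ℤ.[1+m]⊖[1+n]≡m⊖n m n)) (trans (fromℤ-⊖ m n) (cancel₁ _ _))

  fromℕ-+ : ∀ m n → fromℕ (m ℕ.+ n) ≡ fromℕ m + fromℕ n
  fromℕ-+ zero    n = sym (+-identityˡ _)
  fromℕ-+ (suc m) n = trans (cong (1# +_) (fromℕ-+ m n)) (sym (+-assoc _ _ _))

  fromℕ-* : ∀ m n → fromℕ (m ℕ.* n) ≡ fromℕ m * fromℕ n
  fromℕ-* zero    n = sym (zeroˡ _)
  fromℕ-* (suc m) n = trans (fromℕ-+ n (m ℕ.* n))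
    (trans (cong₂ _+_ (sym (*-identityˡ _)) (fromℕ-* m n)) (sym (distribʳ _ _ _)))

  fromℕ-^ : ∀ m n → fromℕ (m ℕ.^ n) ≡ fromℕ m ^ n
  fromℕ-^ m zero    = +-identityʳ 1#
  fromℕ-^ m (suc n) = trans (fromℕ-* m (m ℕ.^ n)) (cong (fromℕ m *_) (fromℕ-^ m n))

  fromℤ-neg : ∀ i → fromℤ (ℤ.- i) ≡ - fromℤ i
  fromℤ-neg (ℤ.+ zero)  = sym -0#≈0#
  fromℤ-neg (ℤ.+ suc n) = refl
  fromℤ-neg -[1+ n ]  = sym (-‿involutive _)

  fromℤ-+ : ∀ i j → fromℤ (i ℤ.+ j) ≡ fromℤ i + fromℤ j
  fromℤ-+ (ℤ.+ m)    (ℤ.+ n)    = fromℕ-+ m n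
  fromℤ-+ (ℤ.+ m)    -[1+ n ] = fromℤ-⊖ m (suc n)
  fromℤ-+ -[1+ m ] (ℤ.+ n)    = trans (fromℤ-⊖ n (suc m)) (+-comm _ _)
  fromℤ-+ -[1+ m ] -[1+ n ] = trans (cong (λ z → - fromℕ (suc z)) (sym (ℕ.+-suc m n)))
    (trans (cong -_ (fromℕ-+ (suc m) (suc n))) (sym (⁻¹-∙-comm _ _)))
    where open import Algebra.Properties.AbelianGroup (CommutativeRing.+-abelianGroup ring) using (⁻¹-∙-comm)

  private
    fromℤ-*⁺ : ∀ m j → fromℤ (ℤ.+ m ℤ.* j) ≡ fromℕ m * fromℤ j
    fromℤ-*⁺ m (ℤ.+ n)    = trans (cong fromℤ (sym (ℤ.pos-* m n))) (fromℕ-* m n)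
    fromℤ-*⁺ m -[1+ n ] = begin
      fromℤ (ℤ.+ m ℤ.* -[1+ n ])        ≡⟨ cong fromℤ (sym (ℤ.neg-distribʳ-* (ℤ.+ m) (ℤ.+ suc n))) ⟩
      fromℤ (ℤ.- (ℤ.+ m ℤ.* ℤ.+ suc n))   ≡⟨ fromℤ-neg (ℤ.+ m ℤ.* ℤ.+ suc n) ⟩
      - fromℤ (ℤ.+ m ℤ.* ℤ.+ suc n)       ≡⟨ cong -_ (fromℤ-*⁺ m (ℤ.+ suc n)) ⟩
      - (fromℕ m * fromℕ (suc n))     ≡⟨ -‿distribʳ-* _ _ ⟩
      fromℕ m * - fromℕ (suc n)       ∎
      where open ≡-Reasoning

  fromℤ-* : ∀ i j → fromℤ (i ℤ.* j) ≡ fromℤ i * fromℤ j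
  fromℤ-* (ℤ.+ m)    j = fromℤ-*⁺ m j
  fromℤ-* -[1+ m ] j = begin
    fromℤ (-[1+ m ] ℤ.* j)          ≡⟨ cong fromℤ (sym (ℤ.neg-distribˡ-* (ℤ.+ suc m) j)) ⟩
    fromℤ (ℤ.- (ℤ.+ suc m ℤ.* j))     ≡⟨ fromℤ-neg (ℤ.+ suc m ℤ.* j) ⟩
    - fromℤ (ℤ.+ suc m ℤ.* j)         ≡⟨ cong -_ (fromℤ-*⁺ (suc m) j) ⟩
    - (fromℕ (suc m) * fromℤ j)     ≡⟨ -‿distribˡ-* _ _ ⟩
    - fromℕ (suc m) * fromℤ j       ∎
    where open ≡-Reasoning

  private
    -- fromℤ sends 1 to 1# + 0#; the solver needs constants that reduce to 1# itself.
    coeff : ℤ → Carrier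
    coeff (ℤ.+ 0)           = 0#
    coeff (ℤ.+ 1)           = 1#
    coeff (ℤ.+ suc (suc n)) = fromℕ (suc (suc n))
    coeff -[1+ n ]          = - fromℕ (suc n)

    coeff≡ : ∀ i → coeff i ≡ fromℤ i
    coeff≡ (ℤ.+ 0)           = refl
    coeff≡ (ℤ.+ 1)           = sym (+-identityʳ 1#)
    coeff≡ (ℤ.+ suc (suc n)) = refl
    coeff≡ -[1+ n ]          = refl

    morphism : ℤ.+-*-rawRing -Raw-AlmostCommutative⟶ fromCommutativeRing ring
    morphism = record
      { ⟦_⟧    = coeff
      ; +-homo = λ i j → trans (coeff≡ (i ℤ.+ j)) (trans (fromℤ-+ i j) (sym (cong₂ _+_ (coeff≡ i) (coeff≡ j))))
      ; *-homo = λ i j → trans (coeff≡ (i ℤ.* j)) (trans (fromℤ-* i j) (sym (cong₂ _*_ (coeff≡ i) (coeff≡ j))))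
      ; -‿homo = λ i → trans (coeff≡ (ℤ.- i)) (trans (fromℤ-neg i) (sym (cong -_ (coeff≡ i))))
      ; 0-homo = refl
      ; 1-homo = refl
      }

    coeff? : ∀ i j → Maybe (coeff i ≡ coeff j)
    coeff? i j with i ℤ.≟ j
    ... | yes i≡j = just (cong coeff i≡j)
    ... | no _    = nothing

  open Algebra.Solver.Ring ℤ.+-*-rawRing (fromCommutativeRing ring) morphism coeff? public
    using (solve; _:+_; _:*_; _:-_; :-_; _:=_; con; Polynomial)

  :0 :1 : ∀ {n} → Polynomial n
  :0 = con (ℤ.+ 0)
  :1 = con (ℤ.+ 1)

  cancel-diff : ∀ {x y} → x - y ≡ 0# → x ≡ y
  cancel-diff {x} {y} p = trans (solve 2 (λ x y → x := (x :- y) :+ y) refl x y) (trans (cong (_+ y) p) (+-identityˡ y))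

  diff≡0 : ∀ {x y} → x ≡ y → x - y ≡ 0#
  diff≡0 refl = -‿inverseʳ _

  -- The solver proves x ≡ y modulo hypotheses a ≡ b once x - y is written as a combination of the a - b.
  by₁ : ∀ {x y a b} c → x - y ≡ c * (a - b) → a ≡ b → x ≡ y
  by₁ c p q = cancel-diff (trans p (trans (cong (c *_) (diff≡0 q)) (zeroʳ c)))

  by₂ : ∀ {x y a b a′ b′} c c′ → x - y ≡ c * (a - b) + c′ * (a′ - b′) → a ≡ b → a′ ≡ b′ → x ≡ y
  by₂ {a = a} {b} c c′ p q q′ = by₁ c (trans p (trans (cong (λ z → c * (a - b) + z) (trans (cong (c′ *_) (diff≡0 q′)) (zeroʳ c′)))
      (+-identityʳ _))) q

  by₃ : ∀ {x y a b a′ b′ a″ b″} c c′ c″ → x - y ≡ c * (a - b) + c′ * (a′ - b′) + c″ * (a″ - b″) →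
    a ≡ b → a′ ≡ b′ → a″ ≡ b″ → x ≡ y
  by₃ {a = a} {b} {a′} {b′} c c′ c″ p q q′ q″ =
    by₂ c c′ (trans p (trans (cong (λ z → c * (a - b) + c′ * (a′ - b′) + z) (trans (cong (c″ *_) (diff≡0 q″)) (zeroʳ c″)))
        (+-identityʳ _))) q q′

  +-monoʳ : ∀ {x y} z → x ≤ y → z + x ≤ z + y
  +-monoʳ z p = subst₂ _≤_ (+-comm _ z) (+-comm _ z) (+-mono _ _ z p)

  +-mono₂ : ∀ {a b c d} → a ≤ b → c ≤ d → a + c ≤ b + d
  +-mono₂ p q = ≤-trans (+-mono _ _ _ p) (+-monoʳ _ q)

  0≤+ : ∀ {x y} → 0# ≤ x → 0# ≤ y → 0# ≤ x + y
  0≤+ {x} {y} p q = subst (_≤ x + y) (+-identityˡ 0#) (+-mono₂ p q)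

  diff-nonneg : ∀ {x y} → x ≤ y → 0# ≤ y - x
  diff-nonneg {x} {y} p = subst (_≤ y - x) (-‿inverseʳ x) (+-mono _ _ (- x) p)

  nonneg-diff : ∀ {x y} → 0# ≤ y - x → x ≤ y
  nonneg-diff {x} {y} p = subst₂ _≤_ (+-identityˡ x) (solve 2 (λ x y → (y :- x) :+ x := y) refl x y) (+-mono _ _ x p)

  neg-nonneg : ∀ {x} → x ≤ 0# → 0# ≤ - x
  neg-nonneg {x} p = subst (0# ≤_) (+-identityˡ (- x)) (diff-nonneg p)

  0≤sq : ∀ x → 0# ≤ x * x
  0≤sq x with total 0# x
  ... | inj₁ p = *-pos x x p p
  ... | inj₂ p = subst (0# ≤_) (solve 1 (λ x → (:- x) :* (:- x) := x :* x) refl x) (*-pos _ _ (neg-nonneg p) (neg-nonneg p))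

  0≤1 : 0# ≤ 1#
  0≤1 = subst (0# ≤_) (*-identityʳ 1#) (0≤sq 1#)

  0≤fromℕ : ∀ n → 0# ≤ fromℕ n
  0≤fromℕ zero    = ≤-refl
  0≤fromℕ (suc n) = 0≤+ 0≤1 (0≤fromℕ n)

  nonneg-sum≡0 : ∀ {x y} → 0# ≤ x → 0# ≤ y → x + y ≡ 0# → x ≡ 0#
  nonneg-sum≡0 {x} {y} p q e = ≤-antisym (subst (x ≤_) e (subst (_≤ x + y) (+-identityʳ x) (+-monoʳ x q))) p

  fromℕ-suc≢0 : ∀ n → fromℕ (suc n) ≢ 0#
  fromℕ-suc≢0 n e = 0≢1 (sym (nonneg-sum≡0 0≤1 (0≤fromℕ n) e))

  fromℕ-cancel-≤ : ∀ {m n} → fromℕ m ≤ fromℕ n → m ℕ.≤ n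
  fromℕ-cancel-≤ {m} {n} p with m ℕ.≤? n
  ... | yes q = q
  ... | no ¬q = ⊥-elim (fromℕ-suc≢0 d (nonneg-sum≡0 (0≤fromℕ (suc d)) (diff-nonneg p)
      (trans (cong (_+ (fromℕ n - fromℕ m)) (refl {x = fromℕ (suc d)}))
      (trans (cong (λ z → fromℕ (suc d) + (fromℕ n - z)) m≡)
          (solve 2 (λ a b → a :+ (b :- (b :+ a)) := :0) refl (fromℕ (suc d)) (fromℕ n))))))
    where
    n<m = ℕ.≰⇒> ¬q
    d = m ℕ.∸ suc n
    m≡ : fromℕ m ≡ fromℕ n + fromℕ (suc d)
    m≡ = trans (cong fromℕ (trans (sym (ℕ.m+[n∸m]≡n n<m)) (sym (ℕ.+-suc n d)))) (fromℕ-+ n (suc d))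

  fromℕ-injective : ∀ {m n} → fromℕ m ≡ fromℕ n → m ≡ n
  fromℕ-injective p = ℕ.≤-antisym (fromℕ-cancel-≤ (≤-reflexive p)) (fromℕ-cancel-≤ (≤-reflexive (sym p)))

  fromℕ-mono-≤ : ∀ {m n} → m ℕ.≤ n → fromℕ m ≤ fromℕ n
  fromℕ-mono-≤ {m} {n} p = subst₂ _≤_ (+-identityʳ _)
    (trans (sym (fromℕ-+ m (n ℕ.∸ m))) (cong fromℕ (ℕ.m+[n∸m]≡n p))) (+-monoʳ (fromℕ m) (0≤fromℕ (n ℕ.∸ m)))

  fromℤ-injective : ∀ {i j} → fromℤ i ≡ fromℤ j → i ≡ j
  fromℤ-injective {i} {j} p = ℤ.i-j≡0⇒i≡j i j (lemma (i ℤ.- j)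
    (trans (fromℤ-+ i (ℤ.- j)) (trans (cong (fromℤ i +_) (fromℤ-neg j)) (diff≡0 p))))
    where
    lemma : ∀ i → fromℤ i ≡ 0# → i ≡ ℤ.+ 0
    lemma (ℤ.+ zero)   _ = refl
    lemma (ℤ.+ suc n)  e = ⊥-elim (fromℕ-suc≢0 n e)
    lemma (-[1+ n ]) e = ⊥-elim (fromℕ-suc≢0 n (trans (sym (-‿involutive _)) (trans (cong -_ e) -0#≈0#)))

  0≢*  : ∀ {x y} → x ≢ 0# → y ≢ 0# → x * y ≢ 0#
  0≢* {x} {y} p q e with inverse x p
  ... | x⁻¹ , xx⁻¹ = q (begin
    y                ≡⟨ sym (*-identityˡ y) ⟩
    1# * y           ≡⟨ cong (_* y) (sym xx⁻¹) ⟩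
    x * x⁻¹ * y      ≡⟨ solve 3 (λ x z y → x :* z :* y := z :* (x :* y)) refl x x⁻¹ y ⟩
    x⁻¹ * (x * y)    ≡⟨ cong (x⁻¹ *_) e ⟩
    x⁻¹ * 0#         ≡⟨ zeroʳ _ ⟩
    0# ∎)
    where open ≡-Reasoning

  *-cancelˡ : ∀ {x y z} → x ≢ 0# → x * y ≡ x * z → y ≡ z
  *-cancelˡ {x} {y} {z} p e = cancel-diff (helper (y - z)
      (trans (solve 3 (λ x y z → x :* (y :- z) := x :* y :- x :* z) refl x y z) (diff≡0 e)))
    where
    helper : ∀ w → x * w ≡ 0# → w ≡ 0#
    helper w xw with inverse x p
    ... | x⁻¹ , xx⁻¹ = trans (sym (*-identityˡ w)) (trans (cong (_* w) (sym xx⁻¹))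
          (trans (solve 3 (λ x z y → x :* z :* y := z :* (x :* y)) refl x x⁻¹ w) (trans (cong (x⁻¹ *_) xw) (zeroʳ _))))

  0<⇒0≤⁻¹ : ∀ {x y} → 0# ≤ x → x * y ≡ 1# → 0# ≤ y
  0<⇒0≤⁻¹ {x} {y} p e = subst (0# ≤_) (trans (solve 2 (λ x y → x :* (y :* y) := (x :* y) :* y) refl x y)
    (trans (cong (_* y) e) (*-identityˡ y))) (*-pos _ _ p (0≤sq y))

  ≤-*-cancelˡ : ∀ {c x y} → 0# ≤ c → c ≢ 0# → c * x ≤ c * y → x ≤ y
  ≤-*-cancelˡ {c} {x} {y} p q r with inverse c q
  ... | d , cd = nonneg-diff (subst (0# ≤_)
        (trans (solve 4 (λ c d x y → d :* (c :* y :- c :* x) := (c :* d) :* (y :- x)) refl c d x y)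
          (trans (cong (_* (y - x)) cd) (*-identityˡ _)))
        (*-pos _ _ (0<⇒0≤⁻¹ p cd) (diff-nonneg r)))

  -- Equality in the field is not decidable and `inverse` asks for x ≢ 0#, so the absence of zero
  -- divisors is available only under a double negation.
  sq≡0⇒≡0 : ∀ {x} → x * x ≡ 0# → ¬ ¬ x ≡ 0#
  sq≡0⇒≡0 e ¬p = 0≢* ¬p ¬p e

  -- Abstract, so that unification can read the summand off a sum.
  abstract
    sum : ∀ {n} → (Fin n → Carrier) → Carrier
    sum = Sum.sum

    sum-empty : ∀ (f : Fin 0 → Carrier) → sum f ≡ 0#
    sum-empty f = refl

    sum-suc : ∀ {n} (f : Fin (suc n) → Carrier) → sum f ≡ f zero + sum (λ i → f (suc i))
    sum-suc f = refl

    sum-cong : ∀ {n} {f g : Fin n → Carrier} → (∀ i → f i ≡ g i) → sum f ≡ sum g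
    sum-cong = Sum.sum-cong-≗

    sum-+ : ∀ {n} (f g : Fin n → Carrier) → sum (λ i → f i + g i) ≡ sum f + sum g
    sum-+ = Sum.∑-distrib-+

    sum-swap : ∀ {m n} (f : Fin m → Fin n → Carrier) → sum (λ i → sum (λ j → f i j)) ≡ sum (λ j → sum (λ i → f i j))
    sum-swap = Sum.∑-comm

    *-sum : ∀ {n} x (f : Fin n → Carrier) → x * sum f ≡ sum (λ i → x * f i)
    *-sum = Sum.*-distribˡ-sum

    sum-* : ∀ {n} x (f : Fin n → Carrier) → sum f * x ≡ sum (λ i → f i * x)
    sum-* = Sum.*-distribʳ-sum

    sum-const : ∀ n (c : Carrier) → sum {n} (λ _ → c) ≡ fromℕ n * c
    sum-const zero    c = sym (zeroˡ c)
    sum-const (suc n) c = trans (cong (c +_) (sum-const n c))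
      (solve 2 (λ c x → c :+ x :* c := (:1 :+ x) :* c) refl c (fromℕ n))

    sum-nonneg : ∀ {n} (f : Fin n → Carrier) → (∀ i → 0# ≤ f i) → 0# ≤ sum f
    sum-nonneg {zero}  f p = ≤-refl
    sum-nonneg {suc n} f p = 0≤+ (p zero) (sum-nonneg (λ i → f (suc i)) (λ i → p (suc i)))

    sum-mono : ∀ {n} (f g : Fin n → Carrier) → (∀ i → f i ≤ g i) → sum f ≤ sum g
    sum-mono {zero}  f g p = ≤-refl
    sum-mono {suc n} f g p = +-mono₂ (p zero) (sum-mono (λ i → f (suc i)) (λ i → g (suc i)) (λ i → p (suc i)))

    sum-nonneg≡0 : ∀ {n} (f : Fin n → Carrier) → (∀ i → 0# ≤ f i) → sum f ≡ 0# → ∀ i → f i ≡ 0#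
    sum-nonneg≡0 {suc n} f p e zero    = nonneg-sum≡0 (p zero) (sum-nonneg _ (λ i → p (suc i))) e
    sum-nonneg≡0 {suc n} f p e (suc i) = sum-nonneg≡0 _ (λ i → p (suc i))
      (nonneg-sum≡0 (sum-nonneg _ (λ i → p (suc i))) (p zero) (trans (+-comm _ _) e)) i

    sumFin≡sum : ∀ {n} (f : Fin n → Carrier) → sumFin f ≡ sum f
    sumFin≡sum {zero}  f = refl
    sumFin≡sum {suc n} f = cong (f zero +_) (sumFin≡sum (λ i → f (suc i)))

    sum-b2F : ∀ {n} (p : Fin n → Bool) → sum (λ i → b2F (p i)) ≡ fromℕ (count p)
    sum-b2F {zero}  p = refl
    sum-b2F {suc n} p with p zero
    ... | true  = cong (1# +_) (sum-b2F (λ i → p (suc i)))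
    ... | false = trans (+-identityˡ _) (sum-b2F (λ i → p (suc i)))

  b2F-∧ : ∀ p q → b2F (p ∧ q) ≡ b2F p * b2F q
  b2F-∧ true  q = sym (*-identityˡ _)
  b2F-∧ false q = sym (zeroˡ _)

-- Traces of orthogonal projections.

module Idempotents (F : OrderedField) where
  open import Data.Nat as ℕ using (ℕ; zero; suc)
  open FieldProperties F

  excluded-middle : ∀ {P : Set} → ¬ ¬ (P ⊎ ¬ P)
  excluded-middle k = k (inj₂ λ p → k (inj₁ p))

  -- Double-negation shift, valid because the domain is finite; it turns the doubly negated
  -- vanishing of each entry of a row into that of the whole row.
  ¬¬-∀Fin : ∀ {n} {P : Fin n → Set} → (∀ i → ¬ ¬ P i) → ¬ ¬ (∀ i → P i)
  ¬¬-∀Fin {zero}  h k = k λ ()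
  ¬¬-∀Fin {suc n} h k = h zero λ p → ¬¬-∀Fin (λ i → h (suc i)) λ ps → k λ { zero → p ; (suc i) → ps i }

  sum-+* : ∀ {n} (f g : Fin n → Carrier) x → sum (λ w → f w + x * g w) ≡ sum f + x * sum g
  sum-+* f g x = trans (sum-+ f (λ w → x * g w)) (cong (sum f +_) (sym (*-sum x g)))

  sum₂-* : ∀ {m n} (f : Fin m → Carrier) (g : Fin n → Carrier) →
    sum (λ a → sum (λ b → f a * g b)) ≡ sum f * sum g
  sum₂-* f g = trans (sum-cong (λ a → sym (*-sum (f a) g))) (sym (sum-* (sum g) f))

  ∑-assoc : ∀ {m n} (f : Fin m → Carrier) (M : Fin m → Fin n → Carrier) (g : Fin n → Carrier) →
    sum (λ w → sum (λ u → f u * M u w) * g w) ≡ sum (λ u → f u * sum (λ w → M u w * g w))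
  ∑-assoc f M g = begin
    sum (λ w → sum (λ u → f u * M u w) * g w)    ≡⟨ sum-cong (λ w → sum-* (g w) (λ u → f u * M u w)) ⟩
    sum (λ w → sum (λ u → f u * M u w * g w))    ≡⟨ sum-swap (λ w u → f u * M u w * g w) ⟩
    sum (λ u → sum (λ w → f u * M u w * g w))    ≡⟨ sum-cong (λ u → sum-cong (λ w → *-assoc (f u) (M u w) (g w))) ⟩
    sum (λ u → sum (λ w → f u * (M u w * g w)))  ≡⟨ sum-cong (λ u → sym (*-sum (f u) (λ w → M u w * g w))) ⟩
    sum (λ u → f u * sum (λ w → M u w * g w))    ∎
    where open ≡-Reasoning

  record SymmetricIdempotent (n : ℕ) : Set where
    field
      entry      : Fin n → Fin n → Carrier
      symmetric  : ∀ i j → entry i j ≡ entry j i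
      idempotent : ∀ i j → sum (λ w → entry i w * entry w j) ≡ entry i j

    trace : Carrier
    trace = sum (λ i → entry i i)
  open SymmetricIdempotent public

  private
    module _ {n} (E : SymmetricIdempotent (suc n)) where
      e = entry E

      tail-sum : ∀ i j → sum (λ w → e i (suc w) * e (suc w) j) ≡ e i j - e i zero * e zero j
      tail-sum i j = trans
        (solve 2 (λ a t → t := (a :+ t) :- a) refl (e i zero * e zero j) (sum (λ w → e i (suc w) * e (suc w) j)))
        (cong (_- e i zero * e zero j) (trans (sym (sum-suc _)) (idempotent E i j)))

      minor : (∀ j → e zero j ≡ 0#) → SymmetricIdempotent n
      minor z = record
        { entry      = λ i j → e (suc i) (suc j)
        ; symmetric  = λ i j → symmetric E _ _
        ; idempotent = λ i j → trans (tail-sum (suc i) (suc j))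
            (trans (cong (λ t → e (suc i) (suc j) - e (suc i) zero * t) (z (suc j)))
              (solve 2 (λ a b → a :- b :* :0 := a) refl (e (suc i) (suc j)) (e (suc i) zero)))
        }

      -- E minus the rank-one projection onto its column 0; row and column 0 of the difference vanish.
      deflate : ∀ c → e zero zero * c ≡ 1# → SymmetricIdempotent n
      deflate c dc = record
        { entry      = λ i j → E′ (suc i) (suc j)
        ; symmetric  = λ i j → cong₂ _-_ (symmetric E _ _)
            (trans (cong₂ (λ x y → x * y * c) (symmetric E (suc i) zero) (symmetric E zero (suc j)))
              (cong (_* c) (*-comm _ _)))
        ; idempotent = λ i j → trans (sum-cong (λ w → expand i j w)) (trans (sums i j) (collect i j))
        }
        where
        E′ : Fin (suc n) → Fin (suc n) → Carrier
        E′ i j = e i j - e i zero * e zero j * c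
        s : Fin (suc n) → Fin (suc n) → Carrier
        s i j = sum (λ w → e i (suc w) * e (suc w) j)
        expand : ∀ i j w → E′ (suc i) (suc w) * E′ (suc w) (suc j) ≡
          e (suc i) (suc w) * e (suc w) (suc j)
          + (- (e zero (suc j) * c)) * (e (suc i) (suc w) * e (suc w) zero)
          + (- (e (suc i) zero * c)) * (e zero (suc w) * e (suc w) (suc j))
          + (e (suc i) zero * e zero (suc j) * c * c) * (e zero (suc w) * e (suc w) zero)
        expand i j w = solve 7 (λ p q a b x y c →
            (p :- a :* x :* c) :* (q :- y :* b :* c) :=
            p :* q :+ (:- (b :* c)) :* (p :* y) :+ (:- (a :* c)) :* (x :* q) :+ (a :* b :* c :* c) :* (x :* y)) refl
          (e (suc i) (suc w)) (e (suc w) (suc j)) (e (suc i) zero) (e zero (suc j)) (e zero (suc w)) (e (suc w) zero) c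
        sums : ∀ i j → _ ≡ _
        sums i j = trans (sum-+* _ _ (e (suc i) zero * e zero (suc j) * c * c))
          (cong (_+ (e (suc i) zero * e zero (suc j) * c * c) * s zero zero)
            (trans (sum-+* _ _ (- (e (suc i) zero * c)))
              (cong (_+ (- (e (suc i) zero * c)) * s zero (suc j))
                (sum-+* _ _ (- (e zero (suc j) * c))))))
        collect : ∀ i j → s (suc i) (suc j) + (- (e zero (suc j) * c)) * s (suc i) zero
            + (- (e (suc i) zero * c)) * s zero (suc j)
            + (e (suc i) zero * e zero (suc j) * c * c) * s zero zero ≡ E′ (suc i) (suc j)
        collect i j = trans (cong₂ _+_ (cong₂ _+_ (cong₂ _+_ (tail-sum _ _) (cong (_ *_) (tail-sum _ _))) (cong (_ *_) (tail-sum _ _)))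
            (cong ((e (suc i) zero * e zero (suc j) * c * c) *_) (tail-sum _ _)))
          (by₁ (- (e (suc i) zero * e zero (suc j) * (c * (e zero zero) - c - 1#)))
            (solve 5 (λ p a b d c →
              ((p :- a :* b) :+ (:- (b :* c)) :* (a :- a :* d) :+ (:- (a :* c)) :* (b :- d :* b)
                :+ (a :* b :* c :* c) :* (d :- d :* d)) :- (p :- a :* b :* c)
              := (:- (a :* b :* (c :* d :- c :- :1))) :* (d :* c :- :1)) refl
              (e (suc i) (suc j)) (e (suc i) zero) (e zero (suc j)) (e zero zero) c) dc)

      -- The subtracted rank-one projection has trace 1: its diagonal sums to c Σ e_i0 e_0i = c e_00
      -- by idempotency.
      trace-deflate : ∀ c dc → 1# + trace (deflate c dc) ≡ trace E
      trace-deflate c dc = trans (trans (cong (1# +_)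
          (trans (sum-cong (λ i → solve 4 (λ p a b c → p :- a :* b :* c := p :+ (:- c) :* (b :* a)) refl
                    (e (suc i) (suc i)) (e (suc i) zero) (e zero (suc i)) c))
            (trans (sum-+* _ _ (- c)) (cong (λ z → t + (- c) * z) (tail-sum zero zero)))))
        (by₁ (e zero zero - 1#) (solve 3 (λ t d c → (:1 :+ (t :+ (:- c) :* (d :- d :* d))) :- (d :+ t)
            := (d :- :1) :* (d :* c :- :1)) refl t (e zero zero) c) dc)) (sym (sum-suc _))
        where t = sum (λ i → e (suc i) (suc i))

  -- The trace is the rank, found by induction on n. The squared norm of row 0 is e_00, so if e_00 =
  -- 0 the row and its column vanish and can be deleted; otherwise deflation lowers the trace by 1.
  -- The test e_00 = 0 is the source of the double negation.
  trace-natural : ∀ {n} (E : SymmetricIdempotent n) → ¬ ¬ (∃[ f ] trace E ≡ fromℕ f)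
  trace-natural {zero}  E k = k (0 , sum-empty _)
  trace-natural {suc n} E k = excluded-middle λ where
      (inj₁ d≡0) → ¬¬-∀Fin (λ j → sq≡0⇒≡0 (sum-nonneg≡0 _ (λ j → 0≤sq (entry E zero j)) (row-norm d≡0) j)) λ z →
        trace-natural (minor E z) λ (f , tr) →
          k (f , trans (sum-suc _) (trans (cong (_+ trace (minor E z)) d≡0) (trans (+-identityˡ _) tr)))
      (inj₂ d≢0) → let (c , dc) = inverse _ d≢0 in
        trace-natural (deflate E c dc) λ (f , tr) →
          k (suc f , trans (sym (trace-deflate E c dc)) (cong (1# +_) tr))
    where
    row-norm : entry E zero zero ≡ 0# → sum (λ j → entry E zero j * entry E zero j) ≡ 0#
    row-norm d≡0 = trans (sum-cong (λ j → cong (entry E zero j *_) (symmetric E zero j)))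
      (trans (idempotent E zero zero) d≡0)

-- Inequalities in V ⊗ V: Bessel and Krein.

module TensorBounds (F : OrderedField) where
  open import Data.Nat as ℕ using (ℕ; zero; suc)
  open FieldProperties F
  open Idempotents F

  Tensor : ℕ → Set
  Tensor n = Fin n → Fin n → Carrier

  ⟪_,_⟫ : ∀ {n} → Tensor n → Tensor n → Carrier
  ⟪ f , g ⟫ = sum λ c → sum λ d → f c d * g c d

  ⟪⟫-comm : ∀ {n} (f g : Tensor n) → ⟪ f , g ⟫ ≡ ⟪ g , f ⟫
  ⟪⟫-comm f g = sum-cong λ c → sum-cong λ d → *-comm (f c d) (g c d)

  ⟪⟫-combination : ∀ {m n} (α : Fin m → Carrier) (f : Fin m → Tensor n) (g : Tensor n) →
    ⟪ (λ c d → sum λ x → α x * f x c d) , g ⟫ ≡ sum λ x → α x * ⟪ f x , g ⟫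
  ⟪⟫-combination α f g = begin
    (sum λ c → sum λ d → (sum λ x → α x * f x c d) * g c d)
      ≡⟨ (sum-cong λ c → sum-cong λ d → trans (sum-* (g c d) (λ x → α x * f x c d)) (sum-cong λ x → *-assoc (α x) (f x c d) (g c d))) ⟩
    (sum λ c → sum λ d → sum λ x → α x * (f x c d * g c d))
      ≡⟨ (sum-cong λ c → trans (sum-swap λ d x → α x * (f x c d * g c d)) (sum-cong λ x → sym (*-sum (α x) (λ d → f x c d * g c d)))) ⟩
    (sum λ c → sum λ x → α x * (sum λ d → f x c d * g c d))
      ≡⟨ trans (sum-swap λ c x → α x * (sum λ d → f x c d * g c d)) (sum-cong λ x → sym (*-sum (α x) (λ c → sum λ d → f x c d * g c d))) ⟩
    (sum λ x → α x * ⟪ f x , g ⟫) ∎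
    where open ≡-Reasoning

  ⟪⟫-⊗ : ∀ {n} (f g f′ g′ : Fin n → Carrier) →
    ⟪ (λ c d → f c * g d) , (λ c d → f′ c * g′ d) ⟫ ≡ sum (λ c → f c * f′ c) * sum (λ d → g d * g′ d)
  ⟪⟫-⊗ f g f′ g′ = trans
    (sum-cong λ c → sum-cong λ d → solve 4 (λ a b c d → (a :* b) :* (c :* d) := (a :* c) :* (b :* d)) refl (f c) (g d) (f′ c) (g′ d))
    (sum₂-* (λ c → f c * f′ c) (λ d → g d * g′ d))

  ⟪⟫-square : ∀ {n} (f g : Tensor n) →
    ⟪ (λ c d → f c d - g c d) , (λ c d → f c d - g c d) ⟫ ≡ ⟪ f , f ⟫ + (- (1# + 1#)) * ⟪ g , f ⟫ + 1# * ⟪ g , g ⟫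
  ⟪⟫-square f g = trans (sum-cong λ c → trans
      (sum-cong λ d → solve 2 (λ a b → (a :- b) :* (a :- b) := a :* a :+ (:- (:1 :+ :1)) :* (b :* a) :+ :1 :* (b :* b)) refl
          (f c d) (g c d))
      (trans (sum-+* _ (λ d → g c d * g c d) 1#) (cong (_+ 1# * _) (sum-+* _ (λ d → g c d * f c d) (- (1# + 1#))))))
    (trans (sum-+* _ (λ c → sum λ d → g c d * g c d) 1#) (cong (_+ 1# * _) (sum-+* _ (λ c → sum λ d → g c d * f c d) (- (1# + 1#)))))

  ⟪⟫-nonneg : ∀ {n} (f : Tensor n) → 0# ≤ ⟪ f , f ⟫
  ⟪⟫-nonneg f = sum-nonneg _ λ c → sum-nonneg _ λ d → 0≤sq (f c d)

  module _ {n} (E G : SymmetricIdempotent n) where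
    private
      e = entry E
      g = entry G

      row : ∀ a b → sum (λ c → e a c * e b c) ≡ e a b
      row a b = trans (sum-cong λ c → cong (e a c *_) (symmetric E b c)) (idempotent E a b)

    gramVector : Fin n → Tensor n
    gramVector i c d = sum λ x → g i x * (e x c * e x d)

    private
      -- Reproducing property: E ⊗ E fixes `gramVector i`, so pairing with the column E_a ⊗ E_b
      -- evaluates it at (a , b).
      ⟪w,ee⟫ : ∀ i a b → ⟪ gramVector i , (λ c d → e a c * e b d) ⟫ ≡ gramVector i a b
      ⟪w,ee⟫ i a b = trans (⟪⟫-combination (g i) (λ x c d → e x c * e x d) _)
        (sum-cong λ x → cong (g i x *_) (trans (⟪⟫-⊗ (e x) (e x) (e a) (e b)) (cong₂ _*_ (row x a) (row x b))))

    ⟪w,w⟫-diagonal : ∀ i j → ⟪ gramVector i , gramVector j ⟫ ≡ sum λ x → g i x * gramVector j x x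
    ⟪w,w⟫-diagonal i j = trans (⟪⟫-combination (g i) (λ x c d → e x c * e x d) (gramVector j))
        (sum-cong λ x → cong (g i x *_) (trans (⟪⟫-comm _ (gramVector j)) (⟪w,ee⟫ j x x)))

    -- The vectors gramVector i = Σ_x G_ix (E_x ⊗ E_x) lie in the image of E ⊗ E and have Gram matrix q G.
    -- By Bessel's inequality they contribute at most the trace of E ⊗ E.
    module _ (q : Carrier) (q≢0 : q ≢ 0#)
           (hadamard : ∀ i j → sum (λ x → g i x * (e x j * e x j)) ≡ q * g i j) where
     private
      ⟪w,w⟫ : ∀ i j → ⟪ gramVector i , gramVector j ⟫ ≡ q * g i j
      ⟪w,w⟫ i j = begin
        ⟪ gramVector i , gramVector j ⟫
          ≡⟨ ⟪w,w⟫-diagonal i j ⟩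
        (sum λ x → g i x * gramVector j x x)
          ≡⟨ (sum-cong λ x → trans (cong (g i x *_) (trans (hadamard j x) (cong (q *_) (symmetric G j x))))
               (solve 3 (λ a q b → a :* (q :* b) := q :* (a :* b)) refl (g i x) q (g x j))) ⟩
        (sum λ x → q * (g i x * g x j))
          ≡⟨ trans (sym (*-sum q _)) (cong (q *_) (idempotent G i j)) ⟩
        q * g i j ∎
        where open ≡-Reasoning

      G-w : ∀ i a b → sum (λ j → g i j * gramVector j a b) ≡ gramVector i a b
      G-w i a b = trans (sym (∑-assoc (g i) g (λ x → e x a * e x b)))
        (sum-cong λ x → cong (_* (e x a * e x b)) (idempotent G i x))

      p = proj₁ (inverse q q≢0)
      qp≡1 = proj₂ (inverse q q≢0)

      -- Since the Gram matrix is q times a projection, p Σ_i w_i w_iᵀ with w_i = `gramVector i` is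
      -- the orthogonal projection onto the span of the w_i. It maps u = E_a ⊗ E_b to t, and the
      -- inequality is 0 ≤ ‖u - t‖².
      bessel : ∀ a b → p * sum (λ i → gramVector i a b * gramVector i a b) ≤ e a a * e b b
      bessel a b = nonneg-diff (subst (0# ≤_) expand (⟪⟫-nonneg (λ c d → u c d - t c d)))
        where
        u t : Tensor n
        u c d = e a c * e b d
        t c d = sum λ i → (p * gramVector i a b) * gramVector i c d
        N = p * sum (λ i → gramVector i a b * gramVector i a b)
        pull : ∀ (h : Fin n → Carrier) → (∀ i → h i ≡ gramVector i a b) → sum (λ i → (p * gramVector i a b) * h i) ≡ N
        pull h h≡ = trans (sum-cong λ i → trans (cong (_ *_) (h≡ i)) (*-assoc p (gramVector i a b) (gramVector i a b))) (sym (*-sum p _))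
        ⟪t,u⟫ : ⟪ t , u ⟫ ≡ N
        ⟪t,u⟫ = trans (⟪⟫-combination (λ i → p * gramVector i a b) gramVector u) (pull _ λ i → ⟪w,ee⟫ i a b)
        ⟪w,t⟫ : ∀ i → ⟪ gramVector i , t ⟫ ≡ gramVector i a b
        ⟪w,t⟫ i = trans (⟪⟫-comm (gramVector i) t) (trans (⟪⟫-combination (λ j → p * gramVector j a b) gramVector (gramVector i))
          (trans (sum-cong λ j → trans (cong ((p * gramVector j a b) *_) (trans (⟪w,w⟫ j i) (cong (q *_) (symmetric G j i))))
                   (trans (solve 4 (λ p gramVector q g → (p :* gramVector) :* (q :* g) := (q :* p) :* (g :* gramVector)) refl p
                       (gramVector j a b) q (g i j))
                     (trans (cong (_* (g i j * gramVector j a b)) qp≡1) (*-identityˡ _))))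
            (G-w i a b)))
        ⟪t,t⟫ : ⟪ t , t ⟫ ≡ N
        ⟪t,t⟫ = trans (⟪⟫-combination (λ i → p * gramVector i a b) gramVector t) (pull _ ⟪w,t⟫)
        expand : ⟪ (λ c d → u c d - t c d) , (λ c d → u c d - t c d) ⟫ ≡ e a a * e b b - N
        expand = trans (⟪⟫-square u t)
          (trans (cong₂ (λ x y → ⟪ u , u ⟫ + (- (1# + 1#)) * x + 1# * y) ⟪t,u⟫ ⟪t,t⟫)
          (trans (cong (λ x → x + (- (1# + 1#)) * N + 1# * N) (trans (⟪⟫-⊗ (e a) (e b) (e a) (e b)) (cong₂ _*_ (row a a) (row b b))))
            (solve 2 (λ x n → x :+ (:- (:1 :+ :1)) :* n :+ :1 :* n := x :- n) refl (e a a * e b b) N)))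

     -- `bessel` summed over all a and b: the left side becomes p Σ_i ‖w_i‖² = p q · trace G, the
     -- right side the trace of E ⊗ E.
     trace-bound : trace G ≤ trace E * trace E
     trace-bound = subst₂ _≤_ lhs (sum₂-* (λ a → e a a) (λ b → e b b))
         (sum-mono _ _ λ a → sum-mono _ _ λ b → bessel a b)
       where
       lhs : sum (λ a → sum λ b → p * sum (λ i → gramVector i a b * gramVector i a b)) ≡ trace G
       lhs = begin
         sum (λ a → sum λ b → p * sum (λ i → gramVector i a b * gramVector i a b))
           ≡⟨ trans (sum-cong λ a → sym (*-sum p _)) (sym (*-sum p _)) ⟩
         p * sum (λ a → sum λ b → sum (λ i → gramVector i a b * gramVector i a b))
           ≡⟨ cong (p *_) (trans (sum-cong λ a → sum-swap _) (sum-swap _)) ⟩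
         p * sum (λ i → ⟪ gramVector i , gramVector i ⟫)
           ≡⟨ cong (p *_) (trans (sum-cong λ i → ⟪w,w⟫ i i) (sym (*-sum q _))) ⟩
         p * (q * trace G)
           ≡⟨ solve 3 (λ p q t → p :* (q :* t) := (q :* p) :* t) refl p q (trace G) ⟩
         q * p * trace G
           ≡⟨ trans (cong (_* trace G) qp≡1) (*-identityˡ _) ⟩
         trace G ∎
         where open ≡-Reasoning

  -- The sum of cubes is a sum of squared norms, those of the vectors `gramVector E E a`: summing
  -- over a contracts the two outer copies of E into one.
  cube-sum-nonneg : ∀ {n} (E : SymmetricIdempotent n) →
    0# ≤ sum λ i → sum λ j → entry E i j * (entry E i j * entry E i j)
  cube-sum-nonneg E = subst (0# ≤_) collapse (sum-nonneg _ λ a → ⟪⟫-nonneg (gramVector E E a))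
    where
    e = entry E
    collapse : sum (λ a → ⟪ gramVector E E a , gramVector E E a ⟫) ≡ sum λ i → sum λ j → e i j * (e i j * e i j)
    collapse = begin
      sum (λ a → ⟪ gramVector E E a , gramVector E E a ⟫)
        ≡⟨ (sum-cong λ a → ⟪w,w⟫-diagonal E E a a) ⟩
      (sum λ a → sum λ x → e a x * sum λ y → e a y * (e y x * e y x))
        ≡⟨ (sum-swap λ a x → e a x * sum λ y → e a y * (e y x * e y x)) ⟩
      (sum λ x → sum λ a → e a x * sum λ y → e a y * (e y x * e y x))
        ≡⟨ (sum-cong λ x → sym (∑-assoc (λ a → e a x) e (λ y → e y x * e y x))) ⟩
      (sum λ x → sum λ y → sum (λ a → e a x * e a y) * (e y x * e y x))
        ≡⟨ (sum-cong λ x → sum-cong λ y → cong₂ _*_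
             (trans (sum-cong λ a → cong (_* e a y) (symmetric E a x)) (idempotent E x y))
             (cong₂ _*_ (symmetric E y x) (symmetric E y x))) ⟩
      (sum λ i → sum λ j → e i j * (e i j * e i j)) ∎
      where open ≡-Reasoning

-- The adjacency algebra, its projections and the Krein parameters.

module Spectrum (F : OrderedField) where
  open import Data.Nat as ℕ using (ℕ; zero; suc)
  open import Relation.Nullary.Decidable using (does; dec-true; dec-false)
  open FieldProperties F
  open Idempotents F
  open TensorBounds F

  δ : ∀ {n} → Fin n → Fin n → Carrier
  δ i j = b2F (does (i ≟ᶠ j))

  δ-refl : ∀ {n} (i : Fin n) → δ i i ≡ 1#
  δ-refl i = cong b2F (dec-true (i ≟ᶠ i) refl)

  δ-≢ : ∀ {n} {i j : Fin n} → i ≢ j → δ i j ≡ 0#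
  δ-≢ {i = i} {j} i≢j = cong b2F (dec-false (i ≟ᶠ j) i≢j)

  δ-suc : ∀ {n} (i j : Fin n) → δ (suc i) (suc j) ≡ δ i j
  δ-suc i j with i ≟ᶠ j
  ... | yes _ = refl
  ... | no _  = refl

  δ-sym : ∀ {n} (i j : Fin n) → δ i j ≡ δ j i
  δ-sym i j with i ≟ᶠ j
  ... | yes i≡j = sym (trans (cong (δ j) i≡j) (δ-refl j))
  ... | no i≢j  = sym (δ-≢ (λ e → i≢j (sym e)))

  sum-δ : ∀ {n} (i : Fin n) (f : Fin n → Carrier) → sum (λ j → δ i j * f j) ≡ f i
  sum-δ {suc n} zero f = trans (sum-suc _) (trans (cong₂ _+_ (*-identityˡ (f zero))
      (trans (sum-cong λ j → zeroˡ (f (suc j))) (trans (sum-const n 0#) (zeroʳ _)))) (+-identityʳ _))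
  sum-δ {suc n} (suc i) f = trans (sum-suc _) (trans (cong₂ _+_ (zeroˡ (f zero))
      (trans (sum-cong λ j → cong (_* f (suc j)) (δ-suc i j)) (sum-δ i (λ j → f (suc j))))) (+-identityˡ _))

  sum-δ′ : ∀ {n} (i : Fin n) (f : Fin n → Carrier) → sum (λ j → δ j i * f j) ≡ f i
  sum-δ′ i f = trans (sum-cong λ j → cong (_* f j) (δ-sym j i)) (sum-δ i f)

  module AdjacencyAlgebra {v} (G : Graph v) {k l μ : ℕ} (srg : IsSRG G k l μ) where
    open IsSRG srg

    α : Fin v → Fin v → Carrier
    α i j = b2F (adj G i j)

    K L M V : Carrier
    K = fromℕ k
    L = fromℕ l
    M = fromℕ μ
    V = fromℕ v

    α-sym : ∀ i j → α i j ≡ α j i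
    α-sym i j = cong b2F (adj-sym G i j)

    data Kind (i j : Fin v) : Set where
      same     : i ≡ j → δ i j ≡ 1# → α i j ≡ 0# → Kind i j
      edge     : i ≢ j → adj G i j ≡ true → δ i j ≡ 0# → α i j ≡ 1# → Kind i j
      non-edge : i ≢ j → adj G i j ≡ false → δ i j ≡ 0# → α i j ≡ 0# → Kind i j

    kind : ∀ i j → Kind i j
    kind i j with i ≟ᶠ j in eq
    ... | yes refl = same refl (cong (λ d → b2F (does d)) eq) (cong b2F (irrefl G i))
    ... | no i≢j with adj G i j in eq′
    ...   | true  = edge i≢j eq′ (cong (λ d → b2F (does d)) eq) (cong b2F eq′)
    ...   | false = non-edge i≢j eq′ (cong (λ d → b2F (does d)) eq) (cong b2F eq′)

    -- Pairs of vertices are equal, adjacent or neither, so the pair (δ, α) takes only three values.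
    by-kind : (f g : Carrier → Carrier → Carrier) → f 1# 0# ≡ g 1# 0# → f 0# 1# ≡ g 0# 1# → f 0# 0# ≡ g 0# 0# →
      ∀ i j → f (δ i j) (α i j) ≡ g (δ i j) (α i j)
    by-kind f g p q r i j with kind i j
    ... | same _ d a       = trans (cong₂ f d a) (trans p (sym (cong₂ g d a)))
    ... | edge _ _ d a     = trans (cong₂ f d a) (trans q (sym (cong₂ g d a)))
    ... | non-edge _ _ d a = trans (cong₂ f d a) (trans r (sym (cong₂ g d a)))

    sum-α : ∀ i → sum (α i) ≡ K
    sum-α i = trans (sum-b2F (adj G i)) (cong fromℕ (regular i))

    α² : ∀ i j → sum (λ w → α i w * α w j) ≡ (K - M) * δ i j + (L - M) * α i j + M
    α² i j = trans (sum-cong λ w → trans (cong (α i w *_) (α-sym w j)) (sym (b2F-∧ (adj G i w) (adj G j w))))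
        (trans (sum-b2F (λ w → adj G i w ∧ adj G j w)) (cases (kind i j)))
      where
      value : ∀ {a b} → δ i j ≡ a → α i j ≡ b → (K - M) * δ i j + (L - M) * α i j + M ≡ (K - M) * a + (L - M) * b + M
      value d a = cong₂ (λ x y → (K - M) * x + (L - M) * y + M) d a
      ∧-idem-count : ∀ {n} (p : Fin n → Bool) → count (λ w → p w ∧ p w) ≡ count p
      ∧-idem-count {zero}  p = refl
      ∧-idem-count {suc n} p with p zero
      ... | true  = cong suc (∧-idem-count (λ w → p (suc w)))
      ... | false = ∧-idem-count (λ w → p (suc w))
      cases : Kind i j → fromℕ (commonNeighbours G i j) ≡ (K - M) * δ i j + (L - M) * α i j + M
      cases (same refl d a) = trans (cong fromℕ (trans (∧-idem-count (adj G i)) (regular i)))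
        (sym (trans (value d a) (solve 3 (λ k l m → (k :- m) :* :1 :+ (l :- m) :* :0 :+ m := k) refl K L M)))
      cases (edge i≢j e d a) = trans (cong fromℕ (edgeParam i j i≢j e))
        (sym (trans (value d a) (solve 3 (λ k l m → (k :- m) :* :0 :+ (l :- m) :* :1 :+ m := l) refl K L M)))
      cases (non-edge i≢j e d a) = trans (cong fromℕ (nonEdgeParam i j i≢j e))
        (sym (trans (value d a) (solve 3 (λ k l m → (k :- m) :* :0 :+ (l :- m) :* :0 :+ m := m) refl K L M)))

    sum-sum-α : ∀ (f : Fin v → Carrier) → sum (λ i → sum (λ j → α i j * f j)) ≡ K * sum f
    sum-sum-α f = trans (sum-swap _) (trans (sum-cong λ j → trans (sym (sum-* (f j) (λ i → α i j)))
      (cong (_* f j) (trans (sum-cong λ i → α-sym i j) (sum-α j)))) (sym (*-sum K f)))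

    sum-linear : ∀ x y z i → sum (λ j → x * δ i j + y * α i j + z) ≡ x + y * K + V * z
    sum-linear x y z i = trans (sum-+ _ (λ _ → z)) (cong₂ _+_ (trans (sum-+ _ (λ j → y * α i j))
      (cong₂ _+_ (trans (sum-cong λ j → *-comm x (δ i j)) (sum-δ i (λ _ → x)))
          (trans (sym (*-sum y (α i))) (cong (y *_) (sum-α i))))) (sum-const v z))

    -- Row sums on both sides of `α²`; every row of A² sums to k².
    parameters : Fin v → K * K ≡ (K - M) + (L - M) * K + V * M
    parameters i = trans (sym (begin
      sum (λ j → sum (λ w → α i w * α w j))  ≡⟨ sum-swap _ ⟩
      sum (λ w → sum (λ j → α i w * α w j))  ≡⟨ (sum-cong λ w → trans (sym (*-sum (α i w) (α w))) (cong (α i w *_) (sum-α w))) ⟩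
      sum (λ w → α i w * K)                  ≡⟨ trans (sym (sum-* K (α i))) (cong (_* K) (sum-α i)) ⟩
      K * K                                  ∎)) (trans (sum-cong λ j → α² i j) (sum-linear (K - M) (L - M) M i))
      where open ≡-Reasoning

    -- Summing A x = θ x over all vertices gives k Σ x = θ Σ x, so θ ≢ k makes x orthogonal to the
    -- constants. The J term of A² then kills x, which leaves a quadratic equation for θ.
    eigenvalue-equation : ∀ θ → IsEigenvalue F G θ → θ ≢ K → θ * θ ≡ (L - M) * θ + (K - M)
    eigenvalue-equation θ (x , (i , xᵢ≢0) , eigen) θ≢K =
      *-cancelˡ xᵢ≢0 (trans (solve 2 (λ x θ → x :* (θ :* θ) := θ :* (θ :* x)) refl (x i) θ) (trans (sym twice)
        (trans (sum-cong λ w → sym (*-sum (α i w) (λ j → α w j * x j))) (trans expand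
          (solve 5 (λ k l m θ x → (k :- m) :* x :+ (l :- m) :* (θ :* x) := x :* ((l :- m) :* θ :+ (k :- m))) refl K L M θ (x i))))))
      where
      eigen′ : ∀ i → sum (λ j → α i j * x j) ≡ θ * x i
      eigen′ i = trans (sym (sumFin≡sum _)) (eigen i)
      sum≡0 : sum x ≡ 0#
      sum≡0 = *-cancelˡ {x = θ - K} (λ e → θ≢K (cancel-diff e)) (trans (by₁ (- 1#)
        (solve 3 (λ t k s → (t :- k) :* s :- :0 := (:- :1) :* (k :* s :- t :* s)) refl θ K (sum x))
        (trans (sym (sum-sum-α x)) (trans (sum-cong eigen′) (sym (*-sum θ x))))) (sym (zeroʳ _)))
      twice : sum (λ w → sum (λ j → α i w * (α w j * x j))) ≡ θ * (θ * x i)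
      twice = trans (sum-cong λ w → trans (sym (*-sum (α i w) (λ j → α w j * x j))) (cong (α i w *_) (eigen′ w)))
        (trans (sum-cong λ w → solve 3 (λ a t x → a :* (t :* x) := t :* (a :* x)) refl (α i w) θ (x w))
          (trans (sym (*-sum θ (λ w → α i w * x w))) (cong (θ *_) (eigen′ i))))
      expand : sum (λ w → α i w * sum (λ j → α w j * x j)) ≡ (K - M) * x i + (L - M) * (θ * x i)
      expand = trans (sym (∑-assoc (α i) α x)) (trans
        (sum-cong λ j → trans (cong (_* x j) (α² i j))
          (solve 6 (λ a b m d e x → (a :* d :+ b :* e :+ m) :* x := a :* (d :* x) :+ b :* (e :* x) :+ m :* x) refl (K - M)
              (L - M) M (δ i j) (α i j) (x j)))
        (trans (sum-+* _ x M) (trans (cong₂ _+_ (trans (sum-+* _ (λ j → α i j * x j) (L - M)) (cong₂ _+_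
           (trans (sym (*-sum (K - M) (λ j → δ i j * x j))) (cong ((K - M) *_) (sum-δ i x))) (cong ((L - M) *_) (eigen′ i))))
           (trans (cong (M *_) sum≡0) (zeroʳ M))) (+-identityʳ _))))

    -- The projection onto the θ-eigenspace, with u = 1 / v and d = 1 / (θ - σ). The matrix d (A - σ
    -- I) is the identity there and zero on the σ-eigenspace; subtracting d ρ J annihilates the
    -- constant vectors as well.
    module Idempotent (i₀ : Fin v) (u : Carrier) (Vu≡1 : V * u ≡ 1#) (θ σ d : Carrier) (θ+σ : θ + σ ≡ L - M) (θσ : θ * σ ≡ M - K)
             (d[θ-σ] : d * (θ - σ) ≡ 1#) where
      ρ : Carrier
      ρ = (K - σ) * u

      private
        Vρ : V * ρ ≡ K - σ
        Vρ = trans (solve 3 (λ v x u → v :* (x :* u) := x :* (v :* u)) refl V (K - σ) u)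
            (trans (cong ((K - σ) *_) Vu≡1) (solve 1 (λ x → x :* :1 := x) refl (K - σ)))

        -- Row sums of (A - θ I)(A - σ I) = μ J.
        VM : V * M ≡ (K - θ) * (K - σ)
        VM = by₂ 1# (- 1#) (solve 6 (λ k l m v t s → v :* m :- (k :- t) :* (k :- s) :=
                :1 :* ((k :- m) :+ (l :- m) :* k :+ v :* m :- k :* k) :+ (:- :1) :*
                    (((l :- m) :- (t :+ s)) :* k :+ (k :- m :+ t :* s) :- :0)) refl K L M V θ σ)
                (sym (parameters i₀))
                (trans (cong₂ _+_ (trans (cong (_* K) (diff≡0 (sym θ+σ))) (zeroˡ K))
                    (trans (cong (K - M +_) θσ) (solve 2 (λ k m → k :- m :+ (m :- k) := :0) refl K M))) (+-identityˡ 0#))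

        M≡ : M ≡ ρ * (K - θ)
        M≡ = by₂ (- M) u (solve 6 (λ k m v u t s → m :- ((k :- s) :* u) :* (k :- t) := (:- m) :* (v :* u :- :1) :+ u :*
            (v :* m :- (k :- t) :* (k :- s))) refl K M V u θ σ) Vu≡1 VM

      ent : Fin v → Fin v → Carrier
      ent i j = d * (α i j - σ * δ i j - ρ)

      apply : ∀ i (f : Fin v → Carrier) → sum (λ w → ent i w * f w) ≡ d * (sum (λ w → α i w * f w) - σ * f i - ρ * sum f)
      apply i f = trans (sum-cong λ w → solve 6 (λ d a s e r f → d :* (a :- s :* e :- r) :* f := d :*
          (a :* f :+ (:- s) :* (e :* f) :+ (:- r) :* f)) refl d (α i w) σ (δ i w) ρ (f w))
        (trans (sym (*-sum d _)) (cong (d *_) (trans (sum-+* _ f (- ρ))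
            (trans (cong (_+ (- ρ) * sum f) (trans (sum-+* _ (λ w → δ i w * f w) (- σ))
            (cong (λ z → sum (λ w → α i w * f w) + (- σ) * z) (sum-δ i f))))
          (solve 5 (λ a s f r t → a :+ (:- s) :* f :+ (:- r) :* t := a :- s :* f :- r :* t) refl _ σ (f i) ρ (sum f))))))

      ent-sym : ∀ i j → ent i j ≡ ent j i
      ent-sym i j = cong₂ (λ a b → d * (a - σ * b - ρ)) (α-sym i j) (δ-sym i j)

      sum-ent : ∀ i → sum (ent i) ≡ 0#
      sum-ent i = trans (sum-cong λ w → solve 5 (λ d a s e r → d :* (a :- s :* e :- r) := (:- (d :* s)) :* e :+ d :* a :+
          (:- (d :* r))) refl d (α i w) σ (δ i w) ρ)
        (trans (sum-linear (- (d * σ)) d (- (d * ρ)) i)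
            (by₁ (- d) (solve 5 (λ d s k v r → (:- (d :* s)) :+ d :* k :+ v :* (:- (d :* r)) :- :0 := (:- d) :*
            (v :* r :- (k :- s))) refl d σ K V ρ) Vρ))

      eigen : ∀ i j → sum (λ w → ent i w * α w j) ≡ θ * ent i j
      eigen i j = trans (apply i (λ w → α w j)) (trans
          (cong₂ (λ x y → d * (x - σ * α i j - ρ * y)) (α² i j) (trans (sum-cong λ w → α-sym w j) (sum-α j)))
        (by₃ (d * δ i j) (- (d * α i j)) d (solve 9 (λ d k l m s t r a e →
            d :* (((k :- m) :* e :+ (l :- m) :* a :+ m) :- s :* a :- r :* k) :- t :* (d :* (a :- s :* e :- r)) :=
            (d :* e) :* (t :* s :- (m :- k)) :+ (:- (d :* a)) :* (t :+ s :- (l :- m)) :+ d :* (m :- r :* (k :- t)))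
                refl d K L M σ θ ρ (α i j) (δ i j))
          θσ θ+σ M≡))

      idem : SymmetricIdempotent v
      idem = record
        { entry = ent ; symmetric = ent-sym
        ; idempotent = λ i j → trans (sum-cong λ w → *-comm _ _) (trans (sum-cong λ w → cong₂ _*_ (ent-sym w j) (ent-sym i w))
            (trans (apply j (λ w → ent w i)) (trans (cong₂ (λ x y → d * (x - σ * ent j i - ρ * y))
                (trans (sum-cong λ w → trans (*-comm _ _) (cong₂ _*_ (ent-sym w i) (α-sym j w))) (eigen i j))
                    (trans (sum-cong λ w → ent-sym w i) (sum-ent i)))
              (trans (cong (λ z → d * (θ * ent i j - σ * z - ρ * 0#)) (ent-sym j i))
              (by₁ (ent i j) (solve 5 (λ d t s e r → d :* (t :* e :- s :* e :- r :* :0) :- e := e :* (d :* (t :- s) :- :1))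
                  refl d θ σ (ent i j) ρ) d[θ-σ])))))
        }

      -- The values of `ent` on the diagonal, on edges and on non-edges.
      e₀ e₁ e₂ : Carrier
      e₀ = d * (0# - σ - ρ)
      e₁ = d * (1# - ρ)
      e₂ = d * (0# - ρ)

      trace-idem : trace idem ≡ d * (- (V * σ) - (K - σ))
      trace-idem = trans (sum-cong λ i → cong₂ (λ a b → d * (a - σ * b - ρ)) (cong b2F (irrefl G i)) (δ-refl i)) (trans (sum-const v _)
        (by₁ (- d) (solve 5 (λ v d s r k → v :* (d :* (:0 :- s :* :1 :- r)) :- d :* ((:- (v :* s)) :- (k :- s)) := (:- d) :*
            (v :* r :- (k :- s))) refl V d σ ρ K) Vρ))

      V*e₀ : V * e₀ ≡ trace idem
      V*e₀ = trans (solve 4 (λ v d s r → v :* (d :* (:0 :- s :- r)) := d :* (:- (v :* s) :- v :* r)) refl V d σ ρ)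
          (trans (cong (λ z → d * (- (V * σ) - z)) Vρ) (sym trace-idem))

      e₁-e₂ : e₁ - e₂ ≡ d
      e₁-e₂ = solve 2 (λ d r → d :* (:1 :- r) :- d :* (:0 :- r) := d) refl d ρ

      -- The diagonal entries of E A = θ E: the k neighbours of a vertex contribute e₁ each.
      K*e₁ : K * e₁ ≡ θ * e₀
      K*e₁ = by₂ d d (solve 7 (λ k d r t s m v → k :* (d :* (:1 :- r)) :- t :* (d :* (:0 :- s :- r)) := d :*
          (t :* s :- (m :- k)) :+ d :* (m :- r :* (k :- t))) refl K d ρ θ σ M V)
        θσ M≡

      -- The vanishing row sum of E, sorted by the kind of entry.
      sum-e : e₀ + K * e₁ + (V - 1# - K) * e₂ ≡ 0#
      sum-e = by₁ (- d) (solve 5 (λ d s r k v → d :* (:0 :- s :- r) :+ k :* (d :* (:1 :- r)) :+ (v :- :1 :- k) :*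
          (d :* (:0 :- r)) :- :0 := (:- d) :* (v :* r :- (k :- s))) refl d σ ρ K V) Vρ

      -- The span of I, A and J is closed under entrywise operations, because E has only three
      -- distinct entries. This is what evaluates entrywise squares and cubes of E.
      ent-map : ∀ (φ : Carrier → Carrier) i j → φ (ent i j) ≡ (φ e₀ - φ e₂) * δ i j + (φ e₁ - φ e₂) * α i j + φ e₂
      ent-map φ = by-kind (λ x y → φ (d * (y - σ * x - ρ))) (λ x y → (φ e₀ - φ e₂) * x + (φ e₁ - φ e₂) * y + φ e₂)
        (trans (cong φ (solve 3 (λ d s r → d :* (:0 :- s :* :1 :- r) := d :* (:0 :- s :- r)) refl d σ ρ))
          (solve 3 (λ x y z → x := (x :- z) :* :1 :+ (y :- z) :* :0 :+ z) refl (φ e₀) (φ e₁) (φ e₂)))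
        (trans (cong φ (solve 3 (λ d s r → d :* (:1 :- s :* :0 :- r) := d :* (:1 :- r)) refl d σ ρ))
          (solve 3 (λ x y z → y := (x :- z) :* :0 :+ (y :- z) :* :1 :+ z) refl (φ e₀) (φ e₁) (φ e₂)))
        (trans (cong φ (solve 3 (λ d s r → d :* (:0 :- s :* :0 :- r) := d :* (:0 :- r)) refl d σ ρ))
          (solve 3 (λ x y z → z := (x :- z) :* :0 :+ (y :- z) :* :0 :+ z) refl (φ e₀) (φ e₁) (φ e₂)))

      cube : Carrier → Carrier
      cube x = x * (x * x)

      sum-cubes : 0# ≤ V * (cube e₀ + K * cube e₁ + (V - 1# - K) * cube e₂)
      sum-cubes = subst (0# ≤_) (trans (sum-cong λ i → trans (sum-cong λ j → ent-map cube i j) (trans (sum-linear _ _ _ i)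
          (solve 5 (λ a b c k v → a :- c :+ (b :- c) :* k :+ v :* c := a :+ k :* b :+ (v :- :1 :- k) :* c) refl (cube e₀)
              (cube e₁) (cube e₂) K V))) (sum-const v _))
        (cube-sum-nonneg idem)

    module Pair (i₀ : Fin v) (u : Carrier) (Vu≡1 : V * u ≡ 1#) (θ σ d : Carrier) (θ+σ : θ + σ ≡ L - M) (θσ : θ * σ ≡ M - K)
             (d[θ-σ] : d * (θ - σ) ≡ 1#) (k′ : ℕ) (v≡ : v ≡ suc (k ℕ.+ k′)) where
      private
        -d[σ-θ] : (- d) * (σ - θ) ≡ 1#
        -d[σ-θ] = trans (solve 3 (λ d t s → (:- d) :* (s :- t) := d :* (t :- s)) refl d θ σ) d[θ-σ]
        module P = Idempotent i₀ u Vu≡1 θ σ d θ+σ θσ d[θ-σ]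
        module Q = Idempotent i₀ u Vu≡1 σ θ (- d) (trans (+-comm σ θ) θ+σ) (trans (*-comm σ θ) θσ) -d[σ-θ]
      open P public using (e₀; e₁; e₂)

      Eθ Eσ : SymmetricIdempotent v
      Eθ = P.idem
      Eσ = Q.idem

      -- The trace of I = Eθ + Eσ + J / v.
      trace-sum : trace Eθ + trace Eσ + 1# ≡ V
      trace-sum = trans (cong₂ (λ x y → x + y + 1#) P.trace-idem Q.trace-idem)
        (by₁ (V - 1#) (solve 5 (λ d v s t k → d :* (:- (v :* s) :- (k :- s)) :+ (:- d) :* (:- (v :* t) :- (k :- t)) :+ :1 :- v
          := (v :- :1) :* (d :* (t :- s) :- :1)) refl d V σ θ K) d[θ-σ])

      -- The trace of A = θ Eθ + σ Eσ + (k / v) J, whose diagonal is zero.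
      trace-adjacency : θ * trace Eθ + σ * trace Eσ + K ≡ 0#
      trace-adjacency = trans (cong₂ (λ x y → θ * x + σ * y + K) P.trace-idem Q.trace-idem)
        (by₁ (- K) (solve 5 (λ d v s t k → t :* (d :* (:- (v :* s) :- (k :- s))) :+ s :* ((:- d) :* (:- (v :* t) :- (k :- t))) :+ k :- :0
          := (:- k) :* (d :* (t :- s) :- :1)) refl d V σ θ K) d[θ-σ])

      -- A Krein parameter divided by v: the eigenvalue of the entrywise square of Eθ on the
      -- σ-eigenspace.
      q : Carrier
      q = (e₀ * e₀ - e₂ * e₂) + (e₁ * e₁ - e₂ * e₂) * σ

      hadamard : ∀ i j → sum (λ x → entry Eσ i x * (entry Eθ x j * entry Eθ x j)) ≡ q * entry Eσ i j
      hadamard i j = trans (sum-cong λ x → trans (cong (entry Eσ i x *_) (P.ent-map (λ z → z * z) x j))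
          (solve 6 (λ g a e b f c → g :* (a :* e :+ b :* f :+ c) := a :* (e :* g) :+ b :* (g :* f) :+ c :* g) refl
              (entry Eσ i x) A (δ x j) B (α x j) C))
        (trans (sum-+* _ (entry Eσ i) C) (trans (cong₂ _+_ (trans (sum-+* _ (λ x → entry Eσ i x * α x j) B) (cong₂ _+_
            (trans (sym (*-sum A _)) (cong (A *_) (sum-δ′ j (entry Eσ i)))) (cong (B *_) (Q.eigen i j)))) (cong (C *_) (Q.sum-ent i)))
          (solve 5 (λ a b c s g → a :* g :+ b :* (s :* g) :+ c :* :0 := (a :+ b :* s) :* g) refl A B C σ (entry Eσ i j))))
        where
        A = e₀ * e₀ - e₂ * e₂
        B = e₁ * e₁ - e₂ * e₂
        C = e₂ * e₂

      private
        K′ = fromℕ k′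

        V-1-K : V - 1# - K ≡ K′
        V-1-K = trans (cong (λ z → z - 1# - K) (trans (cong fromℕ v≡) (cong (1# +_) (fromℕ-+ k k′))))
          (solve 2 (λ k k′ → :1 :+ (k :+ k′) :- :1 :- k := k′) refl K K′)

        -- The counterpart of `K*e₁` for the complement, which has degree k′ and eigenvalue -1 - θ
        -- on the same eigenspace.
        K′*e₂ : K′ * e₂ ≡ - ((1# + θ) * e₀)
        K′*e₂ = by₂ 1# (- 1#) (solve 6 (λ x e₂ t e₀ k e₁ → x :* e₂ :- (:- ((:1 :+ t) :* e₀)) :=
          :1 :* (e₀ :+ k :* e₁ :+ x :* e₂ :- :0) :+ (:- :1) :* (k :* e₁ :- t :* e₀)) refl K′ e₂ θ e₀ K e₁)
          (trans (cong (λ z → e₀ + K * e₁ + z * e₂) (sym V-1-K)) P.sum-e) P.K*e₁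

      -- The Krein parameter cleared of denominators. Substituting e₁ = θ e₀ / k and e₂ = -(1 + θ)
      -- e₀ / k′ gives (k k′)² q = e₀² · `bracket`, an expression in which only the parameters and
      -- the roots remain.
      bracket : Carrier
      bracket = (K * K) * (K′ * K′) + (θ * θ * σ) * (K′ * K′) - ((1# + θ) * (1# + θ) * (1# + σ)) * (K * K)

      private
        q-bracket : (K * K) * (K′ * K′) * q ≡ e₀ * e₀ * bracket
        q-bracket = trans (solve 6 (λ k x e₀ e₁ e₂ s → (k :* k) :* (x :* x) :* ((e₀ :* e₀ :- e₂ :* e₂) :+ (e₁ :* e₁ :- e₂ :* e₂) :* s)
              := (k :* k) :* (x :* x) :* (e₀ :* e₀) :+ (k :* e₁) :* (k :* e₁) :* (x :* x) :* s :- (x :* e₂) :* (x :* e₂) :*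
                  (k :* k) :* (:1 :+ s)) refl K K′ e₀ e₁ e₂ σ)
          (trans (cong₂ (λ a b → (K * K) * (K′ * K′) * (e₀ * e₀) + a * a * (K′ * K′) * σ - b * b * (K * K) * (1# + σ)) P.K*e₁ K′*e₂)
            (solve 5 (λ k x e t s → (k :* k) :* (x :* x) :* (e :* e) :+ (t :* e) :* (t :* e) :* (x :* x) :* s :-
                (:- ((:1 :+ t) :* e)) :* (:- ((:1 :+ t) :* e)) :* (k :* k) :* (:1 :+ s)
              := e :* e :* ((k :* k) :* (x :* x) :+ (t :* t :* s) :* (x :* x) :- ((:1 :+ t) :* (:1 :+ t) :* (:1 :+ s)) :*
                  (k :* k))) refl K K′ e₀ θ σ))

        cube-bracket : (K * K) * (K′ * K′) * (P.cube e₀ + K * P.cube e₁ + K′ * P.cube e₂) ≡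
          e₀ * e₀ * e₀ * ((K * K) * (K′ * K′) + (θ * θ * θ) * (K′ * K′) - ((1# + θ) * (1# + θ) * (1# + θ)) * (K * K))
        cube-bracket = trans (solve 5 (λ k x e₀ e₁ e₂ → (k :* k) :* (x :* x) :*
            (e₀ :* (e₀ :* e₀) :+ k :* (e₁ :* (e₁ :* e₁)) :+ x :* (e₂ :* (e₂ :* e₂)))
              := (k :* k) :* (x :* x) :* (e₀ :* e₀ :* e₀) :+ (k :* e₁) :* (k :* e₁) :* (k :* e₁) :* (x :* x) :+ (x :* e₂) :*
                  (x :* e₂) :* (x :* e₂) :* (k :* k)) refl K K′ e₀ e₁ e₂)
          (trans (cong₂ (λ a b → (K * K) * (K′ * K′) * (e₀ * e₀ * e₀) + a * a * a * (K′ * K′) + b * b * b * (K * K)) P.K*e₁ K′*e₂)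
            (solve 4 (λ k x e t → (k :* k) :* (x :* x) :* (e :* e :* e) :+ (t :* e) :* (t :* e) :* (t :* e) :* (x :* x) :+
                (:- ((:1 :+ t) :* e)) :* (:- ((:1 :+ t) :* e)) :* (:- ((:1 :+ t) :* e)) :* (k :* k)
              := e :* e :* e :* ((k :* k) :* (x :* x) :+ (t :* t :* t) :* (x :* x) :- ((:1 :+ t) :* (:1 :+ t) :* (:1 :+ t)) :*
                  (k :* k))) refl K K′ e₀ θ))

      module _ (K≢0 : K ≢ 0#) (K′≢0 : K′ ≢ 0#) where
        -- If e₀ vanished, so would e₁ and e₂, hence also d = e₁ - e₂, against d (θ - σ) = 1.
        e₀≢0 : e₀ ≢ 0#
        e₀≢0 e₀≡0 = 0≢1 (sym (trans (sym d[θ-σ]) (trans (cong (_* (θ - σ)) d≡0) (zeroˡ _))))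
          where
          e₁≡0 : e₁ ≡ 0#
          e₁≡0 = *-cancelˡ K≢0 (trans P.K*e₁ (trans (cong (θ *_) e₀≡0) (trans (zeroʳ θ) (sym (zeroʳ K)))))
          e₂≡0 : e₂ ≡ 0#
          e₂≡0 = *-cancelˡ K′≢0 (trans K′*e₂ (trans (cong (λ z → - ((1# + θ) * z)) e₀≡0)
            (solve 2 (λ t k → :- ((:1 :+ t) :* :0) := k :* :0) refl θ K′)))
          d≡0 : d ≡ 0#
          d≡0 = trans (sym P.e₁-e₂) (trans (cong₂ _-_ e₁≡0 e₂≡0) (-‿inverseʳ 0#))

        absolute-bound : bracket ≢ 0# → trace Eσ ≤ trace Eθ * trace Eθ
        absolute-bound b≢0 = trace-bound Eθ Eσ q q≢0 hadamard
          where
          q≢0 : q ≢ 0#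
          q≢0 q≡0 = 0≢* (0≢* e₀≢0 e₀≢0) b≢0 (trans (sym q-bracket) (trans (cong ((K * K) * (K′ * K′) *_) q≡0) (zeroʳ _)))

        -- Multiplied by (k k′)², the sum of cubes factors as v e₀³ times the difference of the two
        -- sides. This factor may be cancelled: v e₀ is the trace f, so e₀ is non-negative, and it
        -- is not zero.
        krein : ∀ f → trace Eθ ≡ fromℕ f →
          ((1# + θ) * (1# + θ) * (1# + θ)) * (K * K) ≤ (K * K) * (K′ * K′) + (θ * θ * θ) * (K′ * K′)
        krein f tr = nonneg-diff (≤-*-cancelˡ {c = V * (e₀ * e₀ * e₀)} 0≤Ve³ (0≢* V≢0 (0≢* (0≢* e₀≢0 e₀≢0) e₀≢0))
            (subst₂ _≤_ (sym (zeroʳ _)) scale (*-pos _ _ (*-pos _ _ (0≤sq K) (0≤sq K′)) P.sum-cubes)))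
          where
          V≢0 : V ≢ 0#
          V≢0 e = 0≢1 (sym (trans (sym Vu≡1) (trans (cong (_* u) e) (zeroˡ u))))
          0≤e₀ : 0# ≤ e₀
          0≤e₀ = ≤-*-cancelˡ (0≤fromℕ v) V≢0 (subst₂ _≤_ (sym (zeroʳ V)) (sym (trans P.V*e₀ tr)) (0≤fromℕ f))
          0≤Ve³ : 0# ≤ V * (e₀ * e₀ * e₀)
          0≤Ve³ = *-pos _ _ (0≤fromℕ v) (*-pos _ _ (0≤sq e₀) 0≤e₀)
          scale : (K * K) * (K′ * K′) * (V * (P.cube e₀ + K * P.cube e₁ + (V - 1# - K) * P.cube e₂)) ≡
            V * (e₀ * e₀ * e₀) * ((K * K) * (K′ * K′) + (θ * θ * θ) * (K′ * K′) - ((1# + θ) * (1# + θ) * (1# + θ)) * (K * K))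
          scale = trans (cong (λ z → (K * K) * (K′ * K′) * (V * (P.cube e₀ + K * P.cube e₁ + z * P.cube e₂))) V-1-K)
            (trans (solve 3 (λ a v x → a :* (v :* x) := v :* (a :* x)) refl _ V _)
              (trans (cong (V *_) cube-bracket) (sym (*-assoc V (e₀ * e₀ * e₀) _))))

-- Inequalities and divisibility between the parameters.

module Arithmetic where
  open import Data.Nat
  open import Data.Nat.Properties
  open import Data.Nat.Divisibility using (_∣_; divides; ∣-refl; n∣m*n; *-cancelʳ-∣; *-monoˡ-∣; ∣1⇒≡1; ∣m+n∣m⇒∣n; ∣m∣n⇒∣m+n; ∣⇒≤)
  open import Data.Nat.GCD using (gcd; gcd[m,n]∣m; gcd[m,n]∣n; gcd-greatest)
  open import Data.Nat.Coprimality using (Coprime; coprime-divisor)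
  open import Data.Nat.Tactic.RingSolver using (solve-∀)
  open import Data.Integer as ℤ using (ℤ)
  import Data.Integer.Properties as ℤ
  open import Data.Integer.Divisibility.Signed as ℤ∣ using (∣ᵤ⇒∣; ∣⇒∣ᵤ)
  import Data.Integer.Tactic.RingSolver as ℤSolver

  -- b / a is a root of the monic polynomial x² - e x - h, so its denominator in lowest terms, a′,
  -- divides b′² while being coprime to b′, and must be a unit.
  rational-root : ∀ a b e h → a ≢ ℤ.+ 0 → b ℤ.* b ≡ e ℤ.* (a ℤ.* b) ℤ.+ h ℤ.* (a ℤ.* a) → ∃[ c ] b ≡ c ℤ.* a
  rational-root a b e h a≢0 eq with ∣ᵤ⇒∣ {ℤ.+ g} {a} (gcd[m,n]∣m ℤ.∣ a ∣ ℤ.∣ b ∣) | ∣ᵤ⇒∣ {ℤ.+ g} {b} (gcd[m,n]∣n ℤ.∣ a ∣ ℤ.∣ b ∣)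
    where g = gcd ℤ.∣ a ∣ ℤ.∣ b ∣
  ... | ℤ∣.divides a′ a≡ | ℤ∣.divides b′ b≡ = ℤ∣._∣_.quotient a∣b , ℤ∣._∣_.equality a∣b
    where
    g = gcd ℤ.∣ a ∣ ℤ.∣ b ∣
    instance
      g≢0 : ℤ.NonZero (ℤ.+ g)
      g≢0 = ℤ.≢-nonZero λ g≡0 → a≢0 (trans a≡ (trans (cong (a′ ℤ.*_) g≡0) (ℤ.*-zeroʳ a′)))
    reduced : b′ ℤ.* b′ ≡ a′ ℤ.* (e ℤ.* b′ ℤ.+ h ℤ.* a′)
    reduced = ℤ.*-cancelʳ-≡ _ _ (ℤ.+ g) (ℤ.*-cancelʳ-≡ _ _ (ℤ.+ g) (begin
      b′ ℤ.* b′ ℤ.* G ℤ.* G                                  ≡⟨ lhs b′ G ⟩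
      (b′ ℤ.* G) ℤ.* (b′ ℤ.* G)                              ≡⟨ cong₂ ℤ._*_ (sym b≡) (sym b≡) ⟩
      b ℤ.* b                                                ≡⟨ eq ⟩
      e ℤ.* (a ℤ.* b) ℤ.+ h ℤ.* (a ℤ.* a)                    ≡⟨ cong₂ (λ x y → e ℤ.* (x ℤ.* y) ℤ.+ h ℤ.* (x ℤ.* x)) a≡ b≡ ⟩
      _                                                      ≡⟨ rhs a′ b′ G e h ⟩
      a′ ℤ.* (e ℤ.* b′ ℤ.+ h ℤ.* a′) ℤ.* G ℤ.* G             ∎))
      where
      open ≡-Reasoning
      G = ℤ.+ g
      lhs : ∀ b G → b ℤ.* b ℤ.* G ℤ.* G ≡ (b ℤ.* G) ℤ.* (b ℤ.* G)
      lhs = ℤSolver.solve-∀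
      rhs : ∀ a b G e h → e ℤ.* ((a ℤ.* G) ℤ.* (b ℤ.* G)) ℤ.+ h ℤ.* ((a ℤ.* G) ℤ.* (a ℤ.* G)) ≡ a ℤ.* (e ℤ.* b ℤ.+ h ℤ.* a) ℤ.* G ℤ.* G
      rhs = ℤSolver.solve-∀
    abs≡ : ∀ {x y} → x ≡ y ℤ.* (ℤ.+ g) → ℤ.∣ x ∣ ≡ ℤ.∣ y ∣ * g
    abs≡ {x} {y} p = trans (cong ℤ.∣_∣ p) (ℤ.abs-* y (ℤ.+ g))
    coprime : Coprime ℤ.∣ a′ ∣ ℤ.∣ b′ ∣
    coprime {d} (d∣a′ , d∣b′) = ∣1⇒≡1 (*-cancelʳ-∣ g (subst (d * g ∣_) (sym (*-identityˡ g)) (gcd-greatest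
        (subst (d * g ∣_) (sym (abs≡ {a} {a′} a≡)) (*-monoˡ-∣ g d∣a′)) (subst (d * g ∣_) (sym (abs≡ {b} {b′} b≡)) (*-monoˡ-∣ g d∣b′)))))
      where instance _ = g≢0
    a′∣b′² : ℤ.∣ a′ ∣ ∣ ℤ.∣ b′ ∣ * ℤ.∣ b′ ∣
    a′∣b′² = divides ℤ.∣ e ℤ.* b′ ℤ.+ h ℤ.* a′ ∣ (trans (sym (ℤ.abs-* b′ b′)) (trans (cong ℤ.∣_∣ reduced)
      (trans (ℤ.abs-* a′ _) (*-comm ℤ.∣ a′ ∣ _))))
    a′∣1 : ℤ.∣ a′ ∣ ≡ 1
    a′∣1 = coprime (∣-refl , coprime-divisor coprime a′∣b′²)
    a∣b : a ℤ∣.∣ b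
    a∣b = ∣ᵤ⇒∣ (subst₂ _∣_ (sym (trans (abs≡ {a} {a′} a≡) (trans (cong (_* g) a′∣1) (*-identityˡ g)))) (sym (abs≡ {b} {b′} b≡))
        (n∣m*n ℤ.∣ b′ ∣))

  open ≤-Reasoning

  private
    ^-distribʳ-* : ∀ x y n → (x * y) ^ n ≡ x ^ n * y ^ n
    ^-distribʳ-* x y zero    = refl
    ^-distribʳ-* x y (suc n) = trans (cong (x * y *_) (^-distribʳ-* x y n)) (interchange x y (x ^ n) (y ^ n))
      where
      interchange : ∀ x y a b → x * y * (a * b) ≡ x * a * (y * b)
      interchange = solve-∀

    pow-split : ∀ x a b → x ^ (a + b) ≡ x ^ a * x ^ b
    pow-split = ^-distribˡ-+-*

    1≤⇒≤* : ∀ {a b} → 1 ≤ a → b ≤ a * b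
    1≤⇒≤* {a} {b} p = subst (_≤ a * b) (*-identityˡ b) (*-monoˡ-≤ b p)

    [2k]^10 : ∀ k → (2 * k) ^ 10 ≡ 1024 * k ^ 10
    [2k]^10 k = ^-distribʳ-* 2 k 10

    contradictory-constants : ∀ c {k} → 1 ≤ k → suc c ≤ 1024 → ¬ (1024 * k ^ 10 ≤ c * k ^ 10)
    contradictory-constants c {k} 1≤k c<1024 h = <-irrefl refl (begin-strict
      1024          ≤⟨ *-cancelʳ-≤ 1024 c (k ^ 10) {{k^10≢0}} h ⟩
      c             <⟨ c<1024 ⟩
      1024          ∎)
      where
      instance k≢0 = >-nonZero 1≤k
      k^10≢0 = m^n≢0 k 10

    absolute⇒ : ∀ {v k f x} c → 2 ≤ v → v ≤ 1 + f + f * f → f * x ^ 2 ≤ c * k ^ 2 →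
      v * x ^ 10 ≤ 3 * (c * c) * k ^ 4 * x ^ 6
    absolute⇒ {v} {k} {zero}  {x} c 2≤v v≤ _ = ⊥-elim (<-irrefl refl (≤-trans 2≤v v≤))
    absolute⇒ {v} {k} {f@(suc f′)} {x} c 2≤v v≤ fx² = begin
      v * x ^ 10                                ≡⟨ cong (v *_) (pow-split x 4 6) ⟩
      v * (x ^ 4 * x ^ 6)                       ≡⟨ sym (*-assoc v (x ^ 4) (x ^ 6)) ⟩
      v * x ^ 4 * x ^ 6                         ≤⟨ *-monoˡ-≤ (x ^ 6) (*-monoˡ-≤ (x ^ 4) v≤3ff) ⟩
      3 * (f * f) * x ^ 4 * x ^ 6               ≡⟨ cong (_* x ^ 6) (trans (cong (3 * (f * f) *_) (pow-split x 2 2)) (regroup f (x ^ 2))) ⟩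
      3 * ((f * x ^ 2) * (f * x ^ 2)) * x ^ 6   ≤⟨ *-monoˡ-≤ (x ^ 6) (*-monoʳ-≤ 3 (*-mono-≤ fx² fx²)) ⟩
      3 * ((c * k ^ 2) * (c * k ^ 2)) * x ^ 6   ≡⟨ cong (_* x ^ 6)
          (trans (regroup′ c (k ^ 2)) (cong (3 * (c * c) *_) (sym (pow-split k 2 2)))) ⟩
      3 * (c * c) * k ^ 4 * x ^ 6               ∎
      where
      regroup : ∀ f y → 3 * (f * f) * (y * y) ≡ 3 * ((f * y) * (f * y))
      regroup = solve-∀
      regroup′ : ∀ c y → 3 * ((c * y) * (c * y)) ≡ 3 * (c * c) * (y * y)
      regroup′ = solve-∀
      3ff : ∀ f → 3 * (suc f * suc f) ≡ 1 + suc f + suc f * suc f + (f * (3 + 2 * f))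
      3ff = solve-∀
      v≤3ff : v ≤ 3 * (f * f)
      v≤3ff = ≤-trans v≤ (≤-trans (m≤m+n _ _) (≤-reflexive (sym (3ff f′))))

    k^10-split : ∀ k → k ^ 4 * k ^ 6 ≡ k ^ 10
    k^10-split k = sym (pow-split k 4 6)

  -- v, k, k′, l, μ are the parameters of a strongly regular graph, k′ being the degree of the complement.
  record Parameters (v k k′ l μ : ℕ) : Set where
    field
      v≡    : v ≡ suc (k + k′)
      k²≡   : k * k ≡ k + l * k + μ * k′
      1≤μ   : 1 ≤ μ
      1≤k   : 1 ≤ k
      1≤k′  : 1 ≤ k′

    v≤2k² : v ≤ 2 * k ^ 2
    v≤2k² = begin
      v                                  ≡⟨ v≡ ⟩
      1 + (k + k′)                       ≤⟨ s≤s (+-mono-≤ (m≤m+n k (l * k)) (1≤⇒≤* 1≤μ)) ⟩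
      1 + (k + l * k + μ * k′)           ≡⟨ cong suc (sym k²≡) ⟩
      1 + k * k                          ≤⟨ +-monoˡ-≤ (k * k) (*-mono-≤ 1≤k 1≤k) ⟩
      k * k + k * k                      ≡⟨ double k ⟩
      2 * k ^ 2                          ∎
      where
      double : ∀ k → k * k + k * k ≡ 2 * (k * (k * 1))
      double = solve-∀

    2≤v : 2 ≤ v
    2≤v = ≤-trans (s≤s (≤-trans 1≤k (m≤m+n k k′))) (≤-reflexive (sym v≡))

  -- The eigenvalues other than k are r and -(1 + n).
  module Eigenvalues {v k k′ l μ} (params : Parameters v k k′ l μ) (r n : ℕ)
         (k≡ : k ≡ r * suc n + μ) (l≡ : l + suc n ≡ μ + r) where
    open Parameters params
    m = suc n

    -- The standard count μ k′ = k (k - l - 1), with k - l - 1 = (r + 1)(m - 1).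
    μk′≡ : μ * k′ ≡ k * suc r * n
    μk′≡ = +-cancelˡ-≡ (k + l * k) _ _ (trans (sym k²≡) (trans (cong (k *_) k≡) (trans (reorder k r n μ)
        (trans (cong (λ z → k * (r * n) + k * z) (sym l≡)) (collect k r n l)))))
      where
      reorder : ∀ k r n μ → k * (r * suc n + μ) ≡ k * (r * n) + k * (μ + r)
      reorder = solve-∀
      collect : ∀ k r n l → k * (r * n) + k * (l + suc n) ≡ k + l * k + k * suc r * n
      collect = solve-∀

    1≤n : 1 ≤ n
    1≤n = n≢0⇒n>0 λ n≡0 → <-irrefl (sym (trans μk′≡ (trans (cong (k * suc r *_) n≡0) (*-zeroʳ (k * suc r))))) (*-mono-≤ 1≤μ 1≤k′)

    rm≤k : r * m ≤ k
    rm≤k = ≤-trans (m≤m+n (r * m) μ) (≤-reflexive (sym k≡))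

    r<k : r < k
    r<k = begin-strict
      r              ≡⟨ sym (*-identityʳ r) ⟩
      r * 1          ≤⟨ *-monoʳ-≤ r (s≤s z≤n) ⟩
      r * m          <⟨ m<m+n (r * m) 1≤μ ⟩
      r * m + μ      ≡⟨ sym k≡ ⟩
      k              ∎

    -- Positivity of `bracket` for θ = r and σ = -m, as the absolute bound requires.
    rm-bracket : (r * r * m) * (k′ * k′) < (k * k) * (k′ * k′) + (suc r * suc r * n) * (k * k)
    rm-bracket = begin-strict
      (r * r * m) * (k′ * k′)   ≤⟨ *-monoˡ-≤ (k′ * k′) (≤-trans (≤-reflexive (*-assoc r r m)) (*-monoʳ-≤ r rm≤k)) ⟩
      (r * k) * (k′ * k′)       <⟨ *-monoˡ-< (k′ * k′) {{>-nonZero (*-mono-≤ 1≤k′ 1≤k′)}} (*-monoˡ-< k {{>-nonZero 1≤k}} r<k) ⟩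
      (k * k) * (k′ * k′)       ≤⟨ m≤m+n _ _ ⟩
      _                         ∎

    -- Positivity of `bracket` for θ = -m and σ = r.
    mr-bracket : 1 ≤ r → (n * n * suc r) * (k * k) < (k * k) * (k′ * k′) + (m * m * r) * (k′ * k′)
    mr-bracket 1≤r = begin-strict
      (n * n * suc r) * (k * k)   ≡⟨ cong (_* (k * k)) (*-assoc n n (suc r)) ⟩
      n * (n * suc r) * (k * k)   ≤⟨ *-monoˡ-≤ (k * k) (*-monoʳ-≤ n nr≤k′) ⟩
      n * k′ * (k * k)            <⟨ *-monoˡ-< (k * k) {{>-nonZero (*-mono-≤ 1≤k 1≤k)}} (*-monoˡ-< k′ {{>-nonZero 1≤k′}} n<k′) ⟩
      k′ * k′ * (k * k)           ≡⟨ *-comm (k′ * k′) (k * k) ⟩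
      k * k * (k′ * k′)           ≤⟨ m≤m+n _ _ ⟩
      _                           ∎
      where
      nr≤k′ : n * suc r ≤ k′
      nr≤k′ = *-cancelˡ-≤ μ {{>-nonZero 1≤μ}} (begin
        μ * (n * suc r)      ≤⟨ *-monoˡ-≤ (n * suc r) (≤-trans (m≤n+m μ (r * m)) (≤-reflexive (sym k≡))) ⟩
        k * (n * suc r)      ≡⟨ trans (cong (k *_) (*-comm n (suc r))) (sym (*-assoc k (suc r) n)) ⟩
        k * suc r * n        ≡⟨ sym μk′≡ ⟩
        μ * k′               ∎)
      n<k′ : n < k′
      n<k′ = begin-strict
        n              ≡⟨ sym (*-identityʳ n) ⟩
        n * 1          <⟨ *-monoʳ-< n {{>-nonZero 1≤n}} (s≤s 1≤r) ⟩
        n * suc r      ≤⟨ nr≤k′ ⟩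
        k′             ∎

    m-not-large : ∀ {f g} → 1 ≤ r → v ≡ suc (f + g) → f * m ≡ g * r + k → g ≤ f * f →
      m * m * m * (k′ * k′) ≤ k * k * (k′ * k′) + n * n * n * (k * k) → ¬ ((2 * k) ^ 10 ≤ v * m ^ 10)
    m-not-large {f} {g} 1≤r v≡fg traces absolute krein bad with 2 * k ≤? k′
    -- Now n³ k² is at most a quarter of m³ k′², so the Krein inequality gives 3 m³ ≤ 4 k². Then m¹⁰
    -- = (m³)³ m ≤ 8 k⁶ k, and v ≤ 2 k² yields the constant 16.
    ... | yes 2k≤k′ = contradictory-constants 16 1≤k (m≤m+n 17 1007) (begin
        1024 * k ^ 10                    ≡⟨ sym ([2k]^10 k) ⟩
        (2 * k) ^ 10                     ≤⟨ bad ⟩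
        v * m ^ 10                       ≤⟨ *-mono-≤ v≤2k² (begin
            m ^ 10                                   ≡⟨ split m ⟩
            m * m * m * (m * m * m * (m * m * m)) * m  ≤⟨ *-mono-≤ (*-mono-≤ m³≤ (*-mono-≤ m³≤ m³≤)) m≤k ⟩
            2 * (k * k) * (2 * (k * k) * (2 * (k * k))) * k ∎) ⟩
        2 * k ^ 2 * (2 * (k * k) * (2 * (k * k) * (2 * (k * k))) * k) ≡⟨ collect k ⟩
        16 * (k ^ 9 * 1)                 ≤⟨ *-monoʳ-≤ 16 (*-monoʳ-≤ (k ^ 9) 1≤k) ⟩
        16 * (k ^ 9 * k)                 ≡⟨ cong (16 *_) (*-comm (k ^ 9) k) ⟩
        16 * k ^ 10                      ∎)
      where
      m≤k : m ≤ k
      m≤k = ≤-trans (1≤⇒≤* 1≤r) rm≤k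
      split : ∀ m → m * (m * (m * (m * (m * (m * (m * (m * (m * (m * 1))))))))) ≡ m * m * m * (m * m * m * (m * m * m)) * m
      split = solve-∀
      collect : ∀ k → 2 * (k * (k * 1)) * (2 * (k * k) * (2 * (k * k) * (2 * (k * k))) * k) ≡ 16 *
          ((k * (k * (k * (k * (k * (k * (k * (k * (k * 1))))))))) * 1)
      collect = solve-∀
      4k²≤k′² : 4 * (k * k) ≤ k′ * k′
      4k²≤k′² = ≤-trans (≤-reflexive (four k)) (*-mono-≤ 2k≤k′ 2k≤k′)
        where
        four : ∀ k → 4 * (k * k) ≡ 2 * k * (2 * k)
        four = solve-∀
      cubes : 4 * (n * n * n * (k * k)) ≤ m * m * m * (k′ * k′)
      cubes = begin
        4 * (n * n * n * (k * k))   ≡⟨ shuffle (n * n * n) (k * k) ⟩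
        n * n * n * (4 * (k * k))   ≤⟨ *-mono-≤ (*-mono-≤ (*-mono-≤ (n≤1+n n) (n≤1+n n)) (n≤1+n n)) 4k²≤k′² ⟩
        m * m * m * (k′ * k′)       ∎
        where
        shuffle : ∀ a b → 4 * (a * b) ≡ a * (4 * b)
        shuffle = solve-∀
      3m³≤4k² : 3 * (m * m * m) ≤ 4 * (k * k)
      3m³≤4k² = *-cancelʳ-≤ _ _ (k′ * k′) {{>-nonZero (*-mono-≤ 1≤k′ 1≤k′)}} (+-cancelʳ-≤ X _ _ (begin
        3 * (m * m * m) * (k′ * k′) + X          ≡⟨ add (m * m * m) (k′ * k′) ⟩
        4 * X                                    ≤⟨ *-monoʳ-≤ 4 krein ⟩
        4 * (k * k * (k′ * k′) + n * n * n * (k * k)) ≡⟨ distrib (k * k) (k′ * k′) (n * n * n) ⟩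
        4 * (k * k) * (k′ * k′) + 4 * (n * n * n * (k * k)) ≤⟨ +-monoʳ-≤ (4 * (k * k) * (k′ * k′)) cubes ⟩
        4 * (k * k) * (k′ * k′) + X              ∎))
        where
        X = m * m * m * (k′ * k′)
        add : ∀ a b → 3 * a * b + a * b ≡ 4 * (a * b)
        add = solve-∀
        distrib : ∀ a b c → 4 * (a * b + c * a) ≡ 4 * a * b + 4 * (c * a)
        distrib = solve-∀
      m³≤ : m * m * m ≤ 2 * (k * k)
      m³≤ = *-cancelˡ-≤ 3 (begin
        3 * (m * m * m)       ≤⟨ 3m³≤4k² ⟩
        4 * (k * k)           ≤⟨ *-monoˡ-≤ (k * k) (m≤m+n 4 2) ⟩
        6 * (k * k)           ≡⟨ *-assoc 3 2 (k * k) ⟩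
        3 * (2 * (k * k))     ∎)
    -- Here v ≤ 3 k and the trace equation gives f m² = g (r m) + k m ≤ 2 v k ≤ 6 k²; the constant
    -- is 108 = 3 · 6².
    ... | no 2k≰k′ = contradictory-constants 108 1≤k (m≤m+n 109 915) (begin
        1024 * k ^ 10                    ≡⟨ sym ([2k]^10 k) ⟩
        (2 * k) ^ 10                     ≤⟨ bad ⟩
        v * m ^ 10                       ≤⟨ absolute⇒ {k = k} {f} {m} 6 2≤v (≤-trans (≤-reflexive v≡fg) (+-monoʳ-≤ (suc f) absolute)) fm²≤ ⟩
        108 * k ^ 4 * m ^ 6              ≤⟨ *-monoʳ-≤ (108 * k ^ 4) (^-monoˡ-≤ 6 m≤k) ⟩
        108 * k ^ 4 * k ^ 6              ≡⟨ trans (*-assoc 108 (k ^ 4) (k ^ 6)) (cong (108 *_) (k^10-split k)) ⟩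
        108 * k ^ 10                     ∎)
      where
      m≤k : m ≤ k
      m≤k = ≤-trans (1≤⇒≤* 1≤r) rm≤k
      v≤3k : v ≤ 3 * k
      v≤3k = begin
        v              ≡⟨ v≡ ⟩
        suc (k + k′)   ≡⟨ sym (+-suc k k′) ⟩
        k + suc k′     ≤⟨ +-monoʳ-≤ k (≰⇒> 2k≰k′) ⟩
        3 * k          ∎
      fm²≤ : f * m ^ 2 ≤ 6 * k ^ 2
      fm²≤ = begin
        f * m ^ 2                ≡⟨ square f m ⟩
        m * (f * m)              ≡⟨ trans (cong (m *_) traces) (distrib m g r k) ⟩
        g * (r * m) + k * m      ≤⟨ +-mono-≤ (*-mono-≤ g≤v rm≤k) (*-mono-≤ k≤v m≤k) ⟩
        v * k + v * k            ≤⟨ +-mono-≤ (*-monoˡ-≤ k v≤3k) (*-monoˡ-≤ k v≤3k) ⟩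
        3 * k * k + 3 * k * k    ≡⟨ six k ⟩
        6 * k ^ 2                ∎
        where
        g≤v : g ≤ v
        g≤v = ≤-trans (m≤n+m g (suc f)) (≤-reflexive (sym v≡fg))
        k≤v : k ≤ v
        k≤v = ≤-trans (≤-trans (n≤1+n k) (s≤s (m≤m+n k k′))) (≤-reflexive (sym v≡))
        square : ∀ f m → f * (m * (m * 1)) ≡ m * (f * m)
        square = solve-∀
        distrib : ∀ m g r k → m * (g * r + k) ≡ g * (r * m) + k * m
        distrib = solve-∀
        six : ∀ k → 3 * k * k + 3 * k * k ≡ 6 * (k * (k * 1))
        six = solve-∀

    module RLarge {f g} (1≤r : 1 ≤ r) (v≡fg : v ≡ suc (f + g)) (traces : f * r + k ≡ g * m) (absolute : g ≤ f * f)
             (bad : (2 * k) ^ 10 ≤ v * r ^ 10) where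
      private
        bad′ : 1024 * k ^ 10 ≤ v * r ^ 10
        bad′ = subst (_≤ v * r ^ 10) ([2k]^10 k) bad

        v≤ : v ≤ 1 + f + f * f
        v≤ = ≤-trans (≤-reflexive v≡fg) (+-monoʳ-≤ (suc f) absolute)

        fr²≤vk : f * r ^ 2 ≤ v * k
        fr²≤vk = begin
          f * r ^ 2                  ≡⟨ square f r ⟩
          r * (f * r)                ≤⟨ *-monoʳ-≤ r (≤-trans (m≤m+n (f * r) k) (≤-reflexive traces)) ⟩
          r * (g * m)                ≡⟨ swap r g m ⟩
          g * (r * m)                ≤⟨ *-mono-≤ (≤-trans (m≤n+m g (suc f)) (≤-reflexive (sym v≡fg))) rm≤k ⟩
          v * k                      ∎
          where
          square : ∀ f r → f * (r * (r * 1)) ≡ r * (f * r)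
          square = solve-∀
          swap : ∀ r g m → r * (g * m) ≡ g * (r * m)
          swap = solve-∀

      -- 18 is the largest integer c with 3 c² < 1024. The factor m³, squared by the absolute bound,
      -- pairs with the remaining r⁶ to give (r m)⁶ ≤ k⁶.
      v-large : 18 * m ^ 3 * k < v
      v-large = ≰⇒> λ v-small → contradictory-constants 972 1≤k (m≤m+n 973 51) (begin
        1024 * k ^ 10                                            ≤⟨ bad′ ⟩
        v * r ^ 10                                               ≤⟨ absolute⇒ {k = k} {f} {r} (18 * m ^ 3) 2≤v v≤ (begin
            f * r ^ 2                   ≤⟨ fr²≤vk ⟩
            v * k                       ≤⟨ *-monoˡ-≤ k v-small ⟩
            18 * m ^ 3 * k * k          ≡⟨ sqk (18 * m ^ 3) k ⟩
            18 * m ^ 3 * k ^ 2          ∎) ⟩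
        3 * (18 * m ^ 3 * (18 * m ^ 3)) * k ^ 4 * r ^ 6          ≡⟨ constants (m ^ 3) (k ^ 4) (r ^ 6) ⟩
        972 * (k ^ 4 * (r ^ 6 * (m ^ 3 * m ^ 3)))                ≡⟨ cong (λ z → 972 * (k ^ 4 * (r ^ 6 * z))) (sym (pow-split m 3 3)) ⟩
        972 * (k ^ 4 * (r ^ 6 * m ^ 6))                          ≡⟨ cong (λ z → 972 * (k ^ 4 * z)) (sym (^-distribʳ-* r m 6)) ⟩
        972 * (k ^ 4 * (r * m) ^ 6)                              ≤⟨ *-monoʳ-≤ 972 (*-monoʳ-≤ (k ^ 4) (^-monoˡ-≤ 6 rm≤k)) ⟩
        972 * (k ^ 4 * k ^ 6)                                    ≡⟨ cong (972 *_) (k^10-split k) ⟩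
        972 * k ^ 10                                             ∎)
        where
        sqk : ∀ c k → c * k * k ≡ c * (k * (k * 1))
        sqk = solve-∀
        constants : ∀ a b c → 3 * (18 * a * (18 * a)) * b * c ≡ 972 * (b * (c * (a * a)))
        constants = solve-∀

      -- Otherwise r + 1 ≤ 17 m² μ, so `μk′≡` gives k′ ≤ 17 m² n k. Passing from 17 to 18 pays for
      -- the vertices outside k′, and v ≤ 18 m³ k contradicts `v-large`.
      r-large : 17 * (m * m) * μ ≤ r
      r-large = ≮⇒≥ λ r-small → <⇒≱ v-large (begin
        v                                        ≡⟨ v≡ ⟩
        1 + (k + k′)                             ≤⟨ +-mono-≤ 1≤k (+-monoʳ-≤ k (k′≤ r-small)) ⟩
        k + (k + k * (17 * (m * m)) * n)         ≤⟨ m≤m+n _ _ ⟩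
        k + (k + k * (17 * (m * m)) * n) + k * (16 + 34 * n + 18 * (n * n) + (m * m) * n + 2 * n) ≡⟨ expand k n ⟩
        18 * m ^ 3 * k                           ∎)
        where
        expand : ∀ k n → k + (k + k * (17 * (suc n * suc n)) * n) + k *
            (16 + 34 * n + 18 * (n * n) + (suc n * suc n) * n + 2 * n) ≡ 18 * (suc n * (suc n * (suc n * 1))) * k
        expand = solve-∀
        k′≤ : r < 17 * (m * m) * μ → k′ ≤ k * (17 * (m * m)) * n
        k′≤ r-small = *-cancelˡ-≤ μ {{>-nonZero 1≤μ}} (begin
          μ * k′                        ≡⟨ μk′≡ ⟩
          k * suc r * n                 ≤⟨ *-monoˡ-≤ n (*-monoʳ-≤ k r-small) ⟩
          k * (17 * (m * m) * μ) * n    ≡⟨ shuffle k (m * m) μ n ⟩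
          μ * (k * (17 * (m * m)) * n)  ∎)
          where
          shuffle : ∀ k x μ n → k * (17 * x * μ) * n ≡ μ * (k * (17 * x) * n)
          shuffle = solve-∀

      -- Dividing the assumed inequality by 2 k² ≥ v leaves 512 k⁸ ≤ r¹⁰; inserting r m ≤ k leaves
      -- 512 m⁸ ≤ r².
      r>m⁴ : m ^ 4 < r
      r>m⁴ = ≰⇒> λ r≤m⁴ → <-irrefl refl (begin-strict
        r ^ 2                  ≤⟨ ^-monoˡ-≤ 2 r≤m⁴ ⟩
        (m ^ 4) ^ 2            ≡⟨ ^-*-assoc m 4 2 ⟩
        m ^ 8                  <⟨ m<m+n (m ^ 8) (*-mono-≤ (s≤s (z≤n {510})) (m^n>0 m 8)) ⟩
        m ^ 8 + 511 * m ^ 8    ≤⟨ *-cancelˡ-≤ (r ^ 8) {{m^n≢0 r 8 {{>-nonZero 1≤r}}}} r⁸≤ ⟩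
        r ^ 2                  ∎)
        where
        512k⁸≤ : 512 * k ^ 8 ≤ r ^ 10
        512k⁸≤ = *-cancelˡ-≤ (2 * k ^ 2) {{>-nonZero (*-mono-≤ (s≤s (z≤n {1})) (^-monoˡ-≤ 2 1≤k))}} (begin
          2 * k ^ 2 * (512 * k ^ 8)    ≡⟨ regroup (k ^ 2) (k ^ 8) ⟩
          1024 * (k ^ 2 * k ^ 8)       ≡⟨ cong (1024 *_) (sym (pow-split k 2 8)) ⟩
          1024 * k ^ 10                ≤⟨ bad′ ⟩
          v * r ^ 10                   ≤⟨ *-monoˡ-≤ (r ^ 10) v≤2k² ⟩
          2 * k ^ 2 * r ^ 10           ∎)
          where
          regroup : ∀ a b → 2 * a * (512 * b) ≡ 1024 * (a * b)
          regroup = solve-∀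
        r⁸≤ : r ^ 8 * (512 * m ^ 8) ≤ r ^ 8 * r ^ 2
        r⁸≤ = begin
          r ^ 8 * (512 * m ^ 8)   ≡⟨ regroup (r ^ 8) (m ^ 8) ⟩
          512 * (r ^ 8 * m ^ 8)   ≡⟨ cong (512 *_) (sym (^-distribʳ-* r m 8)) ⟩
          512 * (r * m) ^ 8       ≤⟨ *-monoʳ-≤ 512 (^-monoˡ-≤ 8 rm≤k) ⟩
          512 * k ^ 8             ≤⟨ 512k⁸≤ ⟩
          r ^ 10                  ≡⟨ pow-split r 8 2 ⟩
          r ^ 8 * r ^ 2           ∎
          where
          regroup : ∀ a b → a * (512 * b) ≡ 512 * (a * b)
          regroup = solve-∀

      -- The multiplicity f of r is an integer, so r + m divides n m a (a + 1).
      partial-geometry-bound : ∀ K T a → k ≡ m * K → K ≡ T + r → μ ≡ m * T → n ≡ T + a → 1 ≤ T → ¬ 1 ≤ a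
      partial-geometry-bound K T a k≡mK K≡ μ≡mT n≡ 1≤T 1≤a = <-irrefl refl (begin-strict
          m ^ 4              <⟨ r>m⁴ ⟩
          r                  ≤⟨ m≤m+n r m ⟩
          q                  ≤⟨ ∣⇒≤ {{>-nonZero (*-mono-≤ (*-mono-≤ 1≤n (s≤s z≤n)) (*-mono-≤ 1≤a (s≤s z≤n)))}} q∣ ⟩
          n * m * (a * suc a)  ≤⟨ *-mono-≤ (*-monoˡ-≤ m (n≤1+n n)) (*-mono-≤ (≤-trans a≤n (n≤1+n n)) (s≤s a≤n)) ⟩
          m * m * (m * m)    ≡⟨ fourth m ⟩
          m ^ 4              ∎)
        where
        q = r + m
        a≤n : a ≤ n
        a≤n = ≤-trans (m≤n+m a T) (≤-reflexive (sym n≡))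
        fourth : ∀ m → m * m * (m * m) ≡ m * (m * (m * (m * 1)))
        fourth = solve-∀
        f*q : f * q + k ≡ (k + k′) * m
        f*q = trans (e₁ f r m k) (trans (cong (_+ f * m) traces) (trans (e₂ g m f) (cong (_* m) (suc-injective (trans (sym v≡fg) v≡)))))
          where
          e₁ : ∀ f r m k → f * (r + m) + k ≡ f * r + k + f * m
          e₁ = solve-∀
          e₂ : ∀ g m f → g * m + f * m ≡ (f + g) * m
          e₂ = solve-∀
        μfq : μ * (f * q) ≡ m * (K * (n * m * suc K))
        μfq = +-cancelʳ-≡ (μ * k) _ _ (begin-equality
          μ * (f * q) + μ * k              ≡⟨ sym (*-distribˡ-+ μ (f * q) k) ⟩
          μ * (f * q + k)                  ≡⟨ cong (μ *_) f*q ⟩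
          μ * ((k + k′) * m)               ≡⟨ e₁ μ k k′ m ⟩
          μ * k * m + μ * k′ * m           ≡⟨ cong (λ z → μ * k * m + z * m) μk′≡ ⟩
          μ * k * m + k * suc r * n * m    ≡⟨ e₂ μ k n r ⟩
          k * (n * (μ + m * suc r)) + μ * k  ≡⟨ cong (λ z → k * (n * (z + m * suc r)) + μ * k) μ≡mT ⟩
          k * (n * (m * T + m * suc r)) + μ * k ≡⟨ cong (_+ μ * k)
              (trans (cong₂ (λ x y → x * (n * y)) k≡mK (trans (e₃ m T r) (cong (λ z → m * suc z) (sym K≡)))) (e₄ m K n (suc K))) ⟩
          m * (K * (n * m * suc K)) + μ * k  ∎)
          where
          e₁ : ∀ μ k k′ m → μ * ((k + k′) * m) ≡ μ * k * m + μ * k′ * m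
          e₁ = solve-∀
          e₂ : ∀ μ k n r → μ * k * suc n + k * suc r * n * suc n ≡ k * (n * (μ + suc n * suc r)) + μ * k
          e₂ = solve-∀
          e₃ : ∀ m T r → m * T + m * suc r ≡ m * suc (T + r)
          e₃ = solve-∀
          e₄ : ∀ m K n L → m * K * (n * (m * L)) ≡ m * (K * (n * m * L))
          e₄ = solve-∀
        Tfq : T * f * q ≡ n * m * (K * suc K)
        Tfq = *-cancelˡ-≡ _ _ m (begin-equality
          m * (T * f * q)                ≡⟨ e₁ m T f q ⟩
          m * T * (f * q)                ≡⟨ cong (_* (f * q)) (sym μ≡mT) ⟩
          μ * (f * q)                    ≡⟨ μfq ⟩
          m * (K * (n * m * suc K))      ≡⟨ e₂ m K (n * m) (suc K) ⟩
          m * (n * m * (K * suc K))      ∎)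
          where
          e₁ : ∀ m T f q → m * (T * f * q) ≡ m * T * (f * q)
          e₁ = solve-∀
          e₂ : ∀ m K x L → m * (K * (x * L)) ≡ m * (x * (K * L))
          e₂ = solve-∀
        q≡ : q ≡ K + suc a
        q≡ = begin-equality
          r + suc n            ≡⟨ cong (λ z → r + suc z) n≡ ⟩
          r + suc (T + a)      ≡⟨ e r T a ⟩
          T + r + suc a        ≡⟨ cong (_+ suc a) (sym K≡) ⟩
          K + suc a            ∎
          where
          e : ∀ r T a → r + suc (T + a) ≡ T + r + suc a
          e = solve-∀
        -- Modulo q = K + a + 1 one has K ≡ -(a + 1) and K + 1 ≡ -a, so K (K + 1) in `Tfq` may be
        -- replaced by a (a + 1).
        q∣ : q ∣ n * m * (a * suc a)
        q∣ = ∣m+n∣m⇒∣n {m = n * m * K * q}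
          (subst (q ∣_) (trans (cong (λ z → n * m * (K * suc K) + n * m * a * z) q≡)
              (trans (e (n * m) K a) (cong (λ z → n * m * K * z + n * m * (a * suc a)) (sym q≡))))
            (∣m∣n⇒∣m+n (divides (T * f) (sym Tfq)) (n∣m*n (n * m * a))))
          (n∣m*n (n * m * K))
          where
          e : ∀ x K a → x * (K * suc K) + x * a * (K + suc a) ≡ x * K * (K + suc a) + x * (a * suc a)
          e = solve-∀

  conference : ∀ {v k k′ l μ} → Parameters v k k′ l μ → ∀ f → v ≡ suc (f + f) → f * l + k ≡ f * μ →
    μ ≡ suc l × k ≡ 2 * μ × v ≡ suc (4 * μ)
  conference {v} {k} {k′} {l} {μ} params f v≡ff fl+k≡fμ = μ≡ , k≡2μ ,
      trans v≡ff (cong suc (trans (cong₂ _+_ f≡k f≡k) (trans (cong₂ _+_ k≡2μ k≡2μ) (four μ))))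
    where
    open Parameters params
    four : ∀ μ → 2 * μ + 2 * μ ≡ 4 * μ
    four = solve-∀
    kk′≡ff : k + k′ ≡ f + f
    kk′≡ff = suc-injective (trans (sym v≡) v≡ff)
    l<μ : l < μ
    l<μ = ≰⇒> λ μ≤l → <-irrefl refl (begin-strict
      f * μ            ≤⟨ *-monoʳ-≤ f μ≤l ⟩
      f * l            <⟨ m<m+n (f * l) 1≤k ⟩
      f * l + k        ≡⟨ fl+k≡fμ ⟩
      f * μ            ∎)
    μ≡ : μ ≡ suc l
    μ≡ = ≤-antisym (≮⇒≥ λ 2+l≤μ → <-irrefl refl (begin-strict
      f + f                ≤⟨ +-cancelʳ-≤ (f * l) _ _ (begin
          f + f + f * l        ≡⟨ two f l ⟩
          f * suc (suc l)      ≤⟨ *-monoʳ-≤ f 2+l≤μ ⟩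
          f * μ                ≡⟨ sym fl+k≡fμ ⟩
          f * l + k            ≡⟨ +-comm (f * l) k ⟩
          k + f * l            ∎) ⟩
      k                    <⟨ m<m+n k 1≤k′ ⟩
      k + k′               ≡⟨ kk′≡ff ⟩
      f + f                ∎)) l<μ
      where
      two : ∀ f l → f + f + f * l ≡ f * suc (suc l)
      two = solve-∀
    f≡k : f ≡ k
    f≡k = +-cancelˡ-≡ (f * l) f k (trans (trans (+-comm (f * l) f) (sym (*-suc f l))) (trans (cong (f *_) (sym μ≡)) (sym fl+k≡fμ)))
    k′≡k : k′ ≡ k
    k′≡k = +-cancelˡ-≡ k k′ k (trans kk′≡ff (cong₂ _+_ f≡k f≡k))
    k≡2μ : k ≡ 2 * μ
    k≡2μ = *-cancelˡ-≡ k (2 * μ) k {{>-nonZero 1≤k}} (begin-equality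
      k * k                    ≡⟨ k²≡ ⟩
      k + l * k + μ * k′       ≡⟨ cong (λ z → k + l * k + μ * z) k′≡k ⟩
      k + l * k + μ * k        ≡⟨ factor k l μ ⟩
      k * (suc l + μ)          ≡⟨ cong (λ z → k * (z + μ)) (sym μ≡) ⟩
      k * (μ + μ)              ≡⟨ cong (λ z → k * (μ + z)) (sym (+-identityʳ μ)) ⟩
      k * (2 * μ)              ∎)
      where
      factor : ∀ k l μ → k + l * k + μ * k ≡ k * (suc l + μ)
      factor = solve-∀

  -- With x = 4 μ a conference graph has 2 k = x, v = x + 1 and θ² ≤ x, so the inequality to be
  -- refuted takes the form x¹⁰ ≤ (x + 1) x⁵. It fails for x ≥ 4.
  conference-bound : ∀ μ → 1 ≤ μ → ¬ ((4 * μ) ^ 10 ≤ suc (4 * μ) * (4 * μ) ^ 5)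
  conference-bound μ 1≤μ = not-large (4 * μ) (*-monoʳ-≤ 4 1≤μ)
    where
    not-large : ∀ x → 4 ≤ x → ¬ (x ^ 10 ≤ suc x * x ^ 5)
    not-large x 4≤x h = <-irrefl refl (begin-strict
      suc x          <⟨ +-mono-< {1} {x} (≤-trans (s≤s (s≤s z≤n)) 4≤x) (m<m+n x {x} (≤-trans (s≤s z≤n) 4≤x)) ⟩
      x + (x + x)    ≤⟨ m≤m+n (x + (x + x)) x ⟩
      x + (x + x) + x  ≡⟨ four x ⟩
      4 * x          ≤⟨ *-monoˡ-≤ x 4≤x ⟩
      x * x          ≤⟨ m≤m*n (x * x) (x ^ 3) {{m^n≢0 x 3}} ⟩
      x * x * x ^ 3  ≡⟨ *-assoc x x (x ^ 3) ⟩
      x ^ 5          ≤⟨ *-cancelʳ-≤ (x ^ 5) (suc x) (x ^ 5) {{m^n≢0 x 5}} (≤-trans (≤-reflexive (sym (pow-split x 5 5))) h) ⟩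
      suc x          ∎)
      where
      instance x≢0 = >-nonZero (≤-trans (s≤s z≤n) 4≤x)
      four : ∀ x → x + (x + x) + x ≡ 4 * x
      four = solve-∀

-- Bose's claw argument: large cliques on every edge.

module ClawBounds where
  open import Data.Nat
  open import Data.Nat.Properties
  open import Data.Nat.Tactic.RingSolver using (solve-∀)
  open import Data.Fin.Properties using (any?)
  open import Data.Bool using () renaming (_≟_ to _≟ᵇ_)
  open import Data.List using (List; []; _∷_; length)
  open import Data.List.Relation.Unary.All using (All; []; _∷_)
  import Data.List.Relation.Unary.All as All
  open import Relation.Nullary.Decidable using (_×-dec_; ¬?)
  open FiniteCounting

  module Cliques {v} (G : Graph v) {k l μ} (srg : IsSRG G k l μ) (r n : ℕ)
           (k≡ : k ≡ r * suc n + μ) (l≡ : l + suc n ≡ μ + r)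
           (1≤μ : 1 ≤ μ) (1≤n : 1 ≤ n) (r-large : 17 * (suc n * suc n) * μ ≤ r) where
    open IsSRG srg
    open ≤-Reasoning
    m = suc n
    P = m * μ

    V = Fin v
    a = adj G

    abstract
      m²μ≤r : m * m * μ ≤ r
      m²μ≤r = ≤-trans (m≤m+n _ _) (≤-trans (≤-reflexive (e (m * m * μ))) (≤-trans (≤-reflexive (sym (*-assoc 17 (m * m) μ))) r-large))
        where
        e : ∀ x → x + 16 * x ≡ 17 * x
        e = solve-∀

      -- Each leaf of a claw accounts for l + 1 neighbours of the centre, itself included. So n
      -- leaves leave some neighbour free and the claw can be enlarged; likewise n lines cannot
      -- exhaust the neighbours of a point.
      few-cliques : n * suc l < k
      few-cliques = begin-strict
        n * suc l              ≤⟨ *-monoʳ-≤ n (≤-trans (m≤m+n (suc l) n) (≤-reflexive (trans (sym (+-suc l n)) l≡))) ⟩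
        n * (μ + r)            ≡⟨ e n μ r ⟩
        r * n + n * μ          <⟨ +-monoʳ-< (r * n) (begin-strict
            n * μ                  ≤⟨ *-monoˡ-≤ μ (≤-trans (n≤1+n n) (m≤m*n m m)) ⟩
            m * m * μ              ≤⟨ m²μ≤r ⟩
            r                      <⟨ m<m+n r 1≤μ ⟩
            r + μ                  ∎) ⟩
        r * n + (r + μ)        ≡⟨ e′ r n μ ⟩
        r * m + μ              ≡⟨ sym k≡ ⟩
        k                      ∎
        where
        e : ∀ n μ r → n * (μ + r) ≡ r * n + n * μ
        e = solve-∀
        e′ : ∀ r n μ → r * n + (r + μ) ≡ r * suc n + μ
        e′ = solve-∀

      -- Rules out claws with m + 1 leaves, and later m + 1 lines on a point: (m + 1)(l + 1) exceeds
      -- k by about r, whereas the overlaps amount to a small multiple of m² μ.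
      many-cliques : ¬ (suc m * suc l ≤ k + suc m * suc m * μ)
      many-cliques h = <-irrefl refl (begin-strict
        r + (2 * n * n + 6 * n + 4) * μ        <⟨ +-monoʳ-< r
            (*-monoˡ-< μ {{>-nonZero 1≤μ}} (≤-trans (m≤m+n (suc (2 * n * n + 6 * n + 4)) (15 * n * n + 28 * n + 12))
            (≤-reflexive (e₀ n)))) ⟩
        r + 17 * (m * m) * μ                   ≤⟨ +-monoʳ-≤ r r-large ⟩
        r + r                                  ≤⟨ +-monoʳ-≤ r (+-cancelʳ-≤ (r * n + r + μ) _ _ (begin
            r + (r * n + r + μ)                  ≤⟨ m≤m+n _ _ ⟩
            r + (r * n + r + μ) + (n * μ + μ)    ≡⟨ e₁ n r μ ⟩
            suc m * (μ + r)                      ≡⟨ cong (suc m *_) (sym l≡) ⟩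
            suc m * (l + m)                      ≡⟨ e₂ n l ⟩
            suc m * suc l + suc m * n            ≤⟨ +-mono-≤ h (1≤⇒≤* (suc m * n)) ⟩
            k + suc m * suc m * μ + suc m * n * μ  ≡⟨ cong (λ z → z + suc m * suc m * μ + suc m * n * μ) k≡ ⟩
            r * m + μ + suc m * suc m * μ + suc m * n * μ ≡⟨ e₃ n r μ ⟩
            (2 * n * n + 6 * n + 4) * μ + (r * n + r + μ) ∎)) ⟩
        r + (2 * n * n + 6 * n + 4) * μ        ∎)
        where
        1≤⇒≤* : ∀ b → b ≤ b * μ
        1≤⇒≤* b = m≤m*n b μ {{>-nonZero 1≤μ}}
        e₀ : ∀ n → suc (2 * n * n + 6 * n + 4) + (15 * n * n + 28 * n + 12) ≡ 17 * (suc n * suc n)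
        e₀ = solve-∀
        e₁ : ∀ n r μ → r + (r * n + r + μ) + (n * μ + μ) ≡ suc (suc n) * (μ + r)
        e₁ = solve-∀
        e₂ : ∀ n l → suc (suc n) * (l + suc n) ≡ suc (suc n) * suc l + suc (suc n) * n
        e₂ = solve-∀
        e₃ : ∀ n r μ → r * suc n + μ + suc (suc n) * suc (suc n) * μ + suc (suc n) * n * μ ≡ (2 * n * n + 6 * n + 4) * μ + (r * n + r + μ)
        e₃ = solve-∀

      l-large : 16 * P ≤ l
      l-large = +-cancelʳ-≤ m _ _ (begin
        16 * P + m             ≤⟨ +-monoʳ-≤ (16 * P) (m≤m*n m μ {{>-nonZero 1≤μ}}) ⟩
        16 * P + P             ≤⟨ m≤m*n (16 * P + P) m ⟩
        (16 * P + P) * m       ≡⟨ e m μ ⟩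
        17 * (m * m) * μ       ≤⟨ r-large ⟩
        r                      ≤⟨ m≤n+m r μ ⟩
        μ + r                  ≡⟨ sym l≡ ⟩
        l + m                  ∎)
        where
        e : ∀ m μ → (16 * (m * μ) + m * μ) * m ≡ 17 * (m * m) * μ
        e = solve-∀

      1≤P : 1 ≤ P
      1≤P = *-mono-≤ {1} {m} (s≤s z≤n) 1≤μ

      μ≤P : μ ≤ P
      μ≤P = m≤n*m μ m

      nμ≤P : n * μ ≤ P
      nμ≤P = *-monoˡ-≤ μ (n≤1+n n)

      -- Every count below loses at most a few multiples of P out of l.
      l≰ : ∀ {X} → X ≤ 15 * P → ¬ (l ≤ X)
      l≰ X≤ l≤X = <-irrefl refl (begin-strict
        15 * P      <⟨ *-monoˡ-< P {{>-nonZero 1≤P}} (≤-refl {16}) ⟩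
        16 * P      ≤⟨ l-large ⟩
        l           ≤⟨ l≤X ⟩
        _           ≤⟨ X≤ ⟩
        15 * P      ∎)

    a-sym : ∀ {x y} → a x y ≡ true → a y x ≡ true
    a-sym {x} {y} e = trans (adj-sym G y x) e

    a-symᶠ : ∀ {x y} → a x y ≡ false → a y x ≡ false
    a-symᶠ {x} {y} e = trans (adj-sym G y x) e

    a-≢ : ∀ {x y} → a x y ≡ true → x ≢ y
    a-≢ {x} e refl = true≢false e (irrefl G x)

    nonadjacent-common : ∀ {y z} → y ≢ z → a y z ≡ false → ∀ (p : V → Bool) →
      (∀ w → p w ≡ true → a y w ≡ true × a z w ≡ true) → count p ≤ μ
    nonadjacent-common {y} {z} y≢z yz p h = ≤-trans
      (count-mono p (λ w → a y w ∧ a z w) λ w e → ∧-intro (proj₁ (h w e)) (proj₂ (h w e))) (≤-reflexive (nonEdgeParam y z y≢z yz))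

    data Claw (x : V) : List V → Set where
      []   : Claw x []
      leaf : ∀ {y ys} → a x y ≡ true → All (λ z → y ≢ z × a y z ≡ false) ys → Claw x ys → Claw x (y ∷ ys)

    near : V → V → Bool
    near y w = (y == w) ∨ a y w

    union : (V → V → Bool) → List V → V → Bool
    union f []       w = false
    union f (y ∷ ys) w = f y w ∨ union f ys w

    Far : V → List V → Set
    Far y = All (λ z → y ≢ z × a y z ≡ false)

    uncovered : ∀ ys {w} → union near ys w ≡ false → Far w ys
    uncovered []       e = []
    uncovered (y ∷ ys) {w} e with y == w in e₁ | a y w in e₂
    ... | false | false = ((λ w≡y → true≢false (trans (cong (y ==_) w≡y) (==-refl y)) e₁) , a-symᶠ e₂) ∷ uncovered ys e

    untouched : ∀ ys {w} → union a ys w ≡ false → All (λ z → a w z ≡ false) ys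
    untouched []       e = []
    untouched (y ∷ ys) {w} e with a y w in e₂
    ... | false = a-symᶠ e₂ ∷ untouched ys e

    count-near : ∀ {x y} → a x y ≡ true → count (λ w → a x w ∧ near y w) ≡ suc l
    count-near {x} {y} xy = ≤-antisym
      (≤-trans (count-cover _ (y ==_) (λ w → a x w ∧ a y w) λ w e → let (xw , yw) = ∧-elim {a x w} e in upper w xw (∨-elim yw))
        (≤-reflexive (cong₂ _+_ (count-== y) (edgeParam x y (a-≢ xy) xy))))
      (≤-trans (≤-reflexive (sym (cong₂ _+_ (count-== y) (edgeParam x y (a-≢ xy) xy))))
        (count-disjoint (λ w → a x w ∧ near y w) (y ==_) (λ w → a x w ∧ a y w)
          (λ w e → ∧-intro (subst (λ z → a x z ≡ true) (==⇒≡ e) xy) (∨-introˡ e))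
          (λ w e → let (xw , yw) = ∧-elim {a x w} e in ∧-intro xw (∨-introʳ yw))
          (λ w e e′ → a-≢ (proj₂ (∧-elim {a x w} e′)) (==⇒≡ e))))
      where
      upper : ∀ w → a x w ≡ true → (y == w) ≡ true ⊎ a y w ≡ true → (y == w) ≡ true ⊎ (a x w ∧ a y w) ≡ true
      upper w xw (inj₁ e) = inj₁ e
      upper w xw (inj₂ e) = inj₂ (∧-intro xw e)

    cover-size : V → List V → ℕ
    cover-size x ys = count (λ w → a x w ∧ union near ys w)

    cover-upper : ∀ {x ys} → Claw x ys → cover-size x ys ≤ length ys * suc l
    cover-upper {x} [] = ≤-reflexive (count-∧-false (a x))
    cover-upper {x} {y ∷ ys} (leaf xy _ c) = ≤-trans (count-∧-∨ (a x) (near y) (union near ys))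
      (+-mono-≤ (≤-reflexive (count-near xy)) (cover-upper c))

    near-overlap : ∀ {y z} → y ≢ z → a y z ≡ false → ∀ w → near y w ≡ true → near z w ≡ true → a y w ≡ true × a z w ≡ true
    near-overlap {y} {z} y≢z yz w yw zw with ∨-elim {y == w} yw | ∨-elim {z == w} zw
    ... | inj₂ e | inj₂ e′ = e , e′
    ... | inj₁ e | inj₁ e′ = ⊥-elim (y≢z (trans (==⇒≡ e) (sym (==⇒≡ e′))))
    ... | inj₁ e | inj₂ e′ = ⊥-elim (true≢false (a-sym (subst (λ w → a z w ≡ true) (sym (==⇒≡ e)) e′)) yz)
    ... | inj₂ e | inj₁ e′ = ⊥-elim (true≢false (subst (λ w → a y w ≡ true) (sym (==⇒≡ e′)) e) yz)

    union-overlap : (f : V → V → Bool) → (∀ {y z} → y ≢ z → a y z ≡ false → count (λ w → f y w ∧ f z w) ≤ μ) →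
      ∀ {y} ys → Far y ys → count (λ w → f y w ∧ union f ys w) ≤ length ys * μ
    union-overlap f h {y} []       []                 = ≤-reflexive (count-∧-false (f y))
    union-overlap f h {y} (z ∷ zs) ((y≢z , yz) ∷ far) = ≤-trans (count-∧-∨ (f y) (f z) (union f zs))
      (+-mono-≤ (h y≢z yz) (union-overlap f h zs far))

    cover-overlap : ∀ {y} ys → Far y ys → count (λ w → near y w ∧ union near ys w) ≤ length ys * μ
    cover-overlap = union-overlap near λ {y} y≢z yz → nonadjacent-common y≢z yz _ λ w e →
      let (yw , zw) = ∧-elim {near y w} e in near-overlap y≢z yz w yw zw

    touch-overlap : ∀ {y} ys → Far y ys → count (λ w → a y w ∧ union a ys w) ≤ length ys * μ
    touch-overlap = union-overlap a λ {y} {z} y≢z yz → ≤-reflexive (nonEdgeParam y z y≢z yz)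

    -- Bonferroni's inequality: a new leaf shares at most μ neighbours with each of the t old ones.
    -- The total overlap is estimated crudely by the square of the number of leaves times μ.
    cover-lower : ∀ {x ys} → Claw x ys → length ys * suc l ≤ cover-size x ys + length ys * length ys * μ
    cover-lower [] = z≤n
    cover-lower {x} {y ∷ ys} (leaf xy far c) = begin
      suc l + t * suc l                                   ≤⟨ +-mono-≤ (≤-reflexive (sym (count-near xy))) (cover-lower c) ⟩
      count A + (count B + t * t * μ)                     ≡⟨ trans (sym (+-assoc (count A) _ _))
          (cong (_+ t * t * μ) (sym (count-∨-∧ A B))) ⟩
      count (λ w → A w ∨ B w) + count (λ w → A w ∧ B w) + t * t * μ
        ≤⟨ +-monoˡ-≤ (t * t * μ) (+-mono-≤ (count-mono (λ w → A w ∨ B w) C (λ w e → A∪B⊆C w (∨-elim e)))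
             (≤-trans (count-mono (λ w → A w ∧ B w) (λ w → near y w ∧ union near ys w) λ w e →
               ∧-intro (proj₂ (∧-elim {a x w} (proj₁ (∧-elim {A w} e)))) (proj₂ (∧-elim {a x w} (proj₂ (∧-elim {A w} e)))))
                   (cover-overlap ys far))) ⟩
      count C + t * μ + t * t * μ                         ≤⟨ m≤m+n _ _ ⟩
      count C + t * μ + t * t * μ + (t * μ + μ)           ≡⟨ e (count C) t μ ⟩
      count C + suc t * suc t * μ                         ∎
      where
      t = length ys
      A B C : V → Bool
      A w = a x w ∧ near y w
      B w = a x w ∧ union near ys w
      C w = a x w ∧ union near (y ∷ ys) w
      A∪B⊆C : ∀ w → A w ≡ true ⊎ B w ≡ true → C w ≡ true
      A∪B⊆C w (inj₁ e) = let (xw , yw) = ∧-elim {a x w} e in ∧-intro xw (∨-introˡ yw)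
      A∪B⊆C w (inj₂ e) = let (xw , yw) = ∧-elim {a x w} e in ∧-intro xw (∨-introʳ yw)
      e : ∀ c t μ → c + t * μ + t * t * μ + (t * μ + μ) ≡ c + suc t * suc t * μ
      e = solve-∀

    cover-size≤k : ∀ x ys → cover-size x ys ≤ k
    cover-size≤k x ys = ≤-trans (count-mono _ (a x) λ w e → proj₁ (∧-elim {a x w} e)) (≤-reflexive (regular x))

    no-large-claw : ∀ {x ys} → Claw x ys → length ys ≢ suc m
    no-large-claw {x} {ys} c len = many-cliques (subst (λ t → t * suc l ≤ k + t * t * μ) len
      (≤-trans (cover-lower c) (+-monoˡ-≤ _ (cover-size≤k x ys))))

    extend : ∀ {x ys} → Claw x ys → length ys ≤ n → ∃[ w ] (a x w ≡ true × Far w ys)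
    extend {x} {ys} c len = w , xw , uncovered ys (trans (sym (cong (_∧ union near ys w) xw)) e)
      where
      room : cover-size x ys < count (a x)
      room = begin-strict
        cover-size x ys       ≤⟨ cover-upper c ⟩
        length ys * suc l     ≤⟨ *-monoˡ-≤ (suc l) len ⟩
        n * suc l             <⟨ few-cliques ⟩
        k                     ≡⟨ sym (regular x) ⟩
        count (a x)           ∎
      found = count-< (a x) (λ w → a x w ∧ union near ys w) room
      w  = proj₁ found
      xw = proj₁ (proj₂ found)
      e  = proj₂ (proj₂ found)

    -- The leaf y stays at the head, so that `core-at` can remove it and put two other leaves in its
    -- place.
    maximal-claw : ∀ {x y} → a x y ≡ true → ∀ t → t ≤ n → ∃[ ys ] (length ys ≡ t × Claw x (y ∷ ys))
    maximal-claw xy zero    _   = [] , refl , leaf xy [] []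
    maximal-claw {x} {y} xy (suc t) t<n = grow (maximal-claw xy t (<⇒≤ t<n))
      where
      grow : ∃[ ys ] (length ys ≡ t × Claw x (y ∷ ys)) → ∃[ ys ] (length ys ≡ suc t × Claw x (y ∷ ys))
      grow (ys , len , c@(leaf _ far cys)) = insert (extend c (subst (λ t → suc t ≤ n) (sym len) t<n))
        where
        insert : ∃[ w ] (a x w ≡ true × Far w (y ∷ ys)) → _
        insert (w , xw , (w≢y , wy) ∷ wfar) = w ∷ ys , cong suc len ,
          leaf xy (((λ e → w≢y (sym e)) , a-symᶠ wy) ∷ far) (leaf xw wfar cys)

    -- The bulk of Bose's grand clique on the edge xy. It depends on the choice of a claw, so it
    -- only approximates the line through x and y.
    record Core (x y : V) : Set where
      field
        core      : V → Bool
        core⊆     : ∀ w → core w ≡ true → a x w ≡ true × a y w ≡ true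
        clique    : ∀ {w w′} → core w ≡ true → core w′ ≡ true → w ≢ w′ → a w w′ ≡ true
        remainder : count (λ w → (a x w ∧ a y w) ∧ not (core w)) ≤ n * μ

      core-size : a x y ≡ true → l ≤ count core + n * μ
      core-size xy = begin
        l                                            ≡⟨ sym (edgeParam x y (a-≢ xy) xy) ⟩
        count (λ w → a x w ∧ a y w)                  ≡⟨ count-split (λ w → a x w ∧ a y w) core ⟩
        _ ≤⟨ +-mono-≤ (count-mono (λ w → (a x w ∧ a y w) ∧ core w) core (λ w e → proj₂ (∧-elim {a x w ∧ a y w} e))) remainder ⟩
        count core + n * μ                           ∎

    -- Take a claw at x with leaves y and n others, ys, and keep the common neighbours of x and y
    -- adjacent to none of ys. Two non-adjacent vertices among them could replace y and form a claw
    -- with n + 2 = m + 1 leaves. A discarded vertex is a common neighbour of y and one of the n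
    -- leaves ys.
    core-at : ∀ {x y} → a x y ≡ true → Core x y
    core-at {x} {y} xy with maximal-claw xy n ≤-refl
    ... | ys , len , leaf _ far c = record
        { core      = B
        ; core⊆     = λ w e → ∧-elim {a x w} (proj₁ (∧-elim {a x w ∧ a y w} e))
        ; clique    = clique
        ; remainder = ≤-trans (count-mono _ (λ w → a y w ∧ union a ys w) λ w e → rest w (∧-elim {a x w ∧ a y w} e))
                        (≤-trans (touch-overlap ys far) (≤-reflexive (cong (_* μ) len)))
        }
      where
      B : V → Bool
      B w = (a x w ∧ a y w) ∧ not (union a ys w)
      outside : ∀ {w} → B w ≡ true → Far w ys
      outside {w} e = All.zipWith (λ { ((_ , yz) , wz) → (λ { refl → true≢false (proj₂ (∧-elim {a x w} (proj₁ (∧-elim {a x w ∧ a y w} e)))) yz }) , wz })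
        (far , untouched ys (not-elim (proj₂ (∧-elim {a x w ∧ a y w} e))))
      clique : ∀ {w w′} → B w ≡ true → B w′ ≡ true → w ≢ w′ → a w w′ ≡ true
      clique {w} {w′} e e′ w≢w′ with a w w′ in eq
      ... | true  = refl
      ... | false = ⊥-elim (no-large-claw
              (leaf (proj₁ (∧-elim {a x w} (proj₁ (∧-elim {a x w ∧ a y w} e)))) ((w≢w′ , eq) ∷ outside e)
                (leaf (proj₁ (∧-elim {a x w′} (proj₁ (∧-elim {a x w′ ∧ a y w′} e′)))) (outside e′) c)) (cong (λ t → suc (suc t)) len))
      rest : ∀ w → (a x w ∧ a y w) ≡ true × not (B w) ≡ true → (a y w ∧ union a ys w) ≡ true
      rest w (e , e′) with bool (union a ys w)
      ... | inj₁ t = ∧-intro (proj₂ (∧-elim {a x w} e)) t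
      ... | inj₂ t = ⊥-elim (true≢false (∧-intro e (not-intro t)) (not-elim e′))

    c₃ : V → V → V → ℕ
    c₃ x y z = count (λ w → a x w ∧ (a y w ∧ a z w))

    -- For an edge xy, a common neighbour z is adjacent to all of the core or to at most μ of it.
    dichotomy : ∀ {x y z} → a x y ≡ true → a x z ≡ true → a y z ≡ true → c₃ x y z ≤ P ⊎ l ≤ suc (c₃ x y z) + n * μ
    dichotomy {x} {y} {z} xy xz yz with any? (λ w → (core w ≟ᵇ true) ×-dec (¬? (w ≟ᶠ z) ×-dec (a z w ≟ᵇ false)))
      where open Core (core-at xy)
    -- The core vertices adjacent to z are also adjacent to w, and w and z are not adjacent, so
    -- there are at most μ of them.
    ... | yes (w , Bw , w≢z , zw) = inj₁ (begin
        c₃ x y z                    ≤⟨ count-cover (λ u → a x u ∧ (a y u ∧ a z u)) (λ u → core u ∧ a z u)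
            (λ u → (a x u ∧ a y u) ∧ not (core u)) split ⟩
        _                           ≤⟨ +-mono-≤ (nonadjacent-common w≢z (a-symᶠ zw) _ both) remainder ⟩
        μ + n * μ                   ∎)
      where
      open Core (core-at xy)
      split : ∀ u → (a x u ∧ (a y u ∧ a z u)) ≡ true → (core u ∧ a z u) ≡ true ⊎ ((a x u ∧ a y u) ∧ not (core u)) ≡ true
      split u e with ∧-elim {a x u} e
      ... | xu , e′ with ∧-elim {a y u} e′ | bool (core u)
      ...   | yu , zu | inj₁ b = inj₁ (∧-intro b zu)
      ...   | yu , zu | inj₂ b = inj₂ (∧-intro (∧-intro xu yu) (not-intro b))
      both : ∀ u → (core u ∧ a z u) ≡ true → a w u ≡ true × a z u ≡ true
      both u e = let (bu , zu) = ∧-elim {core u} e in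
        clique Bw bu (λ { refl → true≢false zu zw }) , zu
    -- The extra 1 is for z, which may lie in the core itself.
    ... | no all = inj₂ (begin
        l                             ≤⟨ core-size xy ⟩
        count core + n * μ            ≤⟨ +-monoˡ-≤ (n * μ) (≤-trans (count-cover core (z ==_) (λ w → a x w ∧ (a y w ∧ a z w)) full)
                                            (≤-reflexive (cong (_+ c₃ x y z) (count-== z)))) ⟩
        suc (c₃ x y z) + n * μ        ∎)
      where
      open Core (core-at xy)
      full : ∀ w → core w ≡ true → (z == w) ≡ true ⊎ (a x w ∧ (a y w ∧ a z w)) ≡ true
      full w bw with w ≟ᶠ z | bool (a z w)
      ... | yes refl | _      = inj₁ (==-refl z)
      ... | no w≢z | inj₁ zw = inj₂ (∧-intro (proj₁ (core⊆ w bw)) (∧-intro (proj₂ (core⊆ w bw)) zw))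
      ... | no w≢z | inj₂ zw = ⊥-elim (all (w , bw , w≢z , zw))

-- The lines: from cliques to a partial linear space.

module LineConstruction where
  open import Data.Nat
  open import Data.Nat.Properties
  open import Data.Nat.Tactic.RingSolver using (solve-∀)
  open import Data.Fin using (combine; remQuot)
  open import Data.Fin.Properties using (any?; remQuot-combine)
  open import Data.Bool using (T) renaming (_≟_ to _≟ᵇ_)
  open FiniteCounting
  open ClawBounds

  -- Intended for partial equivalences: an element with R i i false, such as a code of a
  -- non-adjacent pair, belongs to no class.
  record Representatives {n} (R : Fin n → Fin n → Bool) : Set where
    field
      number   : ℕ
      rep      : Fin number → Fin n
      related  : ∀ c → R (rep c) (rep c) ≡ true
      separated : ∀ c d → R (rep c) (rep d) ≡ true → c ≡ d
      class    : ∀ i → R i i ≡ true → ∃[ c ] R i (rep c) ≡ true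

  representatives : ∀ {n} (R : Fin n → Fin n → Bool) → (∀ i j → R i j ≡ true → R j i ≡ true) → Representatives R
  representatives {zero}  R R-sym = record { number = 0 ; rep = λ () ; related = λ () ; separated = λ () ; class = λ () }
  representatives {suc n} R R-sym with representatives (λ i j → R (suc i) (suc j)) (λ i j → R-sym (suc i) (suc j))
  ... | reps with any? (λ c → R zero (suc (Representatives.rep reps c)) ≟ᵇ true) | R zero zero in R₀₀
  ...   | yes (c , e) | _ = record
          { number = number ; rep = λ d → suc (rep d) ; related = related ; separated = separated
          ; class = λ { zero _ → c , e ; (suc i) → class i } }
    where open Representatives reps
  ...   | no _ | false = record
          { number = number ; rep = λ d → suc (rep d) ; related = related ; separated = separated
          ; class = λ { zero e → ⊥-elim (true≢false e R₀₀) ; (suc i) → class i } }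
    where open Representatives reps
  ...   | no none | true = record
          { number = suc number
          ; rep = λ { zero → zero ; (suc d) → suc (rep d) }
          ; related = λ { zero → R₀₀ ; (suc d) → related d }
          ; separated = λ { zero zero _ → refl ; zero (suc d) e → ⊥-elim (none (d , e))
                         ; (suc c) zero e → ⊥-elim (none (c , R-sym _ _ e)) ; (suc c) (suc d) e → cong suc (separated c d e) }
          ; class = λ { zero _ → zero , R₀₀ ; (suc i) e → let (c , e′) = class i e in suc c , e′ } }
    where open Representatives reps

  module Collinearity {v} (G : Graph v) {k l μ} (srg : IsSRG G k l μ) (r n : ℕ)
           (k≡ : k ≡ r * suc n + μ) (l≡ : l + suc n ≡ μ + r)
           (1≤μ : 1 ≤ μ) (1≤n : 1 ≤ n) (r-large : 17 * (suc n * suc n) * μ ≤ r) where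
    open IsSRG srg
    open Cliques G srg r n k≡ l≡ 1≤μ 1≤n r-large
    open ≤-Reasoning

    -- By `dichotomy` the vertices of a triangle have either at most P or almost l common
    -- neighbours, so the threshold P separates triangles inside a line from accidental ones. In
    -- contrast to membership in a core, this criterion involves no choice and is symmetric in the
    -- three vertices.
    collinear : V → V → V → Bool
    collinear x y z = (a x y ∧ (a x z ∧ a y z)) ∧ (P <ᵇ c₃ x y z)

    private
      T⇒≡ : ∀ {b} → T b → b ≡ true
      T⇒≡ {true} _ = refl
      ≡⇒T : ∀ {b} → b ≡ true → T b
      ≡⇒T refl = _

    collinear-intro : ∀ {x y z} → a x y ≡ true → a x z ≡ true → a y z ≡ true → P < c₃ x y z → collinear x y z ≡ true
    collinear-intro xy xz yz h = ∧-intro (∧-intro xy (∧-intro xz yz)) (T⇒≡ (<⇒<ᵇ h))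

    record Collinear (x y z : V) : Set where
      constructor coll
      field
        xy : a x y ≡ true
        xz : a x z ≡ true
        yz : a y z ≡ true
        many : P < c₃ x y z

      large : l ≤ suc (c₃ x y z) + P
      large with dichotomy xy xz yz
      ... | inj₁ small = ⊥-elim (<⇒≱ many small)
      ... | inj₂ big   = ≤-trans big (+-monoʳ-≤ (suc (c₃ x y z)) nμ≤P)

    collinear-elim : ∀ {x y z} → collinear x y z ≡ true → Collinear x y z
    collinear-elim {x} {y} {z} e with ∧-elim {a x y ∧ (a x z ∧ a y z)} e
    ... | e₁ , e₂ with ∧-elim {a x y} e₁
    ...   | xy , e₃ with ∧-elim {a x z} e₃
    ...     | xz , yz = coll xy xz yz (<ᵇ⇒< P _ (≡⇒T e₂))

    c₃-swap₁₂ : ∀ x y z → c₃ x y z ≤ c₃ y x z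
    c₃-swap₁₂ x y z = count-mono _ _ λ w e → let (xw , e′) = ∧-elim {a x w} e ; (yw , zw) = ∧-elim {a y w} e′ in
      ∧-intro yw (∧-intro xw zw)

    c₃-swap₂₃ : ∀ x y z → c₃ x y z ≤ c₃ x z y
    c₃-swap₂₃ x y z = count-mono _ _ λ w e → let (xw , e′) = ∧-elim {a x w} e ; (yw , zw) = ∧-elim {a y w} e′ in
      ∧-intro xw (∧-intro zw yw)

    collinear-swap₁₂ : ∀ {x y z} → collinear x y z ≡ true → collinear y x z ≡ true
    collinear-swap₁₂ {x} {y} {z} e with collinear-elim e
    ... | coll xy xz yz many = collinear-intro (a-sym xy) yz xz (<-≤-trans many (c₃-swap₁₂ x y z))

    collinear-swap₂₃ : ∀ {x y z} → collinear x y z ≡ true → collinear x z y ≡ true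
    collinear-swap₂₃ {x} {y} {z} e with collinear-elim e
    ... | coll xy xz yz many = collinear-intro xz xy (a-sym yz) (<-≤-trans many (c₃-swap₂₃ x y z))

    -- A and B both fill the l common neighbours of x and z up to 1 + P, so at least l - 2 - 2 P
    -- vertices are adjacent to all of x, y and w. That exceeds μ, which forces y and w to be
    -- adjacent, and it exceeds P.
    collinear-trans : ∀ {x z y w} → collinear x z y ≡ true → collinear x z w ≡ true → y ≢ w → collinear x y w ≡ true
    collinear-trans {x} {z} {y} {w} e e′ y≢w = collinear-intro xy xw yw P<c₃
      where
      open Collinear (collinear-elim e) renaming (xy to xz; xz to xy; yz to zy; large to large₁)
      open Collinear (collinear-elim e′) using () renaming (xz to xw; large to large₂)
      A B : V → Bool
      A u = a x u ∧ (a z u ∧ a y u)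
      B u = a x u ∧ (a z u ∧ a w u)
      l≤ : l ≤ 2 + 2 * P + count (λ u → A u ∧ B u)
      l≤ = +-cancelˡ-≤ l _ _ (begin
        l + l                                                       ≤⟨ +-mono-≤ large₁ large₂ ⟩
        suc (count A) + P + (suc (count B) + P)                     ≡⟨ e₁ (count A) (count B) P ⟩
        2 + 2 * P + (count A + count B)                             ≡⟨ cong (2 + 2 * P +_) (sym (count-∨-∧ A B)) ⟩
        2 + 2 * P + (count (λ u → A u ∨ B u) + count (λ u → A u ∧ B u)) ≤⟨ +-monoʳ-≤ (2 + 2 * P) (+-monoˡ-≤ _
            (≤-trans (count-mono (λ u → A u ∨ B u) (λ u → a x u ∧ a z u) (λ u e → xz∪ u (∨-elim e)))
                (≤-reflexive (edgeParam x z (a-≢ xz) xz)))) ⟩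
        2 + 2 * P + (l + count (λ u → A u ∧ B u))                   ≡⟨ e₂ (2 + 2 * P) l (count (λ u → A u ∧ B u)) ⟩
        l + (2 + 2 * P + count (λ u → A u ∧ B u))                   ∎)
        where
        e₁ : ∀ A B P → suc A + P + (suc B + P) ≡ 2 + 2 * P + (A + B)
        e₁ = solve-∀
        e₂ : ∀ c l d → c + (l + d) ≡ l + (c + d)
        e₂ = solve-∀
        drop : ∀ b u → (a x u ∧ (a z u ∧ b)) ≡ true → (a x u ∧ a z u) ≡ true
        drop b u e = let (p , q) = ∧-elim {a x u} e in ∧-intro p (proj₁ (∧-elim {a z u} q))
        xz∪ : ∀ u → A u ≡ true ⊎ B u ≡ true → (a x u ∧ a z u) ≡ true
        xz∪ u (inj₁ e) = drop (a y u) u e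
        xz∪ u (inj₂ e) = drop (a w u) u e
      small-multiple : 2 + 2 * P + P ≤ 15 * P
      small-multiple = begin
        2 + 2 * P + P       ≤⟨ +-monoˡ-≤ P (+-monoˡ-≤ (2 * P) (*-monoʳ-≤ 2 1≤P)) ⟩
        2 * P + 2 * P + P   ≡⟨ five P ⟩
        5 * P               ≤⟨ *-monoˡ-≤ P (m≤m+n 5 10) ⟩
        15 * P              ∎
        where
        five : ∀ P → 2 * P + 2 * P + P ≡ 5 * P
        five = solve-∀
      members : ∀ u → (A u ∧ B u) ≡ true → a x u ≡ true × (a y u ≡ true × a w u ≡ true)
      members u e = let (eA , eB) = ∧-elim {A u} e in proj₁ (∧-elim {a x u} eA) ,
        proj₂ (∧-elim {a z u} (proj₂ (∧-elim {a x u} eA))) , proj₂ (∧-elim {a z u} (proj₂ (∧-elim {a x u} eB)))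
      yw : a y w ≡ true
      yw with bool (a y w)
      ... | inj₁ t = t
      ... | inj₂ f = ⊥-elim (l≰ {2 + 2 * P + P} small-multiple
          (≤-trans l≤ (+-monoʳ-≤ (2 + 2 * P) (≤-trans (nonadjacent-common y≢w f _ (λ u e → proj₂ (members u e))) μ≤P))))
      P<c₃ : P < c₃ x y w
      P<c₃ = ≰⇒> λ small → l≰ {2 + 2 * P + P} small-multiple
          (≤-trans l≤ (+-monoʳ-≤ (2 + 2 * P) (≤-trans (count-mono _ _ λ u e → let (p , q , s) = members u e in ∧-intro p (∧-intro q s)) small)))

    -- A core vertex is adjacent to the rest of the core, hence to almost all common neighbours of x
    -- and y.
    core-collinear : ∀ {x y} (xy : a x y ≡ true) w → Core.core (core-at xy) w ≡ true → collinear x y w ≡ true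
    core-collinear {x} {y} xy w bw = collinear-intro xy (proj₁ (core⊆ w bw)) (proj₂ (core⊆ w bw)) (≰⇒> λ small →
        l≰ {suc P + P} (begin
          suc P + P     ≤⟨ +-monoˡ-≤ P (+-monoˡ-≤ P 1≤P) ⟩
          P + P + P     ≡⟨ three P ⟩
          3 * P         ≤⟨ *-monoˡ-≤ P (m≤m+n 3 12) ⟩
          15 * P        ∎)
        (begin
          l                          ≤⟨ core-size xy ⟩
          count core + n * μ         ≤⟨ +-mono-≤ (≤-trans (count-cover core (w ==_) (λ u → a x u ∧ (a y u ∧ a w u)) full)
                                          (+-mono-≤ (≤-reflexive (count-== w)) small)) nμ≤P ⟩
          suc P + P                  ∎))
      where
      open Core (core-at xy)
      three : ∀ P → P + P + P ≡ 3 * P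
      three = solve-∀
      full : ∀ u → core u ≡ true → (w == u) ≡ true ⊎ (a x u ∧ (a y u ∧ a w u)) ≡ true
      full u bu with w ≟ᶠ u
      ... | yes refl = inj₁ refl
      ... | no w≢u = inj₂ (∧-intro (proj₁ (core⊆ u bu)) (∧-intro (proj₂ (core⊆ u bu)) (clique bw bu w≢u)))

    count-collinear-lower : ∀ {x y} → a x y ≡ true → l ≤ count (collinear x y) + n * μ
    count-collinear-lower {x} {y} xy = ≤-trans (core-size xy) (+-monoˡ-≤ (n * μ) (count-mono core (collinear x y) (core-collinear xy)))
      where open Core (core-at xy)

    count-collinear-upper : ∀ {x y} → a x y ≡ true → count (collinear x y) ≤ l
    count-collinear-upper {x} {y} xy = ≤-trans (count-mono (collinear x y) (λ w → a x w ∧ a y w) λ w e →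
      let open Collinear (collinear-elim e) in ∧-intro xz yz) (≤-reflexive (edgeParam x y (a-≢ xy) xy))

    line : V → V → V → Bool
    line x y w = (x == w) ∨ ((y == w) ∨ collinear x y w)

    data OnLine (x y : V) : V → Set where
      left  : OnLine x y x
      right : OnLine x y y
      third : ∀ {w} → collinear x y w ≡ true → OnLine x y w

    on : ∀ {x y w} → line x y w ≡ true → OnLine x y w
    on {x} {y} {w} e with ∨-elim {x == w} e
    ... | inj₁ e₁ = subst (OnLine x y) (==⇒≡ {i = x} {w} e₁) left
    ... | inj₂ e₂ with ∨-elim {y == w} e₂
    ...   | inj₁ e₁ = subst (OnLine x y) (==⇒≡ {i = y} {w} e₁) right
    ...   | inj₂ c  = third c

    off : ∀ {x y w} → OnLine x y w → line x y w ≡ true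
    off {x} left          = ∨-introˡ (==-refl x)
    off {x} {y} right     = ∨-introʳ {x == y} (∨-introˡ (==-refl y))
    off {x} {y} {w} (third c) = ∨-introʳ {x == w} (∨-introʳ {y == w} c)

    line-swap : ∀ {x y w} → OnLine x y w → OnLine y x w
    line-swap left      = right
    line-swap right     = left
    line-swap (third c) = third (collinear-swap₁₂ c)

    line-slide : ∀ {x y p} → a x y ≡ true → OnLine x y p → p ≢ x → a x p ≡ true × (∀ {w} → OnLine x y w → OnLine x p w)
    line-slide xy left      p≢x = ⊥-elim (p≢x refl)
    line-slide xy right     p≢x = xy , λ o → o
    line-slide {x} {y} {p} xy (third c) p≢x = Collinear.xz (collinear-elim c) , slide
      where
      slide : ∀ {w} → OnLine x y w → OnLine x p w
      slide left  = left
      slide right = third (collinear-swap₂₃ c)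
      slide {w} (third c′) with p ≟ᶠ w
      ... | yes refl = right
      ... | no p≢w   = third (collinear-trans c c′ p≢w)

    -- One defining point is moved at a time: from the pair x, y to x, p and, after a swap, to p, q.
    -- Cases where p or q equals x skip a move.
    line-determined : ∀ {x y p q} → a x y ≡ true → OnLine x y p → OnLine x y q → p ≢ q →
      a p q ≡ true × (∀ {w} → OnLine x y w → OnLine p q w)
    line-determined {x} {y} {p} {q} xy op oq p≢q with p ≟ᶠ x | q ≟ᶠ x
    ... | yes refl | _ = line-slide xy oq (λ e → p≢q (sym e))
    ... | no p≢x | yes refl = let (xp , f) = line-slide xy op p≢x in a-sym xp , λ o → line-swap (f o)
    ... | no p≢x | no _ = let (xp , f) = line-slide xy op p≢x
                              (pq , g) = line-slide (a-sym xp) (line-swap (f oq)) (λ e → p≢q (sym e)) in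
                          pq , λ o → g (line-swap (f o))

    same-line : V × V → V × V → Bool
    same-line (x , y) (p , q) = (a x y ∧ a p q) ∧ (line x y p ∧ line x y q)

    same-line-elim : ∀ {x y p q} → same-line (x , y) (p , q) ≡ true → (a x y ≡ true × a p q ≡ true) × (OnLine x y p × OnLine x y q)
    same-line-elim {x} {y} {p} {q} e = let (e₁ , e₂) = ∧-elim {a x y ∧ a p q} e ; (e₃ , e₄) = ∧-elim {line x y p} e₂ in
      ∧-elim {a x y} e₁ , on e₃ , on e₄

    same-line-intro : ∀ {x y p q} → a x y ≡ true → a p q ≡ true → OnLine x y p → OnLine x y q → same-line (x , y) (p , q) ≡ true
    same-line-intro xy pq op oq = ∧-intro (∧-intro xy pq) (∧-intro (off op) (off oq))

    decode : Fin (v * v) → V × V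
    decode = remQuot {v} v

    -- A line is a class of edges. Pairs of vertices are coded in one finite set so that
    -- `representatives` can select a single edge for each line.
    R : Fin (v * v) → Fin (v * v) → Bool
    R e f = same-line (decode e) (decode f)

    same-line-sym : ∀ e f → same-line e f ≡ true → same-line f e ≡ true
    same-line-sym (x , y) (p , q) e with same-line-elim e
    ... | (xy , pq) , (op , oq) = let (_ , f) = line-determined xy op oq (a-≢ pq) in same-line-intro pq xy (f left) (f right)

    lines : Representatives R
    lines = representatives R λ e f → same-line-sym (decode e) (decode f)

    open Representatives lines using (number; rep; related; separated; class)

    end₁ end₂ : Fin number → V
    end₁ L = proj₁ (decode (rep L))
    end₂ L = proj₂ (decode (rep L))

    inc : Fin number → V → Bool
    inc L = line (end₁ L) (end₂ L)

    ends-adjacent : ∀ L → a (end₁ L) (end₂ L) ≡ true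
    ends-adjacent L = proj₁ (proj₁ (same-line-elim (related L)))

    line-clique : ∀ L {x y} → inc L x ≡ true → inc L y ≡ true → x ≢ y → a x y ≡ true
    line-clique L x∈L y∈L x≢y = proj₁ (line-determined (ends-adjacent L) (on x∈L) (on y∈L) x≢y)

    line-through : ∀ {x y} → a x y ≡ true → ∃[ L ] (inc L x ≡ true × inc L y ≡ true)
    line-through {x} {y} xy = L , off (proj₁ on-L) , off (proj₂ on-L)
      where
      code = combine {v} {v} x y
      decode-code : decode code ≡ (x , y)
      decode-code = remQuot-combine {v} {v} x y
      found = class code (subst (λ e → same-line e e ≡ true) (sym decode-code) (same-line-intro xy xy left right))
      L = proj₁ found
      on-L : OnLine (end₁ L) (end₂ L) x × OnLine (end₁ L) (end₂ L) y
      on-L = proj₂ (same-line-elim (same-line-sym (x , y) (decode (rep L))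
          (subst (λ e → same-line e (decode (rep L)) ≡ true) decode-code (proj₂ found))))

    -- Two common points carry the defining points of M onto L, so the representing edges are
    -- related, and distinct representatives are not.
    line-unique : ∀ L M {x y} → x ≢ y → inc L x ≡ true → inc L y ≡ true → inc M x ≡ true → inc M y ≡ true → L ≡ M
    line-unique L M x≢y xL yL xM yM = separated L M (same-line-intro (ends-adjacent L) (ends-adjacent M) (back left) (back right))
      where
      back : ∀ {w} → OnLine (end₁ M) (end₂ M) w → OnLine (end₁ L) (end₂ L) w
      back o = let (xy , f) = line-determined (ends-adjacent M) (on xM) (on yM) x≢y
                   (_  , g) = line-determined (ends-adjacent L) (on xL) (on yL) x≢y
                   (_  , h) = line-determined xy (g left) (g right) (a-≢ (ends-adjacent L)) in h (f o)

    line-size-lower : ∀ L → suc (suc l) ≤ count (inc L) + n * μ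
    line-size-lower L = begin
      2 + l                                 ≤⟨ +-monoʳ-≤ 2 (count-collinear-lower xy) ⟩
      2 + (count (collinear x y) + n * μ)   ≡⟨ sym (+-assoc 2 (count (collinear x y)) (n * μ)) ⟩
      2 + count (collinear x y) + n * μ     ≡⟨ cong (λ c → c + count (collinear x y) + n * μ) (sym (cong₂ _+_ (count-== x) (count-== y))) ⟩
      count (x ==_) + count (y ==_) + count (collinear x y) + n * μ
        ≡⟨ cong (_+ n * μ) (+-assoc (count (x ==_)) _ _) ⟩
      count (x ==_) + (count (y ==_) + count (collinear x y)) + n * μ
        ≤⟨ +-monoˡ-≤ (n * μ) (≤-trans (+-monoʳ-≤ (count (x ==_)) (count-disjoint (λ w → (y == w) ∨ collinear x y w) (y ==_) (collinear x y)
              (λ _ → ∨-introˡ) (λ w → ∨-introʳ {y == w}) λ w e c → a-≢ (Collinear.yz (collinear-elim c)) (==⇒≡ e)))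
            (count-disjoint (inc L) (x ==_) (λ w → (y == w) ∨ collinear x y w) (λ _ → ∨-introˡ) (λ w → ∨-introʳ {x == w}) disjoint)) ⟩
      count (inc L) + n * μ                 ∎
      where
      x = end₁ L
      y = end₂ L
      xy = ends-adjacent L
      disjoint : ∀ w → (x == w) ≡ true → ((y == w) ∨ collinear x y w) ≡ true → ⊥
      disjoint w e e′ with ∨-elim {y == w} e′
      ... | inj₁ e″ = a-≢ xy (trans (==⇒≡ e) (sym (==⇒≡ e″)))
      ... | inj₂ c  = a-≢ (Collinear.xz (collinear-elim c)) (==⇒≡ e)

    line-size-upper : ∀ L → count (inc L) ≤ suc (suc l)
    line-size-upper L = begin
      count (inc L)                                                       ≤⟨ count-cover (inc L) (x ==_)
          (λ w → (y == w) ∨ collinear x y w) (λ w → ∨-elim) ⟩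
      count (x ==_) + count (λ w → (y == w) ∨ collinear x y w)
          ≤⟨ +-monoʳ-≤ (count (x ==_)) (count-cover _ (y ==_) (collinear x y) (λ w → ∨-elim)) ⟩
      count (x ==_) + (count (y ==_) + count (collinear x y))
          ≤⟨ +-mono-≤ (≤-reflexive (count-== x)) (+-mono-≤ (≤-reflexive (count-== y)) (count-collinear-upper xy)) ⟩
      2 + l                                                               ∎
      where
      x = end₁ L
      y = end₂ L
      xy = ends-adjacent L

-- Partial geometries and dual Steiner systems.

module PartialGeometries where
  open import Data.Nat
  open import Data.Nat.Properties
  open import Data.Fin.Subset using (∣_∣) renaming (_∈_ to _∈ˢ_)
  open import Data.Vec using (tabulate)
  open import Data.Vec.Properties using (lookup∘tabulate; lookup⇒[]=; []=⇒lookup)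
  open FiniteCounting

  -- A partial linear space whose collinearity graph is G.
  record LinearSpace {v} (G : Graph v) : Set where
    field
      b          : ℕ
      inc        : Fin b → Fin v → Bool
      clique     : ∀ L {x y} → inc L x ≡ true → inc L y ≡ true → x ≢ y → adj G x y ≡ true
      through    : ∀ {x y} → adj G x y ≡ true → ∃[ L ] (inc L x ≡ true × inc L y ≡ true)
      unique-line : ∀ L M {x y} → x ≢ y → inc L x ≡ true → inc L y ≡ true → inc M x ≡ true → inc M y ≡ true → L ≡ M
      two-points : ∀ L → ∃[ x ] ∃[ y ] (x ≢ y × inc L x ≡ true × inc L y ≡ true)

    size : Fin b → ℕ
    size L = count (inc L)

    degree-of : Fin v → ℕ
    degree-of x = count (λ L → inc L x)

    on-line : Fin v → Fin b → ℕ
    on-line x L = count (λ w → adj G x w ∧ inc L w)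

    meets : Fin b → Fin b → Bool
    meets M L = 0 <ᵇ count (λ w → inc M w ∧ inc L w)

    meets-intro : ∀ {L M w} → inc M w ≡ true → inc L w ≡ true → meets M L ≡ true
    meets-intro {L} {M} {w} wM wL with count (λ u → inc M u ∧ inc L u) | inhabited-count (λ u → inc M u ∧ inc L u) w (∧-intro wM wL)
    ... | suc _ | _ = refl

    meets-elim : ∀ {L M} → meets M L ≡ true → ∃[ w ] (inc M w ≡ true × inc L w ≡ true)
    meets-elim {L} {M} e with count (λ u → inc M u ∧ inc L u) in eq
    ... | suc c = let (w , e′) = count-inhabited (λ u → inc M u ∧ inc L u) (subst (1 ≤_) (sym eq) (s≤s z≤n)) in w , ∧-elim {inc M w} e′

    same-point : ∀ {L M y z} → M ≢ L → inc M y ≡ true → inc L y ≡ true → inc M z ≡ true → inc L z ≡ true → y ≡ z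
    same-point {L} {M} {y} {z} M≢L yM yL zM zL with y ≟ᶠ z
    ... | yes y≡z = y≡z
    ... | no y≢z  = ⊥-elim (M≢L (unique-line M L y≢z yM zM yL zL))

  -- The geometry pg(s, t, α) with s = K, t = m - 1 and α = T. The axiom counts the lines on x that
  -- meet L, not the points of L collinear with x: the dual Steiner system and the parallel classes
  -- are read off from lines.
  record PartialGeometry {v} (G : Graph v) (m K T : ℕ) : Set where
    field
      space    : LinearSpace G
    open LinearSpace space public
    field
      deg      : ∀ x → degree-of x ≡ m
      size≡    : ∀ L → size L ≡ suc K
      crossing : ∀ L x → inc L x ≡ false → count (λ M → inc M x ∧ meets M L) ≡ T

  count-tabulate : ∀ {n} (p : Fin n → Bool) → ∣ tabulate p ∣ ≡ count p
  count-tabulate {zero}  p = refl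
  count-tabulate {suc n} p with p zero
  ... | true  = cong suc (count-tabulate (λ i → p (suc i)))
  ... | false = count-tabulate (λ i → p (suc i))

  ∈-tabulate : ∀ {n} (p : Fin n → Bool) {x} → p x ≡ true → x ∈ˢ tabulate p
  ∈-tabulate p {x} e = lookup⇒[]= x (tabulate p) (trans (lookup∘tabulate p x) e)

  tabulate-∈ : ∀ {n} (p : Fin n → Bool) {x} → x ∈ˢ tabulate p → p x ≡ true
  tabulate-∈ p {x} e = trans (sym (lookup∘tabulate p x)) ([]=⇒lookup e)

  two-witnesses : ∀ {n} (p : Fin n → Bool) → 2 ≤ count p → ∃[ i ] ∃[ j ] (i ≢ j × p i ≡ true × p j ≡ true)
  two-witnesses p h with count-inhabited p (≤-trans (s≤s z≤n) h)
  ... | i , pi with count-< p (i ==_) (subst (_< count p) (sym (count-== i)) h)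
  ...   | j , pj , i≢j = i , j , (λ i≡j → true≢false (subst (λ z → (i == z) ≡ true) i≡j (==-refl i)) i≢j) , pi , pj

  subset-full : ∀ {n} (p q : Fin n → Bool) → (∀ i → p i ≡ true → q i ≡ true) → count q ≤ count p → ∀ i → q i ≡ true → p i ≡ true
  subset-full p q p⊆q h i qi with bool (p i)
  ... | inj₁ e = e
  ... | inj₂ e = ⊥-elim (<-irrefl refl (begin-strict
      count p                   <⟨ ≤-reflexive (cong (_+ count p) (sym (count-== i))) ⟩
      count (i ==_) + count p   ≤⟨ count-disjoint q (i ==_) p (λ w i≡w → subst (λ z → q z ≡ true) (==⇒≡ i≡w) qi) p⊆q
                                     (λ w i≡w pw → true≢false (subst (λ z → p z ≡ true) (sym (==⇒≡ i≡w)) pw) e) ⟩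
      count q                   ≤⟨ h ⟩
      count p                   ∎))
    where open ≤-Reasoning

  -- When T = m any two lines meet, and the points are the blocks of a Steiner system on the set of lines.
  steiner : ∀ {v} {G : Graph v} {m K} → 2 ≤ m → PartialGeometry G m K m → IsSteinerGraph G
  steiner {v} {G} {m} 2≤m PG = m , b , v , system , record
      { to = λ x → x ; from = λ x → x ; from-to = λ _ → refl ; to-from = λ _ → refl
      ; adj→R = λ x y xy → (λ { refl → true≢false xy (irrefl G x) }) ,
          (let (L , xL , yL) = through xy in L , ∈-tabulate (λ M → inc M x) xL , ∈-tabulate (λ M → inc M y) yL)
      ; R→adj = λ { x y (x≢y , L , xL , yL) → clique L (tabulate-∈ (λ M → inc M x) xL) (tabulate-∈ (λ M → inc M y) yL) x≢y }
      }
    where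
    open PartialGeometry PG
    2≤deg : ∀ x → 2 ≤ count (λ L → inc L x)
    2≤deg x = subst (2 ≤_) (sym (deg x)) 2≤m
    meet : ∀ L M → L ≢ M → ∃[ x ] (inc L x ≡ true × inc M x ≡ true)
    meet L M L≢M with two-points M
    ... | x , y , x≢y , xM , yM with bool (inc L x) | bool (inc L y)
    ...   | inj₁ xL | _       = x , xL , xM
    ...   | _       | inj₁ yL = y , yL , yM
    -- All m lines on x meet L, because `crossing` equals the degree; M is one of them.
    ...   | inj₂ x∉L | inj₂ _ with meets-elim (proj₂ (∧-elim {inc M x} (subset-full (λ N → inc N x ∧ meets N L) (λ N → inc N x)
                                    (λ N e → proj₁ (∧-elim {inc N x} e)) (≤-reflexive (trans (deg x) (sym (crossing L x x∉L)))) M xM)))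
    ...     | z , zM , zL = z , zL , zM
    system : SteinerSystem m b v
    system = record
      { two≤m     = 2≤m
      ; block     = λ x → tabulate (λ L → inc L x)
      ; blockSize = λ x → trans (count-tabulate (λ L → inc L x)) (deg x)
      ; distinct  = λ x y e → distinct-points x y (λ L xL → tabulate-∈ (λ M → inc M y) (subst (L ∈ˢ_) e (∈-tabulate (λ M → inc M x) xL)))
      ; cover     = λ L M L≢M → let (x , xL , xM) = meet L M L≢M in x , ∈-tabulate (λ N → inc N x) xL , ∈-tabulate (λ N → inc N x) xM
      ; unique    = λ L M L≢M x y xL xM yL yM → same-point L≢M (tabulate-∈ (λ N → inc N x) xL) (tabulate-∈ (λ N → inc N x) xM)
                                                  (tabulate-∈ (λ N → inc N y) yL) (tabulate-∈ (λ N → inc N y) yM)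
      }
      where
      distinct-points : ∀ x y → (∀ L → inc L x ≡ true → inc L y ≡ true) → x ≡ y
      distinct-points x y h with two-witnesses (λ L → inc L x) (2≤deg x)
      ... | L , M , L≢M , xL , xM = same-point L≢M xL xM (h L xL) (h M xM)

-- The point-line incidence matrix.

module Incidence (F : OrderedField) where
  open import Data.Nat as ℕ using (ℕ; zero; suc; z≤n; s≤s)
  import Data.Nat.Properties as ℕ
  open FiniteCounting
  open PartialGeometries
  open FieldProperties F
  open Idempotents F
  open Spectrum F

  module Counting {v} (G : Graph v) {k l μ} (srg : IsSRG G k l μ) (S : LinearSpace G) where
    open IsSRG srg
    open AdjacencyAlgebra G srg
    open LinearSpace S

    N : Fin b → Fin v → Carrier
    N L x = b2F (inc L x)

    gram : ∀ x y → sum (λ L → N L x * N L y) ≡ α x y + fromℕ (degree-of x) * δ x y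
    gram x y = trans (sum-cong λ L → sym (b2F-∧ (inc L x) (inc L y))) (trans (sum-b2F (λ L → inc L x ∧ inc L y)) (cases (kind x y)))
      where
      value : ∀ {d a} → δ x y ≡ d → α x y ≡ a → α x y + fromℕ (degree-of x) * δ x y ≡ a + fromℕ (degree-of x) * d
      value e e′ = cong₂ (λ d a → a + fromℕ (degree-of x) * d) e e′
      cases : Kind x y → fromℕ (count (λ L → inc L x ∧ inc L y)) ≡ α x y + fromℕ (degree-of x) * δ x y
      cases (same refl d a) = trans (cong fromℕ (count-cong _ _ λ L → bool-ext (λ e → proj₁ (∧-elim {inc L x} e)) (λ e → ∧-intro e e)))
        (sym (trans (value d a) (solve 1 (λ t → :0 :+ t :* :1 := t) refl (fromℕ (degree-of x)))))
      cases (edge x≢y xy d a) = trans (cong fromℕ (ℕ.≤-antisym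
          (count-≤1 _ λ L M e e′ → let (xL , yL) = ∧-elim {inc L x} e ; (xM , yM) = ∧-elim {inc M x} e′ in unique-line L M x≢y xL yL xM yM)
          (let (L , xL , yL) = through xy in inhabited-count _ L (∧-intro xL yL))))
        (sym (trans (value d a) (solve 1 (λ t → :1 :+ t :* :0 := :1 :+ :0) refl (fromℕ (degree-of x)))))
      cases (non-edge x≢y xy d a) = trans (cong fromℕ (count-empty _ λ L → bool-ext
          (λ e → let (xL , yL) = ∧-elim {inc L x} e in ⊥-elim (true≢false (clique L xL yL x≢y) xy)) λ ()))
        (sym (trans (value d a) (solve 1 (λ t → :0 :+ t :* :0 := :0) refl (fromℕ (degree-of x)))))

    -- Counts the pairs (L, y) with x and y on L: each of the k neighbours y lies on one such line,
    -- and y = x on `degree-of x` of them.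
    flags : ∀ x → sum (λ L → N L x * fromℕ (size L)) ≡ fromℕ (k ℕ.+ degree-of x)
    flags x = begin
      sum (λ L → N L x * fromℕ (size L))          ≡⟨
          (sum-cong λ L → trans (cong (N L x *_) (sym (sum-b2F (inc L)))) (*-sum (N L x) (N L))) ⟩
      sum (λ L → sum λ y → N L x * N L y)          ≡⟨ sum-swap _ ⟩
      sum (λ y → sum λ L → N L x * N L y)          ≡⟨ sum-cong (gram x) ⟩
      sum (λ y → α x y + t * δ x y)                ≡⟨ sum-+* (α x) (δ x) t ⟩
      sum (α x) + t * sum (δ x)                    ≡⟨ cong₂ (λ p q → p + t * q) (sum-α x)
          (trans (sum-cong λ y → sym (trans (*-comm (δ x y) 1#) (*-identityˡ (δ x y)))) (sum-δ x (λ _ → 1#))) ⟩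
      K + t * 1#                                   ≡⟨ cong (K +_) (trans (*-comm t 1#) (*-identityˡ t)) ⟩
      K + t                                        ≡⟨ sym (fromℕ-+ k (degree-of x)) ⟩
      fromℕ (k ℕ.+ degree-of x)                    ∎
      where
      open ≡-Reasoning
      t = fromℕ (degree-of x)

    sum-N : ∀ x (c : ℕ) → sum (λ L → N L x * fromℕ c) ≡ fromℕ (degree-of x ℕ.* c)
    sum-N x c = trans (sym (sum-* (fromℕ c) (λ L → N L x)))
        (trans (cong (_* fromℕ c) (sum-b2F (λ L → inc L x))) (sym (fromℕ-* (degree-of x) c)))

    N-mono : ∀ {L x y z} → y ≤ z → N L x * y ≤ N L x * z
    N-mono {L} {x} {y} {z} y≤z with inc L x
    ... | true  = subst₂ _≤_ (sym (*-identityˡ y)) (sym (*-identityˡ z)) y≤z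
    ... | false = subst₂ _≤_ (sym (zeroˡ y)) (sym (zeroˡ z)) ≤-refl

    flags-upper : ∀ c → (∀ L → size L ℕ.≤ c) → ∀ x → k ℕ.+ degree-of x ℕ.≤ degree-of x ℕ.* c
    flags-upper c h x = fromℕ-cancel-≤ (subst₂ _≤_ (flags x) (sum-N x c) (sum-mono _ _ λ L → N-mono (fromℕ-mono-≤ (h L))))

    flags-lower : ∀ c d → (∀ L → c ℕ.≤ size L ℕ.+ d) → ∀ x → degree-of x ℕ.* c ℕ.≤ k ℕ.+ degree-of x ℕ.+ degree-of x ℕ.* d
    flags-lower c d h x = fromℕ-cancel-≤ (subst₂ _≤_ (sum-N x c)
      (trans (sum-cong λ L → trans (cong (N L x *_) (fromℕ-+ (size L) d)) (distribˡ (N L x) (fromℕ (size L)) (fromℕ d)))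
        (trans (sum-+ _ (λ L → N L x * fromℕ d)) (trans (cong₂ _+_ (flags x) (sum-N x d))
            (sym (fromℕ-+ (k ℕ.+ degree-of x) (degree-of x ℕ.* d))))))
      (sum-mono _ _ λ L → N-mono (fromℕ-mono-≤ (h L))))

    -- A line on x other than L meets L at most once, and each point of L adjacent to x is joined to
    -- it by one line; so meeting lines correspond to adjacent points.
    crossing : ∀ L x → inc L x ≡ false → count (λ M → inc M x ∧ meets M L) ≡ on-line x L
    crossing L x x∉L = fromℕ-injective (begin
      fromℕ (count (λ M → inc M x ∧ meets M L))      ≡⟨ sym (sum-b2F (λ M → inc M x ∧ meets M L)) ⟩
      sum (λ M → b2F (inc M x ∧ meets M L))          ≡⟨ sum-cong each ⟩
      sum (λ M → N M x * sum (λ w → N M w * N L w))  ≡⟨ sym (∑-assoc (λ M → N M x) N (N L)) ⟩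
      sum (λ w → sum (λ M → N M x * N M w) * N L w)  ≡⟨ (sum-cong λ w → trans (cong (_* N L w) (gram x w))
          (solve 4 (λ a t d n → (a :+ t :* d) :* n := a :* n :+ t :* (d :* n)) refl (α x w) t (δ x w) (N L w))) ⟩
      sum (λ w → α x w * N L w + t * (δ x w * N L w)) ≡⟨ trans (sum-+* _ _ t) (cong₂ (λ p q → p + t * q)
          (trans (sum-cong λ w → sym (b2F-∧ (adj G x w) (inc L w))) (sum-b2F (λ w → adj G x w ∧ inc L w)))
              (trans (sum-δ x (N L)) (cong b2F x∉L))) ⟩
      fromℕ (on-line x L) + t * 0#                   ≡⟨ trans (cong (fromℕ (on-line x L) +_) (zeroʳ t)) (+-identityʳ _) ⟩
      fromℕ (on-line x L)                            ∎)
      where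
      open ≡-Reasoning
      t = fromℕ (degree-of x)
      each : ∀ M → b2F (inc M x ∧ meets M L) ≡ N M x * sum (λ w → N M w * N L w)
      each M with inc M x in xM
      ... | false = sym (zeroˡ _)
      ... | true  = sym (trans (*-identityˡ _) (trans (sum-cong λ w → sym (b2F-∧ (inc M w) (inc L w)))
          (trans (sum-b2F (λ w → inc M w ∧ inc L w)) at-most-one)))
        where
        M≢L : M ≢ L
        M≢L refl = true≢false xM x∉L
        ≤1 : count (λ w → inc M w ∧ inc L w) ℕ.≤ 1
        ≤1 = count-≤1 _ λ y z e e′ → let (yM , yL) = ∧-elim {inc M y} e ; (zM , zL) = ∧-elim {inc M z} e′ in same-point M≢L yM yL zM zL
        at-most-one : fromℕ (count (λ w → inc M w ∧ inc L w)) ≡ b2F (meets M L)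
        at-most-one with count (λ w → inc M w ∧ inc L w) | ≤1
        ... | 0 | _ = refl
        ... | 1 | _ = +-identityʳ 1#
        ... | suc (suc _) | s≤s ()

    -- If every point is on m lines, then N Nᵀ = A + m I, so (A - r I) N Nᵀ (A - r I) is a multiple of J
    -- and all rows of (A - r I) N agree.
    module Regular (r m : ℕ) (k≡ : k ≡ r ℕ.* m ℕ.+ μ) (l≡ : l ℕ.+ m ≡ μ ℕ.+ r) (deg : ∀ x → degree-of x ≡ m) where
      private
        r′ m′ : Carrier
        r′ = fromℕ r
        m′ = fromℕ m

        k-eq : K ≡ r′ * m′ + M
        k-eq = trans (cong fromℕ k≡) (trans (fromℕ-+ (r ℕ.* m) μ) (cong (_+ M) (fromℕ-* r m)))

        l-eq : L + m′ ≡ M + r′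
        l-eq = trans (sym (fromℕ-+ l m)) (trans (cong fromℕ l≡) (fromℕ-+ μ r))

        B : Fin v → Fin v → Carrier
        B x w = α x w - r′ * δ x w

        W : Fin b → Fin v → Carrier
        W L x = sum λ w → B x w * N L w

        -- (A + m I)(A - r I) = μ J, the quadratic equation of A.
        inner : ∀ w y → sum (λ u → (α w u + m′ * δ w u) * B y u) ≡ M
        inner w y = begin
          sum (λ u → (α w u + m′ * δ w u) * B y u)
            ≡⟨ (sum-cong λ u → trans (cong₂ (λ p q → (α w u + m′ * δ w u) * (p - r′ * q)) (α-sym y u) (δ-sym y u))
                 (solve 6 (λ a m d a′ r d′ → (a :+ m :* d) :* (a′ :- r :* d′) := (a :* a′ :+ m :* (d :* a′)) :+ (:- r) :*
                     (d′ :* (a :+ m :* d))) refl (α w u) m′ (δ w u) (α u y) r′ (δ u y))) ⟩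
          sum (λ u → (α w u * α u y + m′ * (δ w u * α u y)) + (- r′) * (δ u y * (α w u + m′ * δ w u)))
            ≡⟨ trans (sum-+* _ _ (- r′)) (cong₂ (λ p q → p + (- r′) * q)
                 (trans (sum-+* _ _ m′) (cong₂ (λ p q → p + m′ * q) (α² w y) (sum-δ w (λ u → α u y))))
                     (sum-δ′ y (λ u → α w u + m′ * δ w u))) ⟩
          ((K - M) * δ w y + (L - M) * α w y + M) + m′ * α w y + (- r′) * (α w y + m′ * δ w y)
            ≡⟨ by₂ (δ w y) (α w y) (solve 7 (λ k l μ r m d a →
                 (((k :- μ) :* d :+ (l :- μ) :* a :+ μ) :+ m :* a :+ (:- r) :* (a :+ m :* d)) :- μ :=
                 d :* (k :- (r :* m :+ μ)) :+ a :* ((l :+ m) :- (μ :+ r))) refl K L M r′ m′ (δ w y) (α w y)) k-eq l-eq ⟩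
          M ∎
          where open ≡-Reasoning

        -- By `inner` and (A - r I) J = (k - r) J all these inner products are equal, so the vectors
        -- indexed by x and y have distance zero; this is `rows`.
        Q : ∀ x y → sum (λ L → W L x * W L y) ≡ (K - r′) * M
        Q x y = begin
          sum (λ L → W L x * W L y)
            ≡⟨ (sum-cong λ L → trans (sum-* (W L y) (λ w → B x w * N L w)) (sum-cong λ w → *-assoc (B x w) (N L w) (W L y))) ⟩
          sum (λ L → sum λ w → B x w * (N L w * W L y))
            ≡⟨ trans (sum-swap _) (sum-cong λ w → sym (*-sum (B x w) (λ L → N L w * W L y))) ⟩
          sum (λ w → B x w * sum (λ L → N L w * W L y))
            ≡⟨ (sum-cong λ w → cong (B x w *_) (trans (sum-cong λ L → trans (*-sum (N L w) (λ u → B y u * N L u))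
                 (sum-cong λ u → solve 3 (λ a b c → a :* (b :* c) := (a :* c) :* b) refl (N L w) (B y u) (N L u)))
                 (trans (sum-swap _) (trans (sum-cong λ u → trans (sym (sum-* (B y u) (λ L → N L w * N L u)))
                   (cong (_* B y u) (trans (gram w u) (cong (λ t → α w u + fromℕ t * δ w u) (deg w))))) (inner w y))))) ⟩
          sum (λ w → B x w * M)
            ≡⟨ trans (sym (sum-* M (B x))) (cong (_* M)
                (trans (sum-cong λ w → solve 3 (λ a r d → a :- r :* d := a :+ (:- r) :* d) refl (α x w) r′ (δ x w))
                 (trans (sum-+* (α x) (δ x) (- r′)) (trans (cong₂ (λ p q → p + (- r′) * q) (sum-α x)
                    (trans (sum-cong λ y → sym (trans (*-comm (δ x y) 1#) (*-identityˡ (δ x y)))) (sum-δ x (λ _ → 1#))))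
                   (solve 2 (λ k r → k :+ (:- r) :* :1 := k :- r) refl K r′))))) ⟩
          (K - r′) * M ∎
          where open ≡-Reasoning

        rows : ∀ x y → sum (λ L → (W L x - W L y) * (W L x - W L y)) ≡ 0#
        rows x y = begin
          sum (λ L → (W L x - W L y) * (W L x - W L y))
            ≡⟨ (sum-cong λ L → solve 2 (λ a b → (a :- b) :* (a :- b) := a :* a :+ (:- (:1 :+ :1)) :* (a :* b) :+ :1 :* (b :* b))
                refl (W L x) (W L y)) ⟩
          sum (λ L → W L x * W L x + (- (1# + 1#)) * (W L x * W L y) + 1# * (W L y * W L y))
            ≡⟨ trans (sum-+* _ (λ L → W L y * W L y) 1#) (cong₂ (λ p q → p + 1# * q) (trans (sum-+* _ (λ L → W L x * W L y) (- (1# + 1#)))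
                 (cong₂ (λ p q → p + (- (1# + 1#)) * q) (Q x x) (Q x y))) (Q y y)) ⟩
          q + (- (1# + 1#)) * q + 1# * q
            ≡⟨ solve 1 (λ q → q :+ (:- (:1 :+ :1)) :* q :+ :1 :* q := :0) refl q ⟩
          0# ∎
          where
          open ≡-Reasoning
          q = (K - r′) * M

      bit : Bool → ℕ
      bit true  = 1
      bit false = 0

      private
        b2F≡ : ∀ p → b2F p ≡ fromℕ (bit p)
        b2F≡ true  = sym (+-identityʳ 1#)
        b2F≡ false = refl

        W≡ : ∀ L x → W L x ≡ fromℕ (on-line x L) - fromℕ (r ℕ.* bit (inc L x))
        W≡ L x = trans (sum-cong λ w → solve 4 (λ a r d n → (a :- r :* d) :* n := a :* n :+ (:- r) :* (d :* n)) refl (α x w) r′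
            (δ x w) (N L w))
          (trans (sum-+* _ (λ w → δ x w * N L w) (- r′)) (trans (cong₂ (λ p q → p + (- r′) * q)
              (trans (sum-cong λ w → sym (b2F-∧ (adj G x w) (inc L w))) (sum-b2F (λ w → adj G x w ∧ inc L w)))
                  (trans (sum-δ x (N L)) (b2F≡ (inc L x))))
            (trans (solve 3 (λ a r n → a :+ (:- r) :* n := a :- r :* n) refl (fromℕ (on-line x L)) r′ (fromℕ (bit (inc L x))))
              (cong (λ z → fromℕ (on-line x L) - z) (sym (fromℕ-* r (bit (inc L x))))))))

      -- `on-line x L - r [x ∈ L]` does not depend on x. Both negative terms are moved across to
      -- stay within the natural numbers.
      rows-agree : ∀ L x y → on-line x L ℕ.+ r ℕ.* bit (inc L y) ≡ on-line y L ℕ.+ r ℕ.* bit (inc L x)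
      rows-agree L x y with on-line x L ℕ.+ r ℕ.* bit (inc L y) ℕ.≟ on-line y L ℕ.+ r ℕ.* bit (inc L x)
      ... | yes e = e
      ... | no ≢ = ⊥-elim (sq≡0⇒≡0 (sum-nonneg≡0 _ (λ L → 0≤sq (W L x - W L y)) (rows x y) L) λ e → ≢ (fromℕ-injective
          (trans (fromℕ-+ (on-line x L) _) (trans (by₁ 1#
              (solve 4 (λ a b c d → (a :+ d) :- (c :+ b) := :1 :* (((a :- b) :- (c :- d)) :- :0)) refl
              (fromℕ (on-line x L)) (fromℕ (r ℕ.* bit (inc L x))) (fromℕ (on-line y L)) (fromℕ (r ℕ.* bit (inc L y))))
              (trans (sym (cong₂ _-_ (W≡ L x) (W≡ L y))) e)) (sym (fromℕ-+ (on-line y L) _))))))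

      on-line-member : ∀ L {y} → inc L y ≡ true → suc (on-line y L) ≡ size L
      on-line-member L {y} yL = ℕ.≤-antisym
        (subst (ℕ._≤ size L) (cong (ℕ._+ on-line y L) (count-== y)) (count-disjoint (inc L) (y ==_) (λ w → adj G y w ∧ inc L w)
          (λ w e → subst (λ z → inc L z ≡ true) (==⇒≡ e) yL) (λ w e → proj₂ (∧-elim {adj G y w} e))
          λ w e e′ → true≢false (proj₁ (∧-elim {adj G y w} e′)) (subst (λ z → adj G y z ≡ false) (==⇒≡ e) (irrefl G y))))
        (subst (size L ℕ.≤_) (cong (ℕ._+ on-line y L) (count-== y)) (count-cover (inc L) (y ==_) (λ w → adj G y w ∧ inc L w) pick))
        where
        pick : ∀ w → inc L w ≡ true → (y == w) ≡ true ⊎ (adj G y w ∧ inc L w) ≡ true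
        pick w wL with y ≟ᶠ w
        ... | yes refl = inj₁ refl
        ... | no y≢w   = inj₂ (∧-intro (clique L yL wL y≢w) wL)

      -- The constant of `rows-agree`, evaluated at a point of L, is size L - 1 - r.
      on-line-any : ∀ L x → suc (on-line x L ℕ.+ r) ≡ size L ℕ.+ r ℕ.* bit (inc L x)
      on-line-any L x with two-points L
      ... | y , _ , _ , yL , _ = trans (cong suc (trans
          (cong (on-line x L ℕ.+_) (sym (trans (cong (λ z → r ℕ.* bit z) yL) (ℕ.*-identityʳ r)))) (rows-agree L x y)))
            (cong (ℕ._+ r ℕ.* bit (inc L x)) (on-line-member L yL))

      -- `on-line-any` summed over all x, where Σ_x on-line x L = k · size L. The result is linear
      -- in size L with coefficients independent of L, so all lines have the same size.
      size-equation : ∀ L → v ℕ.* suc r ℕ.+ k ℕ.* size L ≡ v ℕ.* size L ℕ.+ r ℕ.* size L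
      size-equation L = fromℕ-injective (begin
        fromℕ (v ℕ.* suc r ℕ.+ k ℕ.* size L)
          ≡⟨ trans (fromℕ-+ (v ℕ.* suc r) _) (cong₂ _+_ (fromℕ-* v (suc r)) (fromℕ-* k (size L))) ⟩
        V * fromℕ (suc r) + K * fromℕ (size L)
          ≡⟨ cong₂ _+_ (sym (sum-const v (fromℕ (suc r)))) (trans (cong (K *_) (sym (sum-b2F (inc L)))) (sym (sum-sum-α (N L)))) ⟩
        sum {v} (λ _ → fromℕ (suc r)) + sum (λ x → sum (λ w → α x w * N L w))
          ≡⟨ trans (sym (sum-+ {v} (λ _ → fromℕ (suc r)) (λ x → sum (λ w → α x w * N L w)))) (sum-cong each) ⟩
        sum (λ x → fromℕ (size L) + r′ * N L x)
          ≡⟨ trans (sum-+* (λ _ → fromℕ (size L)) (N L) r′) (cong₂ (λ p q → p + r′ * q) (sum-const v (fromℕ (size L))) (sum-b2F (inc L))) ⟩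
        V * fromℕ (size L) + r′ * fromℕ (size L)
          ≡⟨ sym (trans (fromℕ-+ (v ℕ.* size L) _) (cong₂ _+_ (fromℕ-* v (size L)) (fromℕ-* r (size L)))) ⟩
        fromℕ (v ℕ.* size L ℕ.+ r ℕ.* size L) ∎)
        where
        open ≡-Reasoning
        each : ∀ x → fromℕ (suc r) + sum (λ w → α x w * N L w) ≡ fromℕ (size L) + r′ * N L x
        each x = trans (cong (fromℕ (suc r) +_) (trans (sum-cong λ w → sym (b2F-∧ (adj G x w) (inc L w)))
            (sum-b2F (λ w → adj G x w ∧ inc L w))))
          (trans (sym (fromℕ-+ (suc r) (on-line x L))) (trans (cong fromℕ (trans (cong suc (ℕ.+-comm r (on-line x L))) (on-line-any L x)))
            (trans (fromℕ-+ (size L) _) (cong (fromℕ (size L) +_)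
                (trans (fromℕ-* r (bit (inc L x))) (cong (r′ *_) (sym (b2F≡ (inc L x)))))))))

-- Coordinates: nets as Latin squares, and complete multipartite graphs.

module Coordinates where
  open import Data.Nat
  open import Data.Nat.Properties hiding (suc-injective; 0≢1+n)
  open import Data.Fin.Properties using (suc-injective)
  open import Data.Bool using ()
  open FiniteCounting
  open PartialGeometries
  open LineConstruction using (Representatives; representatives)

  record Enumeration {n} (p : Fin n → Bool) (c : ℕ) : Set where
    field
      elem     : Fin c → Fin n
      elem-in  : ∀ a → p (elem a) ≡ true
      index    : ∀ i → p i ≡ true → Fin c
      elem-index : ∀ i pi → elem (index i pi) ≡ i
      elem-injective : ∀ a b → elem a ≡ elem b → a ≡ b

    index-elem : ∀ a pa → index (elem a) pa ≡ a
    index-elem a pa = elem-injective _ _ (elem-index (elem a) pa)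

  enumerate : ∀ {n} (p : Fin n → Bool) {c} → count p ≡ c → Enumeration p c
  enumerate {zero}  p refl = record { elem = λ () ; elem-in = λ () ; index = λ () ; elem-index = λ () ; elem-injective = λ () }
  enumerate {suc n} p refl with p zero in p₀ | enumerate (λ i → p (suc i)) refl
  ... | false | E = record
        { elem = λ a → suc (elem a) ; elem-in = elem-in
        ; index = λ { zero e → ⊥-elim (true≢false e p₀) ; (suc i) e → index i e }
        ; elem-index = λ { zero e → ⊥-elim (true≢false e p₀) ; (suc i) e → cong suc (elem-index i e) }
        ; elem-injective = λ a b e → elem-injective a b (suc-injective e) }
    where open Enumeration E
  ... | true | E = record
        { elem = λ { zero → zero ; (suc a) → suc (elem a) }
        ; elem-in = λ { zero → p₀ ; (suc a) → elem-in a }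
        ; index = λ { zero e → zero ; (suc i) e → suc (index i e) }
        ; elem-index = λ { zero e → refl ; (suc i) e → cong suc (elem-index i e) }
        ; elem-injective = λ { zero zero _ → refl ; zero (suc b) () ; (suc a) zero () ; (suc a) (suc b) e → cong suc (elem-injective a b (suc-injective e)) } }
    where open Enumeration E

  -- A net given by t + 2 labellings of the points, any two of which determine the point. The first
  -- two serve as row and column; the other t become the squares, and `separates` yields both the
  -- Latin property and orthogonality.
  module _ {v} (G : Graph v) {t n : ℕ} (label : Fin (suc (suc t)) → Fin v → Fin n)
           (separates : ∀ {i j} → i ≢ j → ∀ {x y} → label i x ≡ label i y → label j x ≡ label j y → x ≡ y)
           (point : Fin n → Fin n → Fin v)
           (row : ∀ r c → label zero (point r c) ≡ r) (column : ∀ r c → label (suc zero) (point r c) ≡ c)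
           (adjacent⇒ : ∀ x y → adj G x y ≡ true → x ≢ y × ∃[ i ] label i x ≡ label i y)
           (⇒adjacent : ∀ x y → x ≢ y → ∀ i → label i x ≡ label i y → adj G x y ≡ true) where
    private
      0≢1 : _≢_ {A = Fin (suc (suc t))} zero (suc zero)
      0≢1 ()

      point-label : ∀ x → point (label zero x) (label (suc zero) x) ≡ x
      point-label x = separates 0≢1 (row _ _) (column _ _)

      point-injective : ∀ {r c r′ c′} → point r c ≡ point r′ c′ → r ≡ r′ × c ≡ c′
      point-injective {r} {c} {r′} {c′} e = trans (sym (row r c)) (trans (cong (label zero) e) (row r′ c′)) ,
        trans (sym (column r c)) (trans (cong (label (suc zero)) e) (column r′ c′))

    net⇒latin : IsLatinSquareGraph G
    net⇒latin = t , n , squares , record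
        { to      = λ x → label zero x , label (suc zero) x
        ; from    = λ { (r , c) → point r c }
        ; from-to = point-label
        ; to-from = λ { (r , c) → cong₂ _,_ (row r c) (column r c) }
        ; adj→R   = λ x y xy → let (x≢y , i , e) = adjacent⇒ x y xy in
                      (λ e′ → x≢y (separates 0≢1 (cong proj₁ e′) (cong proj₂ e′))) , related x y i e
        ; R→adj   = λ { x y (≢ , rel) → unrelated x y (λ { refl → ≢ refl }) rel }
        }
      where
      squares : MOLS t n
      squares = record
        { sq = λ a r c → label (suc (suc a)) (point r c)
        ; rowLatin = λ a r c c′ e → proj₂ (point-injective (separates {suc (suc a)} {zero} (λ ()) e (trans (row r c) (sym (row r c′)))))
        ; colLatin = λ a r r′ c e → proj₁ (point-injective
            (separates {suc (suc a)} {suc zero} (λ ()) e (trans (column r c) (sym (column r′ c)))))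
        ; orthogonal = λ a b a≢b r c r′ c′ e e′ → point-injective (separates (λ q → a≢b (suc-injective (suc-injective q))) e e′)
        }
      Related : Fin v → Fin v → Set
      Related x y = label zero x ≡ label zero y ⊎ label (suc zero) x ≡ label (suc zero) y ⊎
        ∃[ a ] sq squares a (label zero x) (label (suc zero) x) ≡ sq squares a (label zero y) (label (suc zero) y)
      related : ∀ x y i → label i x ≡ label i y → Related x y
      related x y zero          e = inj₁ e
      related x y (suc zero)    e = inj₂ (inj₁ e)
      related x y (suc (suc a)) e = inj₂ (inj₂ (a , trans (cong (label (suc (suc a))) (point-label x))
          (trans e (sym (cong (label (suc (suc a))) (point-label y))))))
      unrelated : ∀ x y → x ≢ y → Related x y → adj G x y ≡ true
      unrelated x y x≢y (inj₁ e)              = ⇒adjacent x y x≢y zero e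
      unrelated x y x≢y (inj₂ (inj₁ e))       = ⇒adjacent x y x≢y (suc zero) e
      unrelated x y x≢y (inj₂ (inj₂ (a , e))) = ⇒adjacent x y x≢y (suc (suc a))
        (trans (sym (cong (label (suc (suc a))) (point-label x))) (trans e (cong (label (suc (suc a))) (point-label y))))

  -- When T = m - 1 Playfair's axiom holds, and the parallel classes coordinatise the points.
  latin : ∀ {v} {G : Graph v} {t K} → PartialGeometry G (suc (suc t)) K (suc t) → Fin v → IsLatinSquareGraph G
  latin {v} {G} {t} {K} PG o = net⇒latin G label separates point row column
      (λ x y xy → (λ { refl → true≢false xy (irrefl G x) }) , adjacent⇒ x y xy)
      (λ x y x≢y i e → clique (par i x) (par-∋ i x) (subst (λ L → inc L y ≡ true) (sym (label-injective i e)) (par-∋ i y)) x≢y)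
    where
    open PartialGeometry PG
    m = suc (suc t)

    Parallel : Fin b → Fin b → Set
    Parallel M L = M ≡ L ⊎ meets M L ≡ false

    meets-sym : ∀ L M → meets M L ≡ false → meets L M ≡ false
    meets-sym L M e with bool (meets L M)
    ... | inj₂ f = f
    ... | inj₁ f = let (w , wL , wM) = meets-elim f in ⊥-elim (true≢false (meets-intro wM wL) e)

    parallel-sym : ∀ {L M} → Parallel M L → Parallel L M
    parallel-sym (inj₁ e) = inj₁ (sym e)
    parallel-sym {L} {M} (inj₂ e) = inj₂ (meets-sym L M e)

    non-crossing : ∀ L x → inc L x ≡ false → count (λ M → inc M x ∧ not (meets M L)) ≡ 1
    non-crossing L x x∉L = +-cancelˡ-≡ (suc t) _ _ (trans (cong (_+ count (λ M → inc M x ∧ not (meets M L))) (sym (crossing L x x∉L)))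
      (trans (sym (count-split (λ M → inc M x) (λ M → meets M L))) (trans (deg x) (+-comm 1 (suc t)))))

    parallel-exists : ∀ L x → ∃[ M ] (inc M x ≡ true × Parallel M L)
    parallel-exists L x with bool (inc L x)
    ... | inj₁ xL  = L , xL , inj₁ refl
    ... | inj₂ x∉L with count-inhabited (λ M → inc M x ∧ not (meets M L)) (≤-reflexive (sym (non-crossing L x x∉L)))
    ...   | M , e = let (xM , e′) = ∧-elim {inc M x} e in M , xM , inj₂ (not-elim e′)

    parallel-unique : ∀ {L x M M′} → inc M x ≡ true → Parallel M L → inc M′ x ≡ true → Parallel M′ L → M ≡ M′
    parallel-unique xM (inj₁ refl) xM′ (inj₁ refl) = refl
    parallel-unique xM (inj₁ refl) xM′ (inj₂ e)    = ⊥-elim (true≢false (meets-intro xM′ xM) e)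
    parallel-unique xM (inj₂ e)    xM′ (inj₁ refl) = ⊥-elim (true≢false (meets-intro xM xM′) e)
    parallel-unique {L} {x} {M} {M′} xM (inj₂ e) xM′ (inj₂ e′) with M ≟ᶠ M′
    ... | yes M≡M′ = M≡M′
    ... | no M≢M′ = ⊥-elim (<-irrefl (sym (non-crossing L x x∉L)) (two-members (λ N → inc N x ∧ not (meets N L))
                      (∧-intro xM (not-intro e)) (∧-intro xM′ (not-intro e′)) M≢M′))
      where
      x∉L : inc L x ≡ false
      x∉L with bool (inc L x)
      ... | inj₁ xL = ⊥-elim (true≢false (meets-intro xM xL) e)
      ... | inj₂ f  = f

    meets-or-parallel : ∀ M L → (∃[ x ] (inc M x ≡ true × inc L x ≡ true)) ⊎ Parallel M L
    meets-or-parallel M L with bool (meets M L)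
    ... | inj₁ e = inj₁ (meets-elim e)
    ... | inj₂ e = inj₂ (inj₂ e)

    -- If L and N met at x, both would be the parallel to M through x, hence equal.
    parallel-trans : ∀ {L M N} → Parallel L M → Parallel M N → Parallel L N
    parallel-trans {L} {M} {N} p q with meets-or-parallel L N
    ... | inj₂ r            = r
    ... | inj₁ (x , xL , xN) = inj₁ (parallel-unique xL p xN (parallel-sym q))

    -- Every line has exactly one parallel through o, so the m lines on o represent the parallel
    -- classes.
    pencil : Enumeration (λ L → inc L o) m
    pencil = enumerate (λ L → inc L o) (deg o)
    module Pencil = Enumeration pencil

    ℓ : Fin m → Fin b
    ℓ = Pencil.elem

    par : Fin m → Fin v → Fin b
    par i x = proj₁ (parallel-exists (ℓ i) x)

    par-∋ : ∀ i x → inc (par i x) x ≡ true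
    par-∋ i x = proj₁ (proj₂ (parallel-exists (ℓ i) x))

    par-∥ : ∀ i x → Parallel (par i x) (ℓ i)
    par-∥ i x = proj₂ (proj₂ (parallel-exists (ℓ i) x))

    par-meet : ∀ i {x y w} → inc (par i x) w ≡ true → inc (par i y) w ≡ true → par i x ≡ par i y
    par-meet i xw yw = parallel-unique xw (par-∥ i _) yw (par-∥ i _)

    not-parallel : ∀ {i j} → i ≢ j → ∀ {L M} → Parallel L (ℓ i) → Parallel M (ℓ j) → ¬ Parallel L M
    not-parallel {i} {j} i≢j p q r = i≢j (Pencil.elem-injective i j (parallel-unique {L = ℓ j} (Pencil.elem-in i)
      (parallel-trans (parallel-sym p) (parallel-trans r q)) (Pencil.elem-in j) (inj₁ refl)))

    crossing-point : ∀ {i j} → i ≢ j → ∀ {L M} → Parallel L (ℓ i) → Parallel M (ℓ j) → ∃[ x ] (inc L x ≡ true × inc M x ≡ true)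
    crossing-point i≢j {L} {M} p q with meets-or-parallel L M
    ... | inj₁ w = w
    ... | inj₂ r = ⊥-elim (not-parallel i≢j p q r)

    -- Lines of class i are labelled by their intersection with a fixed line of another class.
    τ : Fin m → Fin m
    τ zero    = suc zero
    τ (suc _) = zero

    i≢τi : ∀ i → i ≢ τ i
    i≢τi zero    ()
    i≢τi (suc i) ()

    points : ∀ L → Enumeration (inc L) (suc K)
    points L = enumerate (inc L) (size≡ L)

    foot : ∀ i x → ∃[ w ] (inc (par i x) w ≡ true × inc (ℓ (τ i)) w ≡ true)
    foot i x = crossing-point (i≢τi i) (par-∥ i x) (inj₁ refl)

    label : Fin m → Fin v → Fin (suc K)
    label i x = Enumeration.index (points (ℓ (τ i))) (proj₁ (foot i x)) (proj₂ (proj₂ (foot i x)))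

    label-elem : ∀ i x → Enumeration.elem (points (ℓ (τ i))) (label i x) ≡ proj₁ (foot i x)
    label-elem i x = Enumeration.elem-index (points (ℓ (τ i))) _ _

    label-injective : ∀ i {x y} → label i x ≡ label i y → par i x ≡ par i y
    label-injective i {x} {y} e = par-meet i (proj₁ (proj₂ (foot i x)))
      (subst (λ w → inc (par i y) w ≡ true) (trans (sym (label-elem i y))
          (trans (cong (Enumeration.elem (points (ℓ (τ i)))) (sym e)) (label-elem i x))) (proj₁ (proj₂ (foot i y))))

    label-at : ∀ i {x} c → inc (par i x) (Enumeration.elem (points (ℓ (τ i))) c) ≡ true → label i x ≡ c
    label-at i {x} c on = Enumeration.elem-injective (points (ℓ (τ i))) _ _ (trans (label-elem i x)
      (same-point (λ e → not-parallel (i≢τi i) (par-∥ i x) (inj₁ refl) (inj₁ e)) (proj₁ (proj₂ (foot i x))) (proj₂ (proj₂ (foot i x)))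
        on (Enumeration.elem-in (points (ℓ (τ i))) c)))

    separates : ∀ {i j} → i ≢ j → ∀ {x y} → label i x ≡ label i y → label j x ≡ label j y → x ≡ y
    separates {i} {j} i≢j {x} {y} e e′ = same-point (λ q → not-parallel i≢j (par-∥ i x) (par-∥ j x) (inj₁ q))
      (par-∋ i x) (par-∋ j x) (subst (λ L → inc L y ≡ true) (sym (label-injective i e)) (par-∋ i y))
      (subst (λ L → inc L y ≡ true) (sym (label-injective j e′)) (par-∋ j y))

    0≢1 : _≢_ {A = Fin m} zero (suc zero)
    0≢1 ()

    through-foot : ∀ i (c : Fin (suc K)) → Fin b
    through-foot i c = par i (Enumeration.elem (points (ℓ (τ i))) c)

    intersection : ∀ r c → ∃[ x ] (inc (through-foot zero r) x ≡ true × inc (through-foot (suc zero) c) x ≡ true)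
    intersection r c = crossing-point 0≢1 (par-∥ zero _) (par-∥ (suc zero) _)

    point : Fin (suc K) → Fin (suc K) → Fin v
    point r c = proj₁ (intersection r c)

    label-of-foot : ∀ i c x → inc (through-foot i c) x ≡ true → label i x ≡ c
    label-of-foot i c x on = label-at i c (subst (λ L → inc L _ ≡ true) (par-meet i on (par-∋ i x)) (par-∋ i _))

    row : ∀ r c → label zero (point r c) ≡ r
    row r c = label-of-foot zero r _ (proj₁ (proj₂ (intersection r c)))

    column : ∀ r c → label (suc zero) (point r c) ≡ c
    column r c = label-of-foot (suc zero) c _ (proj₂ (proj₂ (intersection r c)))

    class-of : ∀ L → ∃[ i ] Parallel L (ℓ i)
    class-of L with parallel-exists L o
    ... | M , oM , p = Pencil.index M oM , subst (Parallel L) (sym (Pencil.elem-index M oM)) (parallel-sym p)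

    label-cong : ∀ i {x y} → par i x ≡ par i y → label i x ≡ label i y
    label-cong i {x} {y} e = label-at i (label i y)
        (subst₂ (λ L w → inc L w ≡ true) (sym e) (sym (label-elem i y)) (proj₁ (proj₂ (foot i y))))

    adjacent⇒ : ∀ x y → adj G x y ≡ true → ∃[ i ] label i x ≡ label i y
    adjacent⇒ x y xy with through xy
    ... | L , xL , yL with class-of L
    ...   | i , p = i , label-cong i (trans (parallel-unique (par-∋ i x) (par-∥ i x) xL p) (parallel-unique yL p (par-∋ i y) (par-∥ i y)))

  -- For k = μ non-adjacent vertices have the same neighbours.
  multipartite : ∀ {v} (G : Graph v) {k l μ} → IsSRG G k l μ → k ≡ μ → ∀ {c} → v ≡ k + c → IsCompleteMultipartite G
  multipartite {v} G {k} {l} {μ} srg k≡μ {c} v≡ = number , c , record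
      { to      = λ x → class-index x , position x
      ; from    = λ { (d , i) → Enumeration.elem (members d) i }
      ; from-to = λ x → Enumeration.elem-index (members (class-index x)) x _
      ; to-from = λ { (d , i) → to-from d i }
      ; adj→R   = λ x y xy e → true≢false xy (twin-adj
          (twin-trans (class-twin x) (twin-sym (subst (λ d → twin y (rep d) ≡ true) (sym e) (class-twin y)))))
      ; R→adj   = λ x y ≢ → adjacent x y ≢
      }
    where
    open IsSRG srg
    twin : Fin v → Fin v → Bool
    twin x y = not (adj G x y)
    twin-adj : ∀ {x y} → twin x y ≡ true → adj G x y ≡ false
    twin-adj = not-elim
    twin-sym : ∀ {x y} → twin x y ≡ true → twin y x ≡ true
    twin-sym {x} {y} e = trans (cong not (adj-sym G y x)) e
    same-neighbours : ∀ {x y} → twin x y ≡ true → ∀ w → adj G x w ≡ true → adj G y w ≡ true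
    same-neighbours {x} {y} e w xw with x ≟ᶠ y
    ... | yes refl = xw
    ... | no x≢y = proj₂ (∧-elim {adj G x w} (subset-full (λ w → adj G x w ∧ adj G y w) (adj G x) (λ w e → proj₁ (∧-elim {adj G x w} e))
            (≤-reflexive (trans (regular x) (trans k≡μ (sym (nonEdgeParam x y x≢y (twin-adj e)))))) w xw))
    twin-trans : ∀ {x y z} → twin x y ≡ true → twin y z ≡ true → twin x z ≡ true
    twin-trans {x} {y} {z} p q with bool (adj G x z)
    ... | inj₂ f = not-intro f
    ... | inj₁ t = ⊥-elim (true≢false (same-neighbours p z t) (twin-adj q))
    twin-refl : ∀ x → twin x x ≡ true
    twin-refl x = not-intro (irrefl G x)
    classes : Representatives twin
    classes = representatives twin (λ x y → twin-sym)
    open Representatives classes using (number; rep; separated; class)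
    class-index : Fin v → Fin number
    class-index x = proj₁ (class x (twin-refl x))
    class-twin : ∀ x → twin x (rep (class-index x)) ≡ true
    class-twin x = proj₂ (class x (twin-refl x))
    class-size : ∀ x → count (twin x) ≡ c
    class-size x = +-cancelˡ-≡ k _ _ (trans (cong (_+ count (twin x)) (sym (regular x)))
      (trans (sym (count-split (λ _ → true) (adj G x))) (trans (count-full v) v≡)))
    members : ∀ d → Enumeration (twin (rep d)) c
    members d = enumerate (twin (rep d)) (class-size (rep d))
    position : ∀ x → Fin c
    position x = Enumeration.index (members (class-index x)) x (twin-sym (class-twin x))
    to-from : ∀ d i → (class-index (Enumeration.elem (members d) i) , position (Enumeration.elem (members d) i)) ≡ (d , i)
    -- The type of `position` depends on `class-index`, so the lemma generalises over the class and
    -- the membership proof before the class is identified with d.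
    to-from d i = lemma (class-index x) (separated _ _
        (twin-trans (twin-sym (class-twin x)) (twin-sym (Enumeration.elem-in (members d) i)))) (twin-sym (class-twin x))
      where
      x = Enumeration.elem (members d) i
      lemma : ∀ d′ → d′ ≡ d → (p : twin (rep d′) x ≡ true) → (d′ , Enumeration.index (members d′) x p) ≡ (d , i)
      lemma _ refl p = cong (d ,_) (Enumeration.index-elem (members d) i p)
    adjacent : ∀ x y → class-index x ≢ class-index y → adj G x y ≡ true
    adjacent x y ≢ with bool (adj G x y)
    ... | inj₁ t = t
    ... | inj₂ f = ⊥-elim (≢ (separated _ _ (twin-trans (twin-sym (class-twin x)) (twin-trans (not-intro f) (class-twin y)))))

-- From lines of nearly constant size to a partial geometry.

module GeometricCase (F : OrderedField) where
  open import Data.Nat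
  open import Data.Nat.Properties
  open import Data.Nat.Tactic.RingSolver using (solve-∀)
  open FiniteCounting
  open Arithmetic
  open ClawBounds
  open LineConstruction
  open PartialGeometries
  open Coordinates
  open Incidence F

  module Regularity {v} (G : Graph v) {k k′ l μ} (srg : IsSRG G k l μ) (params : Parameters v k k′ l μ) (r n : ℕ)
           (k≡ : k ≡ r * suc n + μ) (l≡ : l + suc n ≡ μ + r) (r-large : 17 * (suc n * suc n) * μ ≤ r)
           (S : LinearSpace G) (size-lower : ∀ L → suc (suc l) ≤ LinearSpace.size S L + n * μ) (size-upper : ∀ L → LinearSpace.size S L ≤ suc (suc l)) where
    open Parameters params
    open IsSRG srg
    private
      module Base = Eigenvalues params r n k≡ l≡
      module Claws = Cliques G srg r n k≡ l≡ 1≤μ Base.1≤n r-large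
    open Base using (m; 1≤n)
    open ≤-Reasoning

    open LinearSpace S
    private module Counts = Counting G srg S

    -- A line has at least l + 2 - n μ and at most l + 2 points, so its t lines cover the k
    -- neighbours of x almost without loss: `few-cliques` excludes t ≤ n and `many-cliques` excludes
    -- t ≥ m + 1.
    m-lines : ∀ x → degree-of x ≡ m
    m-lines x = ≤-antisym (≮⇒≥ not-more) (≮⇒≥ not-fewer)
      where
      t = degree-of x
      upper : k + t ≤ t * suc l + t
      upper = ≤-trans (Counts.flags-upper (suc (suc l)) size-upper x) (≤-reflexive (trans (*-suc t (suc l)) (+-comm t _)))
      lower : t * suc l ≤ k + t * (n * μ)
      lower = +-cancelˡ-≤ t _ _ (begin
        t + t * suc l               ≡⟨ sym (*-suc t (suc l)) ⟩
        t * suc (suc l)             ≤⟨ Counts.flags-lower (suc (suc l)) (n * μ) size-lower x ⟩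
        k + t + t * (n * μ)         ≡⟨ e k t (t * (n * μ)) ⟩
        t + (k + t * (n * μ))       ∎)
        where
        e : ∀ k t c → k + t + c ≡ t + (k + c)
        e = solve-∀
      not-fewer : ¬ t < m
      not-fewer (s≤s t≤n) = <⇒≱ Claws.few-cliques (≤-trans (+-cancelʳ-≤ t _ _ upper) (*-monoˡ-≤ (suc l) t≤n))
      slack : suc m * (n * μ) ≤ suc m * suc m * μ
      slack = ≤-trans (≤-reflexive (sym (*-assoc (suc m) n μ))) (*-monoˡ-≤ μ (*-monoʳ-≤ (suc m) (≤-trans (n≤1+n n) (n≤1+n m))))
      not-more : ¬ m < t
      not-more m<t with ≤-total (n * μ) (suc l)
      -- If l + 1 ≤ n μ, the slack alone bounds (m + 1)(l + 1); in the other case the truncated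
      -- subtraction in `rest` is exact.
      ... | inj₂ small = Claws.many-cliques (≤-trans (≤-trans (*-monoʳ-≤ (suc m) small) slack) (m≤n+m _ k))
      ... | inj₁ nμ≤ = Claws.many-cliques (begin
          suc m * suc l                     ≡⟨ cong (suc m *_) (sym (m+[n∸m]≡n nμ≤)) ⟩
          suc m * (n * μ + rest)            ≡⟨ *-distribˡ-+ (suc m) (n * μ) rest ⟩
          suc m * (n * μ) + suc m * rest    ≤⟨ +-mono-≤ slack (≤-trans (*-monoˡ-≤ rest m<t) t*rest≤k) ⟩
          suc m * suc m * μ + k             ≡⟨ +-comm _ k ⟩
          k + suc m * suc m * μ             ∎)
        where
        rest = suc l ∸ n * μ
        t*rest≤k : t * rest ≤ k
        t*rest≤k = +-cancelˡ-≤ (t * (n * μ)) _ _ (begin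
          t * (n * μ) + t * rest   ≡⟨ sym (*-distribˡ-+ t (n * μ) rest) ⟩
          t * (n * μ + rest)       ≡⟨ cong (t *_) (m+[n∸m]≡n nμ≤) ⟩
          t * suc l                ≤⟨ lower ⟩
          k + t * (n * μ)          ≡⟨ +-comm k _ ⟩
          t * (n * μ) + k          ∎)

    private
      module Regular = Counts.Regular r m k≡ l≡ m-lines

      c₁ = proj₁ notEmpty
      L₀ : Fin b
      L₀ = proj₁ (through (proj₂ (proj₂ notEmpty)))

    size-determined : ∀ L → (suc k′ + r) * size L ≡ v * suc r
    size-determined L = +-cancelˡ-≡ (k * size L) _ _ (begin-equality
      k * size L + (suc k′ + r) * size L   ≡⟨ e k k′ r (size L) ⟩
      suc (k + k′) * size L + r * size L   ≡⟨ cong (λ z → z * size L + r * size L) (sym v≡) ⟩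
      v * size L + r * size L              ≡⟨ sym (Regular.size-equation L) ⟩
      v * suc r + k * size L               ≡⟨ +-comm _ (k * size L) ⟩
      k * size L + v * suc r               ∎)
      where
      e : ∀ k k′ r c → k * c + (suc k′ + r) * c ≡ suc (k + k′) * c + r * c
      e = solve-∀

    -- By `K≡T+r` the subtraction is not truncated, and by `on-line-T` the number T counts the
    -- neighbours on L of a point off L.
    K T : ℕ
    K = pred (size L₀)
    T = K ∸ r

    size-K : ∀ L → size L ≡ suc K
    size-K L = trans (*-cancelˡ-≡ (size L) (size L₀) (suc k′ + r) (trans (size-determined L) (sym (size-determined L₀))))
      (sym (suc-pred (size L₀) {{>-nonZero (≤-trans (s≤s z≤n) (two-members (inc L₀) xL yL x≢y))}}))
      where
      x≢y = proj₁ (proj₂ (proj₂ (two-points L₀)))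
      xL = proj₁ (proj₂ (proj₂ (proj₂ (two-points L₀))))
      yL = proj₂ (proj₂ (proj₂ (proj₂ (two-points L₀))))

    k≡mK : k ≡ m * K
    k≡mK = +-cancelʳ-≡ m _ _ (begin-equality
      k + m              ≡⟨ cong (k +_) (sym (m-lines c₁)) ⟩
      k + degree-of c₁   ≡⟨ ≤-antisym (Counts.flags-upper (suc K) (λ L → ≤-reflexive (size-K L)) c₁)
                              (≤-trans (Counts.flags-lower (suc K) 0 (λ L → ≤-reflexive (sym (trans (+-identityʳ _) (size-K L)))) c₁)
                                (≤-reflexive (trans (cong (k + degree-of c₁ +_) (*-zeroʳ (degree-of c₁))) (+-identityʳ _)))) ⟩
      degree-of c₁ * suc K ≡⟨ cong (_* suc K) (m-lines c₁) ⟩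
      m * suc K          ≡⟨ trans (*-suc m K) (+-comm m (m * K)) ⟩
      m * K + m          ∎)

    K≡T+r : K ≡ T + r
    K≡T+r = sym (m∸n+n≡m (*-cancelˡ-≤ m (begin
      m * r        ≡⟨ *-comm m r ⟩
      r * m        ≤⟨ m≤m+n (r * m) μ ⟩
      r * m + μ    ≡⟨ trans (sym k≡) k≡mK ⟩
      m * K        ∎)))

    μ≡mT : μ ≡ m * T
    μ≡mT = +-cancelʳ-≡ (m * r) _ _ (begin-equality
      μ + m * r        ≡⟨ trans (+-comm μ _) (cong (_+ μ) (*-comm m r)) ⟩
      r * m + μ        ≡⟨ trans (sym k≡) k≡mK ⟩
      m * K            ≡⟨ cong (m *_) K≡T+r ⟩
      m * (T + r)      ≡⟨ *-distribˡ-+ m T r ⟩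
      m * T + m * r    ∎)

    1≤T : 1 ≤ T
    1≤T = n≢0⇒n>0 λ T≡0 → <-irrefl (sym (trans μ≡mT (trans (cong (m *_) T≡0) (*-zeroʳ m)))) 1≤μ

    on-line-T : ∀ L x → inc L x ≡ false → on-line x L ≡ T
    on-line-T L x x∉L = +-cancelʳ-≡ r _ _ (suc-injective (begin-equality
      suc (on-line x L + r)               ≡⟨ Regular.on-line-any L x ⟩
      size L + r * Regular.bit (inc L x)  ≡⟨ cong₂ (λ s z → s + r * Regular.bit z) (size-K L) x∉L ⟩
      suc K + r * 0                       ≡⟨ trans (cong (suc K +_) (*-zeroʳ r)) (+-identityʳ _) ⟩
      suc K                               ≡⟨ cong suc K≡T+r ⟩
      suc (T + r)                         ∎))

    partial-geometry : PartialGeometry G m K T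
    partial-geometry = record
      { space = S ; deg = m-lines ; size≡ = size-K
      ; crossing = λ L x x∉L → trans (Counts.crossing L x x∉L) (on-line-T L x x∉L) }

    T≤m : T ≤ m
    T≤m with notComplete
    ... | x , y , x≢y , xy with count-inhabited (adj G x) (subst (1 ≤_) (sym (regular x)) 1≤k)
    ...   | z , xz with through xz
    ...     | L , xL , _ = begin
        T                                      ≡⟨ sym (PartialGeometry.crossing partial-geometry L y y∉L) ⟩
        count (λ M → inc M y ∧ meets M L)      ≤⟨ count-mono _ _ (λ M e → proj₁ (∧-elim {inc M y} e)) ⟩
        degree-of y                            ≡⟨ m-lines y ⟩
        m                                      ∎
      where
      y∉L : inc L y ≡ false
      y∉L with bool (inc L y)
      ... | inj₁ yL = ⊥-elim (true≢false (clique L xL yL x≢y) xy)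
      ... | inj₂ f  = f

    private
      as-steiner : ∀ {T} → T ≡ m → PartialGeometry G m K T → IsSteinerGraph G
      as-steiner refl = steiner (s≤s 1≤n)

      as-latin : ∀ {n T} → 1 ≤ n → T ≡ n → PartialGeometry G (suc n) K T → IsLatinSquareGraph G
      as-latin {suc t} _ refl PG = latin PG c₁

    not-exceptional : (∀ a → n ≡ T + a → ¬ 1 ≤ a) → IsLatinSquareGraph G ⊎ IsSteinerGraph G
    not-exceptional no-deficiency with T ≟ m | T ≟ n
    ... | yes T≡m | _       = inj₂ (as-steiner T≡m partial-geometry)
    ... | no _    | yes T≡n = inj₁ (as-latin 1≤n T≡n partial-geometry)
    ... | no T≢m  | no T≢n  = ⊥-elim (no-deficiency (n ∸ T) (sym (m+[n∸m]≡n (<⇒≤ T<n))) (m<n⇒0<n∸m T<n))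
      where
      T<n : T < n
      T<n = ≤∧≢⇒< (≤-pred (≤∧≢⇒< T≤m T≢m)) T≢n

  module _ {v} (G : Graph v) {k k′ l μ} (srg : IsSRG G k l μ) (params : Parameters v k k′ l μ) (r n : ℕ)
           (k≡ : k ≡ r * suc n + μ) (l≡ : l + suc n ≡ μ + r) (r-large : 17 * (suc n * suc n) * μ ≤ r) where
    private
      module Claws = Cliques G srg r n k≡ l≡ (Parameters.1≤μ params) (Eigenvalues.1≤n params r n k≡ l≡) r-large
      module Col = Collinearity G srg r n k≡ l≡ (Parameters.1≤μ params) (Eigenvalues.1≤n params r n k≡ l≡) r-large

    line-space : LinearSpace G
    line-space = record
      { b = Representatives.number Col.lines ; inc = Col.inc ; clique = Col.line-clique ; through = Col.line-through
      ; unique-line = Col.line-unique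
      ; two-points = λ L → Col.end₁ L , Col.end₂ L , Claws.a-≢ (Col.ends-adjacent L) ,
          Col.off {Col.end₁ L} {Col.end₂ L} Col.left , Col.off {Col.end₁ L} {Col.end₂ L} Col.right
      }

    latin-or-steiner : (∀ K T a → k ≡ suc n * K → K ≡ T + r → μ ≡ suc n * T → n ≡ T + a → 1 ≤ T → ¬ 1 ≤ a) →
      IsLatinSquareGraph G ⊎ IsSteinerGraph G
    latin-or-steiner bound = Geo.not-exceptional λ a n≡ → bound Geo.K Geo.T a Geo.k≡mK Geo.K≡T+r Geo.μ≡mT n≡ Geo.1≤T
      where module Geo = Regularity G srg params r n k≡ l≡ r-large line-space Col.line-size-lower Col.line-size-upper

-- Reduction to integral eigenvalues or a conference graph.

module Reduction where
  open import Data.Nat as ℕ using (ℕ; zero; suc; z≤n; s≤s)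
  import Data.Nat.Properties as ℕ
  open import Data.Integer as ℤ using (ℤ; -[1+_])
  open FiniteCounting
  open Arithmetic
  open Coordinates using (multipartite)

  module _ {v} (G : Graph v) {k l μ} (srg : IsSRG G k l μ) (connected : Connected G) where
    open IsSRG srg

    private
      x₀ y₀ : Fin v
      x₀ = proj₁ notComplete
      y₀ = proj₁ (proj₂ notComplete)
      x₀≢y₀ = proj₁ (proj₂ (proj₂ notComplete))
      x₀y₀ = proj₂ (proj₂ (proj₂ notComplete))

    -- Without common neighbours of non-adjacent vertices, adjacency would be transitive.
    0<μ : 1 ℕ.≤ μ
    0<μ = ℕ.n≢0⇒n>0 λ μ≡0 → disconnected μ≡0 (near μ≡0 (connected x₀ y₀))
      where
      near : μ ≡ 0 → ∀ {i w} → Reach G i w → i ≡ w ⊎ adj G i w ≡ true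
      near μ≡0 here = inj₁ refl
      near μ≡0 {i} {w} (step {j = j} ij r) with near μ≡0 r
      ... | inj₁ refl = inj₂ ij
      ... | inj₂ jw with i ≟ᶠ w | bool (adj G i w)
      ...   | yes i≡w | _       = inj₁ i≡w
      ...   | no _    | inj₁ iw = inj₂ iw
      ...   | no i≢w  | inj₂ iw = ⊥-elim (ℕ.<-irrefl (sym (trans (nonEdgeParam i w i≢w iw) μ≡0))
                (inhabited-count (λ u → adj G i u ∧ adj G w u) j (∧-intro ij (trans (adj-sym G w j) jw))))
      disconnected : μ ≡ 0 → x₀ ≡ y₀ ⊎ adj G x₀ y₀ ≡ true → ⊥
      disconnected _ (inj₁ e) = x₀≢y₀ e
      disconnected _ (inj₂ e) = true≢false e x₀y₀

    private
      non-neighbours : Fin v → Bool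
      non-neighbours w = not (adj G x₀ w) ∧ not (x₀ == w)

    co-degree : ℕ
    co-degree = count non-neighbours

    private
      k′ = co-degree

      v≡ : v ≡ suc (k ℕ.+ k′)
      v≡ = begin
        v                                                        ≡⟨ sym (count-full v) ⟩
        count {v} (λ _ → true)                                   ≡⟨ count-split (λ _ → true) (adj G x₀) ⟩
        count (adj G x₀) ℕ.+ count (λ w → not (adj G x₀ w))
            ≡⟨ cong₂ ℕ._+_ (regular x₀) (count-split (λ w → not (adj G x₀ w)) (x₀ ==_)) ⟩
        k ℕ.+ (count (λ w → not (adj G x₀ w) ∧ (x₀ == w)) ℕ.+ k′)
            ≡⟨ cong (λ c → k ℕ.+ (c ℕ.+ k′)) (trans (count-cong _ (x₀ ==_) itself) (count-== x₀)) ⟩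
        k ℕ.+ suc k′                                             ≡⟨ ℕ.+-suc k k′ ⟩
        suc (k ℕ.+ k′)                                           ∎
        where
        open ≡-Reasoning
        itself : ∀ w → (not (adj G x₀ w) ∧ (x₀ == w)) ≡ (x₀ == w)
        itself w = bool-ext (λ e → proj₂ (∧-elim {not (adj G x₀ w)} e))
          (λ e → ∧-intro (not-intro (subst (λ z → adj G x₀ z ≡ false) (==⇒≡ e) (irrefl G x₀))) e)

    μ≤k : μ ℕ.≤ k
    μ≤k = subst₂ ℕ._≤_ (nonEdgeParam x₀ y₀ x₀≢y₀ x₀y₀) (regular x₀) (count-mono _ _ λ w e → proj₁ (∧-elim {adj G x₀ w} e))

    -- The identity for k² is pulled back from the field, where row sums of A² were computed; this
    -- is why F occurs in a statement about natural numbers.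
    srg-parameters : (F : OrderedField) → Parameters v k k′ l μ
    srg-parameters F = record
      { v≡   = v≡
      ; k²≡  = fromℕ-injective (begin
          fromℕ (k ℕ.* k)                          ≡⟨ fromℕ-* k k ⟩
          K * K                                    ≡⟨ parameters x₀ ⟩
          (K - M) + (L - M) * K + V * M            ≡⟨ cong (λ z → (K - M) + (L - M) * K + z * M)
              (trans (cong fromℕ v≡) (cong (1# +_) (fromℕ-+ k k′))) ⟩
          (K - M) + (L - M) * K + (1# + (K + fromℕ k′)) * M
            ≡⟨ solve 4 (λ k l m k′ → (k :- m) :+ (l :- m) :* k :+ (:1 :+ (k :+ k′)) :* m := k :+ l :* k :+ m :* k′) refl K L M (fromℕ k′) ⟩
          K + L * K + M * fromℕ k′                 ≡⟨ sym
              (trans (fromℕ-+ (k ℕ.+ l ℕ.* k) _) (cong₂ _+_ (trans (fromℕ-+ k _) (cong (K +_) (fromℕ-* l k))) (fromℕ-* μ k′))) ⟩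
          fromℕ (k ℕ.+ l ℕ.* k ℕ.+ μ ℕ.* k′)       ∎)
      ; 1≤μ  = 0<μ
      ; 1≤k  = let (i , j , ij) = notEmpty in subst (1 ℕ.≤_) (regular i) (inhabited-count (adj G i) j ij)
      ; 1≤k′ = inhabited-count non-neighbours y₀ (∧-intro (not-intro x₀y₀) (not-intro (≢⇒== x₀≢y₀)))
      }
      where
      open FieldProperties F
      open Spectrum F
      open AdjacencyAlgebra G srg
      open ≡-Reasoning

  module _ (F : OrderedField) where
    open FieldProperties F
    open Idempotents F
    open Spectrum F

    ≰⇒< : ∀ {x y} → ¬ (y ≤ x) → x ≤ y × x ≢ y
    ≰⇒< {x} {y} y≰x with total x y
    ... | inj₁ x≤y = x≤y , λ x≡y → y≰x (≤-reflexive (sym x≡y))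
    ... | inj₂ y≤x = ⊥-elim (y≰x y≤x)

    ^-nonneg : ∀ {x} n → 0# ≤ x → 0# ≤ x ^ n
    ^-nonneg zero    p = 0≤1
    ^-nonneg (suc n) p = *-pos _ _ p (^-nonneg n p)

    *-mono-≤ : ∀ {a b c d} → 0# ≤ a → 0# ≤ d → a ≤ b → c ≤ d → a * c ≤ b * d
    *-mono-≤ {a} {b} {c} {d} p q a≤b c≤d = nonneg-diff (subst (0# ≤_)
      (solve 4 (λ a b c d → (b :- a) :* d :+ a :* (d :- c) := b :* d :- a :* c) refl a b c d)
      (0≤+ (*-pos _ _ (diff-nonneg a≤b) q) (*-pos _ _ p (diff-nonneg c≤d))))

    ^-mono-≤ : ∀ {x y} n → 0# ≤ x → x ≤ y → x ^ n ≤ y ^ n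
    ^-mono-≤ zero    p q = ≤-refl
    ^-mono-≤ (suc n) p q = *-mono-≤ p (^-nonneg n (≤-trans p q)) q (^-mono-≤ n p q)

    neg-^10 : ∀ x → (- x) ^ 10 ≡ x ^ 10
    neg-^10 x = solve 1 (λ x → let y = :- x in
        y :* (y :* (y :* (y :* (y :* (y :* (y :* (y :* (y :* (y :* :1))))))))) :=
        x :* (x :* (x :* (x :* (x :* (x :* (x :* (x :* (x :* (x :* :1)))))))))) refl x

    sq-^5 : ∀ x → x ^ 10 ≡ (x * x) ^ 5
    sq-^5 x = solve 1 (λ x → let y = x :* x in
        x :* (x :* (x :* (x :* (x :* (x :* (x :* (x :* (x :* (x :* :1))))))))) :=
        y :* (y :* (y :* (y :* (y :* :1))))) refl x

    -- 12μ - 3θ² = (θ + 2)² + 8μ - 4.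
    conference-eigenvalue : ∀ {θ μ} → fromℕ 1 ≤ μ → θ * θ ≡ - 1# * θ + μ → θ * θ ≤ fromℕ 4 * μ
    conference-eigenvalue {θ} {μ} 1≤μ θ² = ≤-*-cancelˡ {c = fromℕ 3} (0≤fromℕ 3) (fromℕ-suc≢0 2) (nonneg-diff (subst (0# ≤_) identity
        (0≤+ (0≤sq (θ + (1# + 1#))) (0≤+ (0≤fromℕ 4) (*-pos _ _ (0≤fromℕ 8) (diff-nonneg 1≤μ))))))
      where
      identity : (θ + (1# + 1#)) * (θ + (1# + 1#)) + (fromℕ 4 + fromℕ 8 * (μ - fromℕ 1)) ≡ fromℕ 3 * (fromℕ 4 * μ) - fromℕ 3 * (θ * θ)
      identity = by₁ (fromℕ 4) (solve 2 (λ t m →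
          ((t :+ (:1 :+ :1)) :* (t :+ (:1 :+ :1)) :+ (con (ℤ.+ 4) :+ con (ℤ.+ 8) :* (m :- (:1 :+ :0)))) :-
              (con (ℤ.+ 3) :* (con (ℤ.+ 4) :* m) :- con (ℤ.+ 3) :* (t :* t)) :=
          con (ℤ.+ 4) :* (t :* t :- ((:- :1) :* t :+ m))) refl θ μ) θ²

    fromℕ-difference≢0 : ∀ {x y} → y ℕ.< x → fromℕ x - fromℕ y ≢ 0#
    fromℕ-difference≢0 y<x e = ℕ.<-irrefl (sym (fromℕ-injective (cancel-diff e))) y<x

    module BadEigenvalue {v} (G : Graph v) {k l μ} (srg : IsSRG G k l μ) (exceptional : Exceptional G) (θ : Carrier)
             (eigenvalue : IsEigenvalue F G θ) (θ≢k : θ ≢ fromℕ k) (bad : fromℕ ((2 ℕ.* k) ℕ.^ 10) ≤ fromℕ v * θ ^ 10) where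
      open AdjacencyAlgebra G srg
      private
        connected = proj₁ exceptional
        k′ = co-degree G srg connected
        params = srg-parameters G srg connected F
      open Parameters params

      private
        not-multipartite = proj₁ (proj₂ exceptional)
        not-latin   = proj₁ (proj₂ (proj₂ exceptional))
        not-steiner = proj₂ (proj₂ (proj₂ exceptional))

        e h : ℤ
        e = ℤ.+ l ℤ.- ℤ.+ μ
        h = ℤ.+ k ℤ.- ℤ.+ μ

        fromℤ-- : ∀ a b → fromℤ (a ℤ.- b) ≡ fromℤ a - fromℤ b
        fromℤ-- a b = trans (fromℤ-+ a (ℤ.- b)) (cong (fromℤ a +_) (fromℤ-neg b))

        1≤2k^10 : 1 ℕ.≤ (2 ℕ.* k) ℕ.^ 10
        1≤2k^10 = ℕ.m^n>0 (2 ℕ.* k) {{ℕ.>-nonZero (ℕ.*-mono-≤ {1} {2} (s≤s z≤n) 1≤k)}} 10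

        θ≢0 : θ ≢ 0#
        θ≢0 refl = ℕ.<⇒≱ 1≤2k^10 (fromℕ-cancel-≤ (subst (fromℕ ((2 ℕ.* k) ℕ.^ 10) ≤_)
          (trans (cong (V *_) (zeroˡ (0# ^ 9))) (zeroʳ V)) bad))

        K≢0 : K ≢ 0#
        K≢0 p = ℕ.<-irrefl (sym (fromℕ-injective {n = 0} p)) 1≤k

        K′≢0 : fromℕ k′ ≢ 0#
        K′≢0 p = ℕ.<-irrefl (sym (fromℕ-injective {n = 0} p)) 1≤k′

        V≢0 : V ≢ 0#
        V≢0 p = ℕ.<-irrefl (sym (fromℕ-injective {n = 0} p)) (ℕ.≤-trans (s≤s z≤n) 2≤v)

        x₀ = proj₁ (IsSRG.notEmpty srg)

        θ² : θ * θ ≡ (L - M) * θ + (K - M)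
        θ² = eigenvalue-equation θ eigenvalue θ≢k

        σ : Carrier
        σ = (L - M) - θ

        θ+σ : θ + σ ≡ L - M
        θ+σ = solve 2 (λ t x → t :+ (x :- t) := x) refl θ (L - M)

        θσ : θ * σ ≡ M - K
        θσ = by₁ (- 1#) (solve 4 (λ t x m k → t :* (x :- t) :- (m :- k) := (:- :1) :* (t :* t :- (x :* t :+ (k :- m)))) refl θ
            (L - M) M K) θ²

        -- A double root would satisfy θ² = θ σ = μ - k ≤ 0, hence vanish.
        θ-σ≢0 : θ - σ ≢ 0#
        θ-σ≢0 p = sq≡0⇒≡0 (≤-antisym (subst₂ _≤_ (sym θθ) (-‿inverseʳ K) (+-mono M K (- K) (fromℕ-mono-≤ (μ≤k G srg connected))))
            (0≤sq θ)) θ≢0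
          where
          θθ : θ * θ ≡ M - K
          θθ = trans (cong (θ *_) (cancel-diff p)) θσ

        u  = proj₁ (inverse V V≢0)
        Vu = proj₂ (inverse V V≢0)
        d  = proj₁ (inverse (θ - σ) θ-σ≢0)
        dd : d * (θ - σ) ≡ 1#
        dd = trans (*-comm d (θ - σ)) (proj₂ (inverse (θ - σ) θ-σ≢0))

        module P = Pair x₀ u Vu θ σ d θ+σ θσ dd k′ v≡

      module Multiplicities (f g : ℕ) (trθ : trace P.Eθ ≡ fromℕ f) (trσ : trace P.Eσ ≡ fromℕ g) where
        v≡fg : v ≡ suc (f ℕ.+ g)
        v≡fg = fromℕ-injective (trans (sym P.trace-sum) (trans (cong₂ (λ x y → x + y + 1#) trθ trσ)
          (trans (+-comm _ 1#) (cong (1# +_) (sym (fromℕ-+ f g))))))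

        traces : θ * fromℕ f + σ * fromℕ g + K ≡ 0#
        traces = trans (cong₂ (λ x y → θ * x + σ * y + K) (sym trθ) (sym trσ)) P.trace-adjacency

        absolute : P.bracket ≢ 0# → g ℕ.≤ f ℕ.* f
        absolute b≢0 = fromℕ-cancel-≤ (subst₂ _≤_ trσ (trans (cong₂ _*_ trθ trθ) (sym (fromℕ-* f f))) (P.absolute-bound K≢0 K′≢0 b≢0))

        ℕ-bad : ∀ c → θ ^ 10 ≡ fromℕ c ^ 10 → (2 ℕ.* k) ℕ.^ 10 ℕ.≤ v ℕ.* c ℕ.^ 10
        ℕ-bad c θ≡ = fromℕ-cancel-≤ (subst (fromℕ ((2 ℕ.* k) ℕ.^ 10) ≤_)
          (trans (cong (V *_) (trans θ≡ (sym (fromℕ-^ c 10)))) (sym (fromℕ-* v (c ℕ.^ 10)))) bad)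

        module Integral (r n : ℕ) (k≡ : k ≡ r ℕ.* suc n ℕ.+ μ) (l≡ : l ℕ.+ suc n ≡ μ ℕ.+ r) where
          m = suc n
          r′ m′ n′ K′ : Carrier
          r′ = fromℕ r
          m′ = fromℕ m
          n′ = fromℕ n
          K′ = fromℕ k′
          open Eigenvalues params r n k≡ l≡ hiding (m)

          fromℕ-bracket : ∀ a b c d → fromℕ (a ℕ.* b ℕ.* c ℕ.* (d ℕ.* d)) ≡ (fromℕ a * fromℕ b * fromℕ c) * (fromℕ d * fromℕ d)
          fromℕ-bracket a b c d = trans (fromℕ-* (a ℕ.* b ℕ.* c) (d ℕ.* d))
              (cong₂ _*_ (trans (fromℕ-* (a ℕ.* b) c) (cong (_* fromℕ c) (fromℕ-* a b))) (fromℕ-* d d))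

          fromℕ-bracket₂ : ∀ a b c d → fromℕ ((k ℕ.* k) ℕ.* (k′ ℕ.* k′) ℕ.+ a ℕ.* b ℕ.* c ℕ.* (d ℕ.* d)) ≡
            (K * K) * (K′ * K′) + (fromℕ a * fromℕ b * fromℕ c) * (fromℕ d * fromℕ d)
          fromℕ-bracket₂ a b c d = trans (fromℕ-+ ((k ℕ.* k) ℕ.* (k′ ℕ.* k′)) (a ℕ.* b ℕ.* c ℕ.* (d ℕ.* d)))
            (cong₂ _+_ (trans (fromℕ-* (k ℕ.* k) (k′ ℕ.* k′)) (cong₂ _*_ (fromℕ-* k k) (fromℕ-* k′ k′))) (fromℕ-bracket a b c d))

          positive : θ ≡ r′ → σ ≡ - m′ → ⊥
          positive θ≡ σ≡ = not-both (GeometricCase.latin-or-steiner F G srg params r n k≡ l≡ r-large partial-geometry-bound)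
            where
            not-both : ¬ (IsLatinSquareGraph G ⊎ IsSteinerGraph G)
            not-both (inj₁ x) = not-latin x
            not-both (inj₂ x) = not-steiner x
            1≤r : 1 ℕ.≤ r
            1≤r = ℕ.n≢0⇒n>0 λ r≡0 → θ≢0 (trans θ≡ (cong fromℕ r≡0))
            tr : f ℕ.* r ℕ.+ k ≡ g ℕ.* m
            tr = fromℕ-injective (trans (trans (fromℕ-+ (f ℕ.* r) k) (cong (_+ K) (fromℕ-* f r)))
              (trans (by₁ 1# (solve 5 (λ f r k g m → (f :* r :+ k) :- g :* m := :1 :* ((r :* f :+ (:- m) :* g :+ k) :- :0)) refl
                  (fromℕ f) r′ K (fromℕ g) m′)
                (trans (cong₂ (λ x y → x * fromℕ f + y * fromℕ g + K) (sym θ≡) (sym σ≡)) traces)) (sym (fromℕ-* g m))))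
            b≢0 : P.bracket ≢ 0#
            b≢0 p = fromℕ-difference≢0 rm-bracket (trans (cong₂ _-_ (fromℕ-bracket₂ (suc r) (suc r) n k) (fromℕ-bracket r r m k′))
              (trans (trans (solve 4 (λ k k′ r n → (k :* k) :* (k′ :* k′) :+ ((:1 :+ r) :* (:1 :+ r) :* n) :* (k :* k) :-
                  (r :* r :* (:1 :+ n)) :* (k′ :* k′) :=
                 (k :* k) :* (k′ :* k′) :+ (r :* r :* (:- (:1 :+ n))) :* (k′ :* k′) :-
                     ((:1 :+ r) :* (:1 :+ r) :* (:1 :+ (:- (:1 :+ n)))) :* (k :* k)) refl K K′ r′ n′)
                 (cong₂ (λ t s → (K * K) * (K′ * K′) + (t * t * s) * (K′ * K′) - ((1# + t) * (1# + t) * (1# + s)) * (K * K))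
                     (sym θ≡) (sym σ≡))) p))
            open RLarge {f} {g} 1≤r v≡fg tr (absolute b≢0) (ℕ-bad r (cong (_^ 10) θ≡))

          negative : θ ≡ - m′ → σ ≡ r′ → ⊥
          negative θ≡ σ≡ with 1 ℕ.≤? r
          -- r = 0 means k = μ. Each part consists of a vertex and its k′ non-neighbours.
          ... | no r<1 = not-multipartite (multipartite G srg k≡μ (trans v≡ (sym (ℕ.+-suc k k′))))
            where
            k≡μ : k ≡ μ
            k≡μ = trans k≡ (cong (λ z → z ℕ.* suc n ℕ.+ μ) (ℕ.n<1⇒n≡0 (ℕ.≰⇒> r<1)))
          ... | yes 1≤r = m-not-large {f} {g} 1≤r v≡fg tr (absolute b≢0) kr (ℕ-bad m (trans (cong (_^ 10) θ≡) (neg-^10 m′)))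
            where
            tr : f ℕ.* m ≡ g ℕ.* r ℕ.+ k
            tr = fromℕ-injective (trans (fromℕ-* f m)
              (trans (by₁ (- 1#) (solve 5 (λ f r k g m → f :* m :- (g :* r :+ k) := (:- :1) :*
                  (((:- m) :* f :+ r :* g :+ k) :- :0)) refl (fromℕ f) r′ K (fromℕ g) m′)
                (trans (cong₂ (λ x y → x * fromℕ f + y * fromℕ g + K) (sym θ≡) (sym σ≡)) traces))
                    (sym (trans (fromℕ-+ (g ℕ.* r) k) (cong (_+ K) (fromℕ-* g r))))))
            b≢0 : P.bracket ≢ 0#
            b≢0 p = fromℕ-difference≢0 (mr-bracket 1≤r) (trans (cong₂ _-_ (fromℕ-bracket₂ m m r k′) (fromℕ-bracket n n (suc r) k))
              (trans (trans (solve 4 (λ k k′ r n → (k :* k) :* (k′ :* k′) :+ ((:1 :+ n) :* (:1 :+ n) :* r) :* (k′ :* k′) :-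
                  (n :* n :* (:1 :+ r)) :* (k :* k) :=
                 (k :* k) :* (k′ :* k′) :+ ((:- (:1 :+ n)) :* (:- (:1 :+ n)) :* r) :* (k′ :* k′) :-
                     ((:1 :+ (:- (:1 :+ n))) :* (:1 :+ (:- (:1 :+ n))) :* (:1 :+ r)) :* (k :* k)) refl K K′ r′ n′)
                 (cong₂ (λ t s → (K * K) * (K′ * K′) + (t * t * s) * (K′ * K′) - ((1# + t) * (1# + t) * (1# + s)) * (K * K))
                     (sym θ≡) (sym σ≡))) p))
            kr : m ℕ.* m ℕ.* m ℕ.* (k′ ℕ.* k′) ℕ.≤ k ℕ.* k ℕ.* (k′ ℕ.* k′) ℕ.+ n ℕ.* n ℕ.* n ℕ.* (k ℕ.* k)
            kr = fromℕ-cancel-≤ (subst₂ _≤_ (sym (fromℕ-bracket m m m k′)) (sym (fromℕ-bracket₂ n n n k))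
              (nonneg-diff (subst (0# ≤_) (trans (cong
                  (λ t → (K * K) * (K′ * K′) + (t * t * t) * (K′ * K′) - ((1# + t) * (1# + t) * (1# + t)) * (K * K)) θ≡)
                (solve 3 (λ k k′ n → (k :* k) :* (k′ :* k′) :+ ((:- (:1 :+ n)) :* (:- (:1 :+ n)) :* (:- (:1 :+ n))) :*
                    (k′ :* k′) :- ((:1 :+ (:- (:1 :+ n))) :* (:1 :+ (:- (:1 :+ n))) :* (:1 :+ (:- (:1 :+ n)))) :* (k :* k) :=
                  ((k :* k) :* (k′ :* k′) :+ (n :* n :* n) :* (k :* k)) :- ((:1 :+ n) :* (:1 :+ n) :* (:1 :+ n)) :* (k′ :* k′))
                      refl K K′ n′))
                (diff-nonneg (P.krein K≢0 K′≢0 f trθ)))))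

        fromℤ-e : fromℤ e ≡ L - M
        fromℤ-e = fromℤ-- (ℤ.+ l) (ℤ.+ μ)

        fromℤ-h : fromℤ h ≡ K - M
        fromℤ-h = fromℤ-- (ℤ.+ k) (ℤ.+ μ)

        integer-case : ∀ c → θ ≡ fromℤ c → ⊥
        integer-case c θ≡ = cases c (e ℤ.- c) θ≡ (trans (cong₂ _-_ (sym fromℤ-e) θ≡) (sym (fromℤ-- e c)))
          where
          equations : ∀ r n → (θ ≡ fromℕ r × σ ≡ - fromℕ (suc n)) ⊎ (θ ≡ - fromℕ (suc n) × σ ≡ fromℕ r) →
            k ≡ r ℕ.* suc n ℕ.+ μ × l ℕ.+ suc n ≡ μ ℕ.+ r
          equations r n roots =
              fromℕ-injective (trans (by₁ 1# (solve 4 (λ k r m μ → k :- (r :* m :+ μ) := :1 :* (r :* (:- m) :- (μ :- k))) refl K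
                  (fromℕ r) (fromℕ (suc n)) M) (product roots))
                (sym (trans (fromℕ-+ (r ℕ.* suc n) μ) (cong (_+ M) (fromℕ-* r (suc n))))))
            , fromℕ-injective (trans (fromℕ-+ l (suc n))
                (trans (by₁ (- 1#) (solve 4 (λ l r m μ → (l :+ m) :- (μ :+ r) := (:- :1) :* ((r :+ (:- m)) :- (l :- μ))) refl L
                (fromℕ r) (fromℕ (suc n)) M) (sum-roots roots))
                (sym (fromℕ-+ μ r))))
            where
            product : _ → fromℕ r * (- fromℕ (suc n)) ≡ M - K
            product (inj₁ (p , q)) = trans (cong₂ _*_ (sym p) (sym q)) θσ
            product (inj₂ (p , q)) = trans (trans (*-comm _ _) (cong₂ _*_ (sym p) (sym q))) θσ
            sum-roots : _ → fromℕ r + (- fromℕ (suc n)) ≡ L - M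
            sum-roots (inj₁ (p , q)) = trans (cong₂ _+_ (sym p) (sym q)) θ+σ
            sum-roots (inj₂ (p , q)) = trans (trans (+-comm _ _) (cong₂ _+_ (sym p) (sym q))) θ+σ
          l<k : l ℕ.< k
          l<k = ℕ.*-cancelʳ-≤ (suc l) k k {{ℕ.>-nonZero 1≤k}} (ℕ.≤-trans (ℕ.m≤m+n _ _) (ℕ.≤-reflexive (sym k²≡)))
          -- The product of two non-negative roots gives k ≤ μ and their sum gives μ ≤ l, against l
          -- < k.
          both-nonneg : ∀ a b → fromℕ a * fromℕ b ≡ M - K → fromℕ a + fromℕ b ≡ L - M → ⊥
          both-nonneg a b p s = ℕ.<⇒≱ l<k (ℕ.≤-trans k≤μ (ℕ.≤-trans (ℕ.m≤n+m μ (a ℕ.+ b)) (ℕ.≤-reflexive a+b+μ)))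
            where
            ab+k : a ℕ.* b ℕ.+ k ≡ μ
            ab+k = fromℕ-injective (trans (fromℕ-+ (a ℕ.* b) k)
                (trans (cong (_+ K) (trans (fromℕ-* a b) p)) (solve 2 (λ m k → m :- k :+ k := m) refl M K)))
            a+b+μ : a ℕ.+ b ℕ.+ μ ≡ l
            a+b+μ = fromℕ-injective (trans (fromℕ-+ (a ℕ.+ b) μ)
                (trans (cong (_+ M) (trans (fromℕ-+ a b) s)) (solve 2 (λ l m → l :- m :+ m := l) refl L M)))
            k≤μ : k ℕ.≤ μ
            k≤μ = ℕ.≤-trans (ℕ.m≤n+m k (a ℕ.* b)) (ℕ.≤-reflexive ab+k)
          cases : ∀ c z → θ ≡ fromℤ c → σ ≡ fromℤ z → ⊥
          cases (ℤ.+ r) -[1+ n ] p q = let (k≡ , l≡) = equations r n (inj₁ (p , q)) in Integral.positive r n k≡ l≡ p q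
          cases -[1+ n ] (ℤ.+ r) p q = let (k≡ , l≡) = equations r n (inj₂ (p , q)) in Integral.negative r n k≡ l≡ p q
          cases (ℤ.+ a) (ℤ.+ b) p q = both-nonneg a b (trans (cong₂ _*_ (sym p) (sym q)) θσ) (trans (cong₂ _+_ (sym p) (sym q)) θ+σ)
          -- Two negative roots have a positive product, so k < μ, against μ ≤ k.
          cases -[1+ a ] -[1+ b ] p q = ℕ.<⇒≱ (ℕ.≤-trans (ℕ.m<n+m k (s≤s z≤n)) (ℕ.≤-reflexive ab+k)) (μ≤k G srg connected)
            where
            ab+k : suc a ℕ.* suc b ℕ.+ k ≡ μ
            ab+k = fromℕ-injective (trans (fromℕ-+ (suc a ℕ.* suc b) k) (trans (cong (_+ K) (trans (fromℕ-* (suc a) (suc b))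
              (trans (solve 2 (λ x y → x :* y := (:- x) :* (:- y)) refl (fromℕ (suc a)) (fromℕ (suc b)))
                  (trans (cong₂ _*_ (sym p) (sym q)) θσ))))
              (solve 2 (λ m k → m :- k :+ k := m) refl M K)))

        conference-case : f ≡ g → f ℕ.* l ℕ.+ k ≡ f ℕ.* μ → ⊥
        conference-case f≡g fl+k = conference-bound μ 1≤μ (subst₂ (λ x y → x ℕ.≤ y ℕ.* (4 ℕ.* μ) ℕ.^ 5) (cong (ℕ._^ 10) 2k≡4μ) v≡4μ+1
            (fromℕ-cancel-≤ (≤-trans bad (subst₂ _≤_ (cong (V *_) (sym (sq-^5 θ)))
              (trans (cong (V *_) (sym (fromℕ-^ (4 ℕ.* μ) 5))) (sym (fromℕ-* v ((4 ℕ.* μ) ℕ.^ 5))))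
              (*-mono-≤ (0≤fromℕ v) (^-nonneg 5 (0≤fromℕ (4 ℕ.* μ))) ≤-refl (^-mono-≤ 5 (0≤sq θ) θ²≤))))))
          where
          facts = conference params f (trans v≡fg (cong (λ z → suc (f ℕ.+ z)) (sym f≡g))) fl+k
          μ≡ = proj₁ facts
          k≡2μ = proj₁ (proj₂ facts)
          v≡4μ+1 = proj₂ (proj₂ facts)
          2k≡4μ : 2 ℕ.* k ≡ 4 ℕ.* μ
          2k≡4μ = trans (cong (2 ℕ.*_) k≡2μ) (sym (ℕ.*-assoc 2 2 μ))
          L-M : L - M ≡ - 1#
          L-M = trans (cong (λ z → L - fromℕ z) μ≡) (solve 1 (λ l → l :- (:1 :+ l) := :- :1) refl L)
          K-M : K - M ≡ M
          K-M = trans (cong (λ z → fromℕ z - M) (trans k≡2μ (cong (μ ℕ.+_) (ℕ.+-identityʳ μ))))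
              (trans (cong (_- M) (fromℕ-+ μ μ)) (solve 1 (λ m → m :+ m :- m := m) refl M))
          θ²≤ : θ * θ ≤ fromℕ (4 ℕ.* μ)
          θ²≤ = subst (θ * θ ≤_) (sym (fromℕ-* 4 μ))
              (conference-eigenvalue (fromℕ-mono-≤ 1≤μ) (trans θ² (cong₂ (λ x y → x * θ + y) L-M K-M)))

        -- After substituting σ = e - θ, the trace equation reads (f - g) θ = -(k + g e). So θ is
        -- rational unless a = 0, and being a root of a monic integral quadratic it is then an
        -- integer.
        a : ℤ
        a = ℤ.+ f ℤ.- ℤ.+ g

        equal : a ≡ ℤ.+ 0 → ⊥
        equal a≡0 = conference-case f≡g (fromℕ-injective (trans (trans (fromℕ-+ (f ℕ.* l) k) (cong (_+ K) (fromℕ-* f l)))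
                (trans (by₁ 1# (solve 4 (λ f l k m → (f :* l :+ k) :- f :* m := :1 :* ((f :* (l :- m) :+ k) :- :0)) refl
                    (fromℕ f) L K M) balanced) (sym (fromℕ-* f μ)))))
          where
          f≡g : f ≡ g
          f≡g = fromℕ-injective (cancel-diff (trans (sym (fromℤ-- (ℤ.+ f) (ℤ.+ g))) (cong fromℤ a≡0)))
          balanced : fromℕ f * (L - M) + K ≡ 0#
          balanced = trans (cong (λ z → fromℕ f * z + K) (sym θ+σ))
              (trans (solve 4 (λ f t s k → f :* (t :+ s) :+ k := t :* f :+ s :* f :+ k) refl (fromℕ f) θ σ K)
            (trans (cong (λ z → θ * fromℕ f + σ * fromℕ z + K) f≡g) traces))

        unequal : a ≢ ℤ.+ 0 → ⊥
        unequal a≢0 = integer-case (proj₁ root) (*-cancelˡ {x = fromℤ a} (λ p → a≢0 (fromℤ-injective {j = ℤ.+ 0} p))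
                (trans aθ (trans (cong fromℤ (proj₂ root)) (trans (fromℤ-* (proj₁ root) a) (*-comm _ _)))))
          where
          b : ℤ
          b = ℤ.- (ℤ.+ k ℤ.+ ℤ.+ g ℤ.* e)
          aθ : fromℤ a * θ ≡ fromℤ b
          aθ = trans (cong (_* θ) (fromℤ-- (ℤ.+ f) (ℤ.+ g)))
              (trans (by₁ 1# (solve 5 (λ f g t x k → (f :- g) :* t :- (:- (k :+ g :* x)) := :1 :*
              ((t :* f :+ (x :- t) :* g :+ k) :- :0)) refl (fromℕ f) (fromℕ g) θ (L - M) K) traces)
            (sym (trans (fromℤ-neg (ℤ.+ k ℤ.+ ℤ.+ g ℤ.* e))
                (cong -_ (trans (fromℤ-+ (ℤ.+ k) (ℤ.+ g ℤ.* e)) (cong (K +_) (trans (fromℤ-* (ℤ.+ g) e) (cong (fromℕ g *_) fromℤ-e))))))))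
          quadratic : b ℤ.* b ≡ e ℤ.* (a ℤ.* b) ℤ.+ h ℤ.* (a ℤ.* a)
          quadratic = fromℤ-injective (trans (fromℤ-* b b) (trans (cong₂ _*_ (sym aθ) (sym aθ))
            (trans (by₁ (fromℤ a * fromℤ a) (solve 4
                (λ a t x y → (a :* t) :* (a :* t) :- (x :* (a :* (a :* t)) :+ y :* (a :* a)) := (a :* a) :*
                (t :* t :- (x :* t :+ y))) refl (fromℤ a) θ (L - M) (K - M)) θ²)
              (sym (trans (fromℤ-+ (e ℤ.* (a ℤ.* b)) (h ℤ.* (a ℤ.* a)))
                  (cong₂ _+_ (trans (fromℤ-* e (a ℤ.* b)) (cong₂ _*_ fromℤ-e (trans (fromℤ-* a b) (cong (fromℤ a *_) (sym aθ)))))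
                (trans (fromℤ-* h (a ℤ.* a)) (cong₂ _*_ fromℤ-h (fromℤ-* a a)))))))))
          root : ∃[ c ] b ≡ c ℤ.* a
          root = rational-root a b e h a≢0 quadratic

        contradiction : ⊥
        contradiction = decide (a ℤ.≟ ℤ.+ 0)
          where
          decide : Dec (a ≡ ℤ.+ 0) → ⊥
          decide (yes a≡0) = equal a≡0
          decide (no a≢0)  = unequal a≢0

      impossible : ⊥
      impossible = trace-natural P.Eθ λ (f , trθ) → trace-natural P.Eσ λ (g , trσ) → Multiplicities.contradiction f g trθ trσ

open import Data.Nat using (ℕ; _*_; _^_)

theorem0p4 : (v k l m : ℕ) (G : Graph v) → IsSRG G k l m → Exceptional G →
    (F : OrderedField) → (θ : OrderedField.Carrier F) → IsEigenvalue F G θ →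
    θ ≢ OrderedField.fromℕ F k →
    OrderedField._<_ F
    (OrderedField._*_ F (OrderedField.fromℕ F v) (OrderedField._^_ F θ 10))
    (OrderedField.fromℕ F ((2 * k) ^ 10))
theorem0p4 v k l m G srg exceptional F θ eigenvalue θ≢k =
  Reduction.≰⇒< F (Reduction.BadEigenvalue.impossible F G srg exceptional θ eigenvalue θ≢k)
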